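{- Let $k\geqslant 4$ be a fixed integer. Then for even $n$, \[ R_k(C_n)\leqslant \left(k-\frac{1}{4}\right)n + o(n)\,, \] that is, there is a function $f$ with $f(n)/n\to 0$ as $n\to\infty$ such that $R_k(C_n)\leqslant (k-\frac14)n+f(n)$ for all even $n\geqslant 4$.
   Context: $C_n$ denotes the cycle on $n$ vertices. For a graph $F$, the Ramsey number $R_k(F)$ is the least integer $N$ such that every colouring of the edges of the complete graph $K_N$ with $k$ colours contains a monochromatic copy of $F$. -}

module Defs where

open import Data.Nat using (ℕ; zero; suc; _≤_)
open import Data.Fin using (Fin; toℕ)
open import Data.Product using (Σ; _×_)
open import Data.Sum using (_⊎_)
open import Relation.Binary.PropositionalEquality using (_≡_)
open import Function.Definitions using (Injective)

-- Adjacency in the cycle C_n on vertex set Fin n = {0,…,n-1}: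
-- i ~ i+1 and n-1 ~ 0.  (Edges are read as ordered pairs; with a
-- symmetric colouring the orientation is irrelevant.)
CycleAdj : (n : ℕ) → Fin n → Fin n → Set
CycleAdj n i j = (suc (toℕ i) ≡ toℕ j) ⊎ ((suc (toℕ i) ≡ n) × (toℕ j ≡ 0))

-- A k-colouring of the edges of K_N: a symmetric map on pairs of vertices
-- (values on the diagonal are irrelevant, since only edges between
-- distinct vertices are ever inspected).
IsEdgeColouring : (k N : ℕ) → (Fin N → Fin N → Fin k) → Set
IsEdgeColouring k N c = ∀ x y → c x y ≡ c y x

MonoCycle : {k N : ℕ} → (Fin N → Fin N → Fin k) → (n : ℕ) → Fin k → Set
MonoCycle {k} {N} c n col =
  Σ (Fin n → Fin N) λ v →
    Injective _≡_ _≡_ v × (∀ i j → CycleAdj n i j → c (v i) (v j) ≡ col)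

Arrows : (k n N : ℕ) → Set
Arrows k n N =
  (c : Fin N → Fin N → Fin k) → IsEdgeColouring k N c →
  Σ (Fin k) λ col → MonoCycle c n col

-- R_k(C_n) ≤ M  (R_k(C_n) is the least N with Arrows k n N; since the set
-- of such N is upward closed, "least ≤ M" is "some N ≤ M arrows").
RamseyLe : (k n M : ℕ) → Set
RamseyLe k n M = Σ ℕ λ N → (N ≤ M) × Arrows k n N

{-# OPTIONS --safe #-}
-- Kopylov's theorem replaces the regularity lemma. Call a sequence of distinct
-- vertices long if it has n + o(n) members and falls into boundedly many paths.
--
-- (1) A graph on v vertices without a long sequence has, up to o(n²), at most
--     n²/2 edges if v ≤ 5n/4 and at most nv/2 - n²/8 edges otherwise. In an
--     edge-maximal such graph the core of minimum degree just above n/2 is a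
--     clique, say of size s, and peeling off the remaining vertices never meets
--     a degree much larger than n - s. Both claims follow from Ore's exchange;
--     since a sequence with one path too many has fewer than n + o(n) members
--     (drop its shortest path), no connectivity is needed.
--
-- (2) In a C_n-free colour, after deleting o(n²) edges, no component contains a
--     long sequence. Greedily chosen bounded sets dominate almost all vertices;
--     together with a bounded set of reserved edges they contain disjoint
--     connecting paths, of the right parity, between any two vertices of a
--     component. They join the paths of a long sequence to a cycle, and hubs
--     with many common neighbours adjust its length to exactly n.
--
-- (3) Measured in ordered pairs, a colour with a component of size ≥ 5n/4 has
--     at most nN - n²/4 of the N² pairs. Two colours cannot both exceed this
--     bound, because then both essentially partition the vertices into cliques
--     of size about n, and these overlap too much. A single exceptional colour
--     has at most (k-1)n² + (3n/4 + o(n))² pairs. The sum is less than N².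
module Submission where

open import Defs
open import Data.Bool using (Bool; true; false; _∧_; _∨_; not; _xor_; if_then_else_)
import Data.Bool.Properties as Boolₚ
open import Data.Empty using (⊥; ⊥-elim)
open import Data.Fin using (Fin; zero; suc)
import Data.Fin as Fin
import Data.Fin.Properties as Finₚ
open import Data.List using (List; []; _∷_; _++_; length; reverse; map; cartesianProduct; allFin)
open import Data.List.Membership.Propositional using (_∈_; _∉_)
open import Data.List.Membership.Propositional.Properties using (∈-cartesianProduct⁺; ∈-allFin)
open import Data.List.Properties using (length-++; length-map; unfold-reverse; reverse-++; ++-assoc; ∷-injectiveˡ; ∷-injectiveʳ)
open import Data.List.Relation.Binary.Permutation.Propositional using (_↭_; ↭-refl; ↭-sym; ↭-trans; ↭-reflexive; ↭⇒↭ₛ)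
import Data.List.Relation.Binary.Permutation.Propositional.Properties as ↭ₚ
import Data.List.Relation.Binary.Permutation.Setoid.Properties as ↭ₛₚ
open import Data.List.Relation.Binary.Sublist.Propositional using (_⊆_; []; _∷_; _∷ʳ_; ⊆-refl; ⊆-trans; minimum)
open import Data.List.Relation.Binary.Sublist.Propositional.Properties using (All-resp-⊆; ++⁺; ++⁺ˡ)
open import Data.List.Relation.Unary.All as All using (All; []; _∷_)
open import Data.List.Relation.Unary.AllPairs using ([]; _∷_)
open import Data.List.Relation.Unary.Any using (here; there)
import Data.List.Relation.Unary.Any.Properties as Anyₚ
open import Data.List.Relation.Unary.Unique.Propositional using (Unique)
import Data.List.Relation.Unary.Unique.Propositional.Properties as Uniqueₚ
open import Data.Nat
open import Data.Nat.DivMod using (m/n*n≤m; m≡m%n+[m/n]*n; m%n<n)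
open import Data.Nat.Properties
open import Data.Nat.Tactic.RingSolver using (solve-∀)
open import Data.Product using (Σ; ∃; ∃₂; _×_; _,_; proj₁; proj₂)
open import Data.Sum using (_⊎_; inj₁; inj₂; [_,_]′)
open import Data.Vec using (Vec; []; _∷_; lookup; tabulate)
open import Data.Vec.Properties using (lookup∘tabulate)
open import Function using (_∘_; case_of_)
open import Relation.Binary.PropositionalEquality hiding (J)
open import Relation.Nullary using (¬_; Dec; yes; no; does; ¬?; _×-dec_)
open import Relation.Nullary.Decidable using (dec-true; dec-false; _→-dec_; _⊎-dec_)

open import Algebra.Properties.Semiring.Sum +-*-semiring using (sum; sum-cong-≗; ∑-distrib-+; ∑-comm; *-distribˡ-sum; *-distribʳ-sum)

-- The delicate point is the order of the constants. One piece more may cost only `g` vertices,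
-- which asks for 4t = (b + 1)g; joining the pieces takes b + 2 connectors; and yet the edges lost
-- to connectors and hubs must stay below gN. This is possible because the two dominate with
-- different thresholds: `θ₁` fixes the size `ℓ` of a connector, `ℓ` fixes the number `T` of hub
-- levels, and hubs use θ₁ / T, so that all levels together miss at most `θ₁` neighbours of a
-- vertex. All constants except the thresholds and their multiples depend only on k and the
-- precision. Hubs lengthen a cycle by two vertices at a time, so the cycle must be even before it
-- is adjusted. Connecting paths keep the parity of the walk they replace, and the cycle is closed
-- between two vertices joined by an even walk; bipartite components thus need no separate
-- treatment. The value 1/4 is where the count in (3) balances: at N = (k - 1/4)n its main terms add
-- up to exactly N². The `s` further vertices leave a surplus of order `u * (K * s)`, which
-- outweighs the errors once `s` is a large multiple of `g`.

-- A certificate form of linear arithmetic: x ≤ y follows from a ≤ b once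
-- y - x exceeds b - a by the explicit amount c.
lin : ∀ {a b} x y c → a ≤ b → y + a ≡ x + b + c → x ≤ y
lin {a} {b} x y c a≤b eq = +-cancelʳ-≤ a x y (begin
  x + a     ≤⟨ +-monoʳ-≤ x a≤b ⟩
  x + b     ≤⟨ m≤m+n (x + b) c ⟩
  x + b + c ≡⟨ eq ⟨
  y + a     ∎)
  where open ≤-Reasoning

lin⊥ : ∀ {a b} c → a ≤ b → a ≡ b + suc c → ⊥
lin⊥ {a} {b} c a≤b eq = <⇒≱ (subst (b <_) (sym eq) (m<m+n b z<s)) a≤b

-- Boolean indicators, finite sums and cardinalities

⟦_⟧ : Bool → ℕ
⟦ true ⟧ = 1
⟦ false ⟧ = 0

_==_ : ∀ {n} → Fin n → Fin n → Bool
i == j = does (i Fin.≟ j)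

==-refl : ∀ {n} (i : Fin n) → (i == i) ≡ true
==-refl i = dec-true (i Fin.≟ i) refl

==-sound : ∀ {n} {i j : Fin n} → (i == j) ≡ true → i ≡ j
==-sound {i = i} {j} eq with i Fin.≟ j
... | yes p = p

==-sym : ∀ {n} (i j : Fin n) → (i == j) ≡ (j == i)
==-sym i j with i Fin.≟ j
... | yes refl = sym (==-refl i)
... | no i≢j = sym (dec-false (j Fin.≟ i) (i≢j ∘ sym))

==-≢ : ∀ {n} {i j : Fin n} → i ≢ j → (i == j) ≡ false
==-≢ {i = i} {j} = dec-false (i Fin.≟ j)

∧-true : ∀ {a b} → a ∧ b ≡ true → a ≡ true × b ≡ true
∧-true {true} {true} _ = refl , refl

∧-intro : ∀ {a b} → a ≡ true → b ≡ true → a ∧ b ≡ true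
∧-intro refl refl = refl

not-true : ∀ {a} → not a ≡ true → a ≡ false
not-true {false} _ = refl

true≢false : ∀ {a} {A : Set} → a ≡ true → a ≡ false → A
true≢false refl ()

⟦⟧≤1 : ∀ b → ⟦ b ⟧ ≤ 1
⟦⟧≤1 true = ≤-refl
⟦⟧≤1 false = z≤n

⟦⟧-mono : ∀ {a b} → (a ≡ true → b ≡ true) → ⟦ a ⟧ ≤ ⟦ b ⟧
⟦⟧-mono {true} h = ≤-reflexive (cong ⟦_⟧ (sym (h refl)))
⟦⟧-mono {false} h = z≤n

sum-mono : ∀ {n} {f g : Fin n → ℕ} → (∀ i → f i ≤ g i) → sum f ≤ sum g
sum-mono {zero} h = z≤n
sum-mono {suc n} h = +-mono-≤ (h zero) (sum-mono (h ∘ suc))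

sum-const : ∀ n c → sum {n} (λ _ → c) ≡ n * c
sum-const zero c = refl
sum-const (suc n) c = cong (c +_) (sum-const n c)

term≤sum : ∀ {n} (f : Fin n → ℕ) i → f i ≤ sum f
term≤sum f zero = m≤m+n _ _
term≤sum f (suc i) = ≤-trans (term≤sum (f ∘ suc) i) (m≤n+m _ _)

sum-δ : ∀ {n} (f : Fin n → ℕ) j → sum (λ i → ⟦ i == j ⟧ * f i) ≡ f j
sum-δ {suc n} f zero = trans (cong₂ _+_ (*-identityˡ (f zero)) (trans (sum-const n 0) (*-zeroʳ n))) (+-identityʳ _)
sum-δ {suc n} f (suc j) = trans (sum-cong-≗ shift) (sum-δ (f ∘ suc) j)
  where
  shift : ∀ i → ⟦ suc i == suc j ⟧ * f (suc i) ≡ ⟦ i == j ⟧ * f (suc i)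
  shift i with i Fin.≟ j
  ... | yes _ = refl
  ... | no _ = refl

sum-mono-< : ∀ {n} {f g : Fin n → ℕ} → (∀ i → f i ≤ g i) → ∀ j → f j < g j → sum f < sum g
sum-mono-< h zero lt = +-mono-<-≤ lt (sum-mono (h ∘ suc))
sum-mono-< h (suc j) lt = +-mono-≤-< (h zero) (sum-mono-< (h ∘ suc) j lt)

# : ∀ {n} → (Fin n → Bool) → ℕ
# f = sum (λ i → ⟦ f i ⟧)

#≤n : ∀ {n} (f : Fin n → Bool) → # f ≤ n
#≤n {n} f = ≤-trans (sum-mono (λ i → ⟦⟧≤1 (f i))) (≤-reflexive (trans (sum-const n 1) (*-identityʳ n)))

#-mono : ∀ {n} {f g : Fin n → Bool} → (∀ i → f i ≡ true → g i ≡ true) → # f ≤ # g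
#-mono h = sum-mono (λ i → ⟦⟧-mono (h i))

_∖_ : ∀ {n} → (Fin n → Bool) → Fin n → Fin n → Bool
(f ∖ j) i = f i ∧ not (i == j)

#-remove : ∀ {n} (f : Fin n → Bool) j → f j ≡ true → # f ≡ suc (# (f ∖ j))
#-remove f j fj = trans (sum-cong-≗ split) (trans (∑-distrib-+ (λ i → ⟦ i == j ⟧ * 1) (λ i → ⟦ (f ∖ j) i ⟧))
                    (cong (_+ # (f ∖ j)) (sum-δ (λ _ → 1) j)))
  where
  split : ∀ i → ⟦ f i ⟧ ≡ ⟦ i == j ⟧ * 1 + ⟦ (f ∖ j) i ⟧
  split i with i Fin.≟ j
  split i | yes refl rewrite fj = refl
  split i | no _ with f i
  ... | true = refl
  ... | false = refl

#-remove-≤ : ∀ {n} (f : Fin n → Bool) j → # f ≤ ⟦ f j ⟧ + # (f ∖ j)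
#-remove-≤ f j with f j in eq
... | true = ≤-reflexive (#-remove f j eq)
... | false = #-mono keep
  where
  keep : ∀ i → f i ≡ true → (f ∖ j) i ≡ true
  keep i fi = ∧-intro fi (cong not (==-≢ {i = i} {j} λ { refl → true≢false fi eq }))

#-pos : ∀ {n} (f : Fin n → Bool) → 0 < # f → ∃ λ i → f i ≡ true
#-pos {suc n} f lt with f zero in eq
... | true = zero , eq
... | false = let i , p = #-pos (f ∘ suc) lt in suc i , p

countᴸ : ∀ {n} → (Fin n → Bool) → List (Fin n) → ℕ
countᴸ f [] = 0
countᴸ f (x ∷ l) = ⟦ f x ⟧ + countᴸ f l

countᴸ-mono : ∀ {n} {f g : Fin n → Bool} → (∀ i → f i ≡ true → g i ≡ true) → ∀ l → countᴸ f l ≤ countᴸ g l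
countᴸ-mono h [] = z≤n
countᴸ-mono h (x ∷ l) = +-mono-≤ (⟦⟧-mono (h x)) (countᴸ-mono h l)

#≤countᴸ : ∀ {n} (f : Fin n → Bool) l → (∀ i → f i ≡ true → i ∈ l) → # f ≤ countᴸ f l
#≤countᴸ {n} f [] h with # f in eq
... | zero = z≤n
... | suc _ = case h _ (proj₂ (#-pos f (subst (0 <_) (sym eq) z<s))) of λ ()
#≤countᴸ f (x ∷ l) h = ≤-trans (#-remove-≤ f x) (+-monoʳ-≤ ⟦ f x ⟧
    (≤-trans (#≤countᴸ (f ∖ x) l cover) (countᴸ-mono (λ i → proj₁ ∘ ∧-true) l)))
  where
  cover : ∀ i → (f ∖ x) i ≡ true → i ∈ l
  cover i fi with ∧-true {f i} fi
  ... | fi′ , ne with h i fi′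
  ... | here refl = true≢false (==-refl i) (not-true ne)
  ... | there p = p

length≤# : ∀ {n} (f : Fin n → Bool) l → Unique l → All (λ i → f i ≡ true) l → length l ≤ # f
length≤# f [] _ _ = z≤n
length≤# f (x ∷ l) (x∉ ∷ u) (fx ∷ fl) = subst (suc (length l) ≤_) (sym (#-remove f x fx))
    (s≤s (length≤# (f ∖ x) l u (All.zipWith (λ { (ne , fi) → ∧-intro fi (cong not (==-≢ (ne ∘ sym))) }) (x∉ , fl))))

length≤n : ∀ {n} (l : List (Fin n)) → Unique l → length l ≤ n
length≤n l u = ≤-trans (length≤# (λ _ → true) l u (All.universal (λ _ → refl) l)) (#≤n _)

Unique-↭ : ∀ {A : Set} {l l′ : List A} → l ↭ l′ → Unique l → Unique l′
Unique-↭ {A} p = ↭ₛₚ.Unique-resp-↭ (setoid A) (↭⇒↭ₛ p)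

Unique-⊆ : ∀ {A : Set} {l l′ : List A} → l ⊆ l′ → Unique l′ → Unique l
Unique-⊆ [] u = u
Unique-⊆ (_ ∷ʳ p) (_ ∷ u) = Unique-⊆ p u
Unique-⊆ (refl ∷ p) (ne ∷ u) = All-resp-⊆ p ne ∷ Unique-⊆ p u

-- Sequences of vertices cut into paths

module Pieces {N : ℕ} (E : Fin N → Fin N → Bool) where

  private V = Fin N

  -- The number of E-paths into which a sequence of vertices falls when it is
  -- cut between consecutive non-adjacent vertices.
  pieces : List V → ℕ
  pieces [] = 0
  pieces (a ∷ []) = 1
  pieces (a ∷ b ∷ l) = ⟦ not (E a b) ⟧ + pieces (b ∷ l)

  pieces-∷ : ∀ a l → pieces l ≤ pieces (a ∷ l)
  pieces-∷ a [] = z≤n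
  pieces-∷ a (b ∷ l) = m≤n+m _ _

  pieces-∷-≤ : ∀ a l → pieces (a ∷ l) ≤ suc (pieces l)
  pieces-∷-≤ a [] = ≤-refl
  pieces-∷-≤ a (b ∷ l) = +-monoˡ-≤ _ (⟦⟧≤1 _)

  pieces-++ : ∀ l l′ → pieces (l ++ l′) ≤ pieces l + pieces l′
  pieces-++ [] l′ = ≤-refl
  pieces-++ (a ∷ []) l′ = pieces-∷-≤ a l′
  pieces-++ (a ∷ b ∷ l) l′ = ≤-trans (+-monoʳ-≤ ⟦ not (E a b) ⟧ (pieces-++ (b ∷ l) l′))
    (≤-reflexive (sym (+-assoc ⟦ not (E a b) ⟧ _ _)))

  pieces-++ʳ : ∀ l l′ → pieces l′ ≤ pieces (l ++ l′)
  pieces-++ʳ [] l′ = ≤-refl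
  pieces-++ʳ (a ∷ l) l′ = ≤-trans (pieces-++ʳ l l′) (pieces-∷ a (l ++ l′))

  pieces-pos : ∀ b l → 1 ≤ pieces (b ∷ l)
  pieces-pos b [] = ≤-refl
  pieces-pos b (c ∷ l) = ≤-trans (pieces-pos c l) (m≤n+m _ _)

  pieces-++ˡ : ∀ l l′ → pieces l ≤ pieces (l ++ l′)
  pieces-++ˡ [] l′ = z≤n
  pieces-++ˡ (a ∷ []) [] = ≤-refl
  pieces-++ˡ (a ∷ []) (b ∷ l′) = ≤-trans (pieces-pos b l′) (m≤n+m _ _)
  pieces-++ˡ (a ∷ b ∷ l) l′ = +-monoʳ-≤ ⟦ not (E a b) ⟧ (pieces-++ˡ (b ∷ l) l′)

  pieces-join : ∀ l x y l′ → E x y ≡ true →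
    suc (pieces ((l ++ x ∷ []) ++ y ∷ l′)) ≤ pieces (l ++ x ∷ []) + pieces (y ∷ l′)
  pieces-join [] x y l′ e rewrite e = ≤-refl
  pieces-join (a ∷ []) x y l′ e rewrite e = ≤-reflexive (solve₁ ⟦ not (E a x) ⟧ (pieces (y ∷ l′)))
    where solve₁ : ∀ p q → suc (p + (0 + q)) ≡ p + 1 + q
          solve₁ = solve-∀
  pieces-join (a ∷ b ∷ l) x y l′ e =
    ≤-trans (≤-reflexive (sym (+-suc ⟦ not (E a b) ⟧ _)))
      (≤-trans (+-monoʳ-≤ ⟦ not (E a b) ⟧ (pieces-join (b ∷ l) x y l′ e))
        (≤-reflexive (sym (+-assoc ⟦ not (E a b) ⟧ _ _))))

  pieces-reverse : (∀ x y → E x y ≡ E y x) → ∀ l → pieces (reverse l) ≤ pieces l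
  pieces-reverse s [] = z≤n
  pieces-reverse s (a ∷ []) = ≤-refl
  pieces-reverse s (a ∷ b ∷ l) = subst (λ m → pieces m ≤ pieces (a ∷ b ∷ l)) (sym (unfold-reverse a (b ∷ l)))
      (snoc (pieces-reverse s (b ∷ l)))
    where
    snoc : pieces (reverse (b ∷ l)) ≤ pieces (b ∷ l) → pieces (reverse (b ∷ l) ++ a ∷ []) ≤ pieces (a ∷ b ∷ l)
    snoc ih with E a b in eq
    ... | false = ≤-trans (pieces-++ (reverse (b ∷ l)) (a ∷ [])) (≤-trans (≤-reflexive (+-comm _ 1)) (s≤s ih))
    ... | true = s≤s⁻¹ (≤-trans step (≤-trans (≤-reflexive (+-comm _ 1)) (s≤s ih)))
      where
      step : suc (pieces (reverse (b ∷ l) ++ a ∷ [])) ≤ pieces (reverse (b ∷ l)) + 1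
      step rewrite unfold-reverse b l = pieces-join (reverse l) b a [] (trans (s b a) eq)

  first-piece : ∀ a l → ∃₂ λ l₁ l₂ →
    l ≡ l₁ ++ l₂ × pieces (a ∷ l₁) ≡ 1 × pieces (a ∷ l) ≡ suc (pieces l₂)
  first-piece a [] = [] , [] , refl , refl , refl
  first-piece a (b ∷ l) with E a b in eq
  ... | false = [] , b ∷ l , refl , refl , refl
  ... | true with first-piece b l
  ... | l₁ , l₂ , refl , one , cnt =
    b ∷ l₁ , l₂ , refl , trans (cong (λ e → ⟦ not e ⟧ + pieces (b ∷ l₁)) eq) one , cnt

  -- The shortest piece need not be located: the first piece is discarded if it is no longer than
  -- average; otherwise it is kept, and the average of the rest only drops.
  drop-piece : ∀ b l → pieces l ≤ suc b →
    ∃ λ l′ → l′ ⊆ l × pieces l′ ≤ b × b * length l ≤ suc b * length l′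
  drop-piece zero l _ = [] , minimum l , z≤n , z≤n
  drop-piece (suc b) [] _ = [] , [] , z≤n , ≤-reflexive (trans (*-zeroʳ (suc b)) (sym (*-zeroʳ (suc (suc b)))))
  drop-piece (suc b) (a ∷ l) h with first-piece a l
  ... | l₁ , l₂ , refl , one , cnt with suc (suc b) * length (a ∷ l₁) ≤? length (a ∷ l₁) + length l₂
  ... | yes short = l₂ , ++⁺ˡ (a ∷ l₁) ⊆-refl , s≤s⁻¹ (subst (_≤ suc (suc b)) cnt h) ,
      subst (λ L → suc b * L ≤ suc (suc b) * length l₂) (sym (length-++ (a ∷ l₁)))
        (lin _ _ 0 short (idn b (length (a ∷ l₁)) (length l₂)))
    where
    idn : ∀ b p q → suc (suc b) * q + suc (suc b) * p ≡ suc b * (p + q) + (p + q) + 0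
    idn = solve-∀
  ... | no long with drop-piece b l₂ (s≤s⁻¹ (subst (_≤ suc (suc b)) cnt h))
  ... | l₂′ , sub , few , big = (a ∷ l₁) ++ l₂′ , ++⁺ (⊆-refl {x = a ∷ l₁}) sub ,
      ≤-trans (pieces-++ (a ∷ l₁) l₂′) (subst (λ o → o + pieces l₂′ ≤ suc b) (sym one) (s≤s few)) ,
      subst₂ (λ L L′ → suc b * L ≤ suc (suc b) * L′) (sym (length-++ (a ∷ l₁))) (sym (length-++ (a ∷ l₁)))
        (*-cancelˡ-≤ (suc b) (lin _ _ 0
          (+-mono-≤ (<⇒≤ (≰⇒> long)) (*-monoʳ-≤ (suc (suc b)) big))
          (idn b (length (a ∷ l₁)) (length l₂) (length l₂′))))
    where
    idn : ∀ b p q r → suc b * (suc (suc b) * (p + r)) + (p + q + suc (suc b) * (b * q))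
        ≡ suc b * (suc b * (p + q)) + (suc (suc b) * p + suc (suc b) * (suc b * r)) + 0
    idn = solve-∀

  -- Cutting a closed sequence at one of its breaks saves a piece.
  cut-closed : ∀ b a l u → E u a ≡ true → pieces (a ∷ (l ++ u ∷ [])) ≤ suc (suc b) →
    ∃ λ l′ → (a ∷ (l ++ u ∷ [])) ↭ l′ × pieces l′ ≤ suc b
  cut-closed b a l u e h with first-piece a (l ++ u ∷ [])
  ... | l₁ , [] , eq , one , cnt = _ , ↭-refl , subst (_≤ suc b) (sym cnt) (s≤s z≤n)
  ... | l₁ , y ∷ l₂ , eq , one , cnt with ends l₁ l eq
    where
    ends : ∀ l₁ l → l ++ u ∷ [] ≡ l₁ ++ y ∷ l₂ → ∃ λ l₃ → y ∷ l₂ ≡ l₃ ++ u ∷ []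
    ends [] l eq = l , sym eq
    ends (x ∷ []) [] ()
    ends (x ∷ z ∷ l₁) [] ()
    ends (x ∷ l₁) (z ∷ l) eq = ends l₁ l (∷-injectiveʳ eq)
  ... | l₃ , eq₃ = (y ∷ l₂) ++ (a ∷ l₁) , perm , s≤s⁻¹ (≤-trans small h)
    where
    perm : (a ∷ (l ++ u ∷ [])) ↭ (y ∷ l₂) ++ (a ∷ l₁)
    perm = ↭-trans (↭-reflexive (cong (a ∷_) eq)) (↭ₚ.++-comm (a ∷ l₁) (y ∷ l₂))
    small : suc (pieces ((y ∷ l₂) ++ a ∷ l₁)) ≤ pieces (a ∷ (l ++ u ∷ []))
    small = begin
      suc (pieces ((y ∷ l₂) ++ a ∷ l₁))        ≡⟨ cong (λ m → suc (pieces (m ++ a ∷ l₁))) eq₃ ⟩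
      suc (pieces ((l₃ ++ u ∷ []) ++ a ∷ l₁))  ≤⟨ pieces-join l₃ u a l₁ e ⟩
      pieces (l₃ ++ u ∷ []) + pieces (a ∷ l₁)  ≡⟨ cong₂ _+_ (cong pieces (sym eq₃)) one ⟩
      pieces (y ∷ l₂) + 1                      ≡⟨ +-comm _ 1 ⟩
      suc (pieces (y ∷ l₂))                    ≡⟨ cnt ⟨
      pieces (a ∷ (l ++ u ∷ []))               ∎
      where open ≤-Reasoning

-- Ore's count. Move the positions counted by `g` one place forward towards the head: if they avoid
-- those counted by `f`, both fit into the places of the sequence. Hence `g` is not counted at the
-- head, which has no predecessor.
consecutive : ∀ {N} (f g : Fin N → Bool) a l →
  (∃₂ λ l₁ x → ∃₂ λ y l₂ → a ∷ l ≡ l₁ ++ x ∷ y ∷ l₂ × f x ≡ true × g y ≡ true)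
  ⊎ countᴸ f (a ∷ l) + countᴸ g l ≤ suc (length l)
consecutive f g a [] = inj₂ (≤-trans (≤-reflexive (trans (+-identityʳ _) (+-identityʳ _))) (⟦⟧≤1 (f a)))
consecutive f g a (b ∷ l) with consecutive f g b l
... | inj₁ (l₁ , x , y , l₂ , eq , p) = inj₁ (a ∷ l₁ , x , y , l₂ , cong (a ∷_) eq , p)
... | inj₂ h with f a in fa | g b in gb
... | true | true = inj₁ ([] , a , b , l , refl , fa , gb)
... | true | false = inj₂ (s≤s h)
... | false | false = inj₂ (m≤n⇒m≤1+n h)
... | false | true = inj₂ (≤-trans (≤-reflexive (+-suc _ _)) (s≤s h))

-- Degrees, peeling and Ore's exchange

VSet : ℕ → Set
VSet N = Fin N → Bool

Graph : ℕ → Set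
Graph N = Fin N → Fin N → Bool

module _ {N : ℕ} where

  open import Data.List.Membership.DecPropositional (Fin._≟_ {N}) using (_∈?_)

  private V = Fin N

  deg : Graph N → VSet N → V → ℕ
  deg E X u = # (λ y → X y ∧ E u y)

  edges : Graph N → VSet N → ℕ
  edges E S = sum (λ x → sum (λ y → ⟦ S x ∧ (S y ∧ E x y) ⟧))

  deg-mono : ∀ E {X Y : VSet N} → (∀ v → X v ≡ true → Y v ≡ true) → ∀ u → deg E X u ≤ deg E Y u
  deg-mono E X⊆Y u = #-mono λ v p → let xv , e = ∧-true p in ∧-intro (X⊆Y v xv) e

  edges≤#² : ∀ E S → edges E S ≤ # S * # S
  edges≤#² E S = ≤-trans (sum-mono row) (≤-reflexive (sym (*-distribʳ-sum (# S) (λ x → ⟦ S x ⟧))))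
    where
    row : ∀ x → sum (λ y → ⟦ S x ∧ (S y ∧ E x y) ⟧) ≤ ⟦ S x ⟧ * # S
    row x with S x
    ... | true = ≤-trans (#-mono {f = λ y → S y ∧ E x y} {S} (λ y → proj₁ ∘ ∧-true)) (≤-reflexive (sym (+-identityʳ (# S))))
    ... | false = ≤-reflexive (trans (sum-const N 0) (*-zeroʳ N))

  -- Ordered pairs are counted, so a vertex takes away both its row and its column.
  edges-remove : ∀ E S → (∀ x y → E x y ≡ E y x) → ∀ w → edges E S ≤ edges E (S ∖ w) + 2 * deg E S w
  edges-remove E S symm w = begin
    edges E S
      ≤⟨ sum-mono (λ x → sum-mono (λ y → cell x y)) ⟩
    sum (λ x → sum (λ y → ⟦ (S ∖ w) x ∧ ((S ∖ w) y ∧ E x y) ⟧ + (⟦ x == w ⟧ * r y + ⟦ y == w ⟧ * r x)))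
      ≡⟨ sum-cong-≗ (λ x → trans (∑-distrib-+ (c x) (λ y → ⟦ x == w ⟧ * r y + ⟦ y == w ⟧ * r x))
           (cong (sum (c x) +_) (trans (∑-distrib-+ (λ y → ⟦ x == w ⟧ * r y) (λ y → ⟦ y == w ⟧ * r x))
             (cong₂ _+_ (sym (*-distribˡ-sum ⟦ x == w ⟧ r)) (sum-δ (λ _ → r x) w))))) ⟩
    sum (λ x → sum (λ y → ⟦ (S ∖ w) x ∧ ((S ∖ w) y ∧ E x y) ⟧) + (⟦ x == w ⟧ * D + r x))
      ≡⟨ ∑-distrib-+ (λ x → sum (λ y → ⟦ (S ∖ w) x ∧ ((S ∖ w) y ∧ E x y) ⟧)) (λ x → ⟦ x == w ⟧ * D + r x) ⟩
    edges E (S ∖ w) + sum (λ x → ⟦ x == w ⟧ * D + r x)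
      ≡⟨ cong (edges E (S ∖ w) +_) (trans (∑-distrib-+ (λ x → ⟦ x == w ⟧ * D) r)
           (cong₂ _+_ (sum-δ (λ _ → D) w) (sym (+-identityʳ D)))) ⟩
    edges E (S ∖ w) + 2 * D ∎
    where
    open ≤-Reasoning
    r : V → ℕ
    r y = ⟦ S y ∧ E w y ⟧
    D = deg E S w
    c : V → V → ℕ
    c x y = ⟦ (S ∖ w) x ∧ ((S ∖ w) y ∧ E x y) ⟧
    cell : ∀ x y → ⟦ S x ∧ (S y ∧ E x y) ⟧ ≤
      ⟦ (S ∖ w) x ∧ ((S ∖ w) y ∧ E x y) ⟧ + (⟦ x == w ⟧ * r y + ⟦ y == w ⟧ * r x)
    cell x y with x Fin.≟ w | y Fin.≟ w
    ... | yes refl | _ with S w | S y ∧ E w y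
    ...   | true | b = ≤-trans (≤-reflexive (sym (+-identityʳ ⟦ b ⟧))) (m≤m+n (⟦ b ⟧ + 0) _)
    ...   | false | _ = z≤n
    cell x y | no _ | yes refl rewrite symm x w with S x | S w
    ...   | true | true = ≤-reflexive (sym (+-identityʳ ⟦ E w x ⟧))
    ...   | true | false = z≤n
    ...   | false | _ = z≤n
    cell x y | no _ | no _ with S x | S y
    ...   | true | true = m≤m+n _ _
    ...   | true | false = z≤n
    ...   | false | _ = z≤n

  -- Vertices outside K of degree below d are removed one at a time until
  -- either no such vertex is left or only c vertices remain.
  peel : ∀ E → (∀ x y → E x y ≡ E y x) → ∀ (K S : VSet N) → (∀ v → K v ≡ true → S v ≡ true) →
    ∀ d c j → # S ≡ c + j →
    (∃ λ (H : VSet N) → (∀ v → K v ≡ true → H v ≡ true) × (∀ v → H v ≡ true → S v ≡ true) × c < # H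
      × (∀ v → H v ≡ true → K v ≡ false → d ≤ deg E H v)
      × (∀ v → S v ≡ true → H v ≡ false → deg E H v < d))
    ⊎ edges E S ≤ c * c + 2 * d * j
  peel E symm K S K⊆S d c zero size =
    inj₂ (≤-trans (edges≤#² E S) (≤-trans (≤-reflexive (cong (λ s → s * s) (trans size (+-identityʳ c)))) (m≤m+n _ _)))
  peel E symm K S K⊆S d c (suc j) size
    with Finₚ.any? (λ w → (S w ∧ not (K w)) Boolₚ.≟ true ×-dec (deg E S w <? d))
  ... | no none = inj₁ (S , K⊆S , (λ _ s → s) , subst (c <_) (sym size) (m<m+n c z<s) ,
          (λ v s k → ≮⇒≥ λ lt → none (v , ∧-intro s (cong not k) , lt)) , (λ v s s′ → true≢false s s′))
  ... | yes (w , cond , low) with peel E symm K (S ∖ w) K⊆′ d c j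
          (suc-injective (trans (sym (#-remove S w (proj₁ (∧-true cond)))) (trans size (+-suc c j))))
    where
    K⊆′ : ∀ v → K v ≡ true → (S ∖ w) v ≡ true
    K⊆′ v k = ∧-intro (K⊆S v k) (cong not (==-≢ {i = v} {w} λ { refl → true≢false k (not-true (proj₂ (∧-true {S v} cond))) }))
  ... | inj₁ (H , K⊆H , H⊆ , c<H , high , lowH) =
    inj₁ (H , K⊆H , (λ v h → proj₁ (∧-true (H⊆ v h))) , c<H , high , lowH′)
    where
    lowH′ : ∀ v → S v ≡ true → H v ≡ false → deg E H v < d
    lowH′ v s h with v Fin.≟ w
    ... | yes refl = ≤-<-trans (deg-mono E (λ x hx → proj₁ (∧-true (H⊆ x hx))) v) low
    ... | no v≢w = lowH v (∧-intro s (cong not (==-≢ v≢w))) h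
  ... | inj₂ few = inj₂ (begin
      edges E S                           ≤⟨ edges-remove E S symm w ⟩
      edges E (S ∖ w) + 2 * deg E S w     ≤⟨ +-mono-≤ few (*-monoʳ-≤ 2 (<⇒≤ low)) ⟩
      c * c + 2 * d * j + 2 * d           ≡⟨ idn c d j ⟩
      c * c + 2 * d * suc j               ∎)
    where
    open ≤-Reasoning
    idn : ∀ c d j → c * c + 2 * d * j + 2 * d ≡ c * c + 2 * d * suc j
    idn = solve-∀

  Covered : Graph N → VSet N → ℕ → ℕ → Set
  Covered E S n B = ∃ λ l → Unique l × All (λ v → S v ≡ true) l × n ≤ length l × Pieces.pieces E l ≤ B

  module _ (E : Graph N) (symm : ∀ x y → E x y ≡ E y x) where

    open Pieces E

    pieces-split : ∀ l l′ → pieces l + pieces l′ ≤ suc (pieces (l ++ l′))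
    pieces-split [] l′ = n≤1+n _
    pieces-split (a ∷ []) l′ = s≤s (pieces-∷ a l′)
    pieces-split (a ∷ b ∷ l) l′ = ≤-trans (≤-reflexive (+-assoc ⟦ not (E a b) ⟧ _ _))
      (≤-trans (+-monoʳ-≤ ⟦ not (E a b) ⟧ (pieces-split (b ∷ l) l′)) (≤-reflexive (+-suc _ _)))

    -- Ore's exchange: u x and w y close the sequence up after reversing its end.
    exchange : ∀ {b} w M u l₁ x y l₂ → w ∷ (M ++ u ∷ []) ≡ l₁ ++ x ∷ y ∷ l₂ →
      E u x ≡ true → E w y ≡ true → pieces (w ∷ (M ++ u ∷ [])) ≤ suc (suc b) →
      ∃ λ l′ → (w ∷ (M ++ u ∷ [])) ↭ l′ × pieces l′ ≤ suc b
    exchange {b} w M u l₁ x y l₂ eq ux wy few with front l₁ eq | back l₁ (w ∷ M) eq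
      where
      front : ∀ l₁ → w ∷ (M ++ u ∷ []) ≡ l₁ ++ x ∷ y ∷ l₂ → ∃ λ r → l₁ ++ x ∷ [] ≡ w ∷ r
      front [] eq = [] , cong (_∷ []) (sym (∷-injectiveˡ eq))
      front (z ∷ l) eq = l ++ x ∷ [] , cong (_∷ (l ++ x ∷ [])) (sym (∷-injectiveˡ eq))
      back : ∀ l₁ M → M ++ u ∷ [] ≡ l₁ ++ x ∷ y ∷ l₂ → ∃ λ l₃ → y ∷ l₂ ≡ l₃ ++ u ∷ []
      back [] [] ()
      back [] (m ∷ M) eq = M , sym (∷-injectiveʳ eq)
      back (z ∷ []) [] ()
      back (z ∷ _ ∷ _) [] ()
      back (z ∷ l₁) (m ∷ M) eq = back l₁ M (∷-injectiveʳ eq)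
    ... | r , eqr | l₃ , eq₃ with cut-closed b w (r ++ reverse l₂) y (trans (symm y w) wy)
            (subst (λ m → pieces m ≤ suc (suc b)) shape (≤-trans (s≤s⁻¹ bound) few))
      where
      C = (l₁ ++ x ∷ []) ++ reverse (y ∷ l₂)
      shape : C ≡ w ∷ ((r ++ reverse l₂) ++ y ∷ [])
      shape = trans (cong₂ _++_ eqr (unfold-reverse y l₂)) (cong (w ∷_) (sym (++-assoc r (reverse l₂) (y ∷ []))))
      rev : reverse (y ∷ l₂) ≡ u ∷ reverse l₃
      rev = trans (cong reverse eq₃) (reverse-++ l₃ (u ∷ []))
      Q≡ : (l₁ ++ x ∷ []) ++ y ∷ l₂ ≡ w ∷ (M ++ u ∷ [])
      Q≡ = trans (++-assoc l₁ (x ∷ []) (y ∷ l₂)) (sym eq)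
      bound : suc (pieces C) ≤ suc (pieces (w ∷ (M ++ u ∷ [])))
      bound = begin
        suc (pieces C)                                            ≡⟨ cong (λ m → suc (pieces ((l₁ ++ x ∷ []) ++ m))) rev ⟩
        suc (pieces ((l₁ ++ x ∷ []) ++ u ∷ reverse l₃))           ≤⟨ pieces-join l₁ x u (reverse l₃) (trans (symm x u) ux) ⟩
        pieces (l₁ ++ x ∷ []) + pieces (u ∷ reverse l₃)           ≡⟨ cong (λ m → pieces (l₁ ++ x ∷ []) + pieces m) rev ⟨
        pieces (l₁ ++ x ∷ []) + pieces (reverse (y ∷ l₂))         ≤⟨ +-monoʳ-≤ (pieces (l₁ ++ x ∷ [])) (pieces-reverse symm (y ∷ l₂)) ⟩
        pieces (l₁ ++ x ∷ []) + pieces (y ∷ l₂)                   ≤⟨ pieces-split (l₁ ++ x ∷ []) (y ∷ l₂) ⟩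
        suc (pieces ((l₁ ++ x ∷ []) ++ y ∷ l₂))                   ≡⟨ cong (suc ∘ pieces) Q≡ ⟩
        suc (pieces (w ∷ (M ++ u ∷ [])))                          ∎
        where open ≤-Reasoning
    ... | l′ , perm , few′ = l′ , ↭-trans (↭-trans (↭-reflexive Q≡) flip) perm , few′
      where
      Q≡ : w ∷ (M ++ u ∷ []) ≡ (l₁ ++ x ∷ []) ++ y ∷ l₂
      Q≡ = trans eq (sym (++-assoc l₁ (x ∷ []) (y ∷ l₂)))
      flip : (l₁ ++ x ∷ []) ++ y ∷ l₂ ↭ w ∷ ((r ++ reverse l₂) ++ y ∷ [])
      flip = ↭-trans (↭ₚ.++⁺ˡ (l₁ ++ x ∷ []) (↭-sym (↭ₚ.↭-reverse (y ∷ l₂))))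
        (↭-reflexive (trans (cong₂ _++_ eqr (unfold-reverse y l₂)) (cong (w ∷_) (sym (++-assoc r (reverse l₂) (y ∷ []))))))

    module _ (S : VSet N) (n b g : ℕ) (n≡ : n ≡ suc b * g) (bare : ¬ Covered E S n (suc b)) where

      -- A sequence of n + g = (b + 2)g members in b + 2 pieces would still have n members after
      -- losing its shortest piece.
      short : ∀ Q → Unique Q → All (λ v → S v ≡ true) Q → pieces Q ≤ suc (suc b) → length Q < n + g
      short Q uq sq few with drop-piece (suc b) Q few
      ... | l , sub , few′ , big = ≰⇒> λ long → lin⊥ _ (≤-trans (*-monoʳ-≤ (suc b) long) (≤-trans big
              (*-monoʳ-≤ (suc (suc b)) (<⇒≤pred small)))) (idn n small n≡)
        where
        small : length l < n
        small = ≰⇒> λ le → bare (l , Unique-⊆ sub uq , All-resp-⊆ sub sq , le , few′)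
        idn : ∀ n {m} → m < n → n ≡ suc b * g → suc b * (n + g) ≡ suc (suc b) * pred n + suc (suc b)
        idn (suc n) _ eq = trans (*-distribˡ-+ (suc b) (suc n) g) (trans (cong (suc b * suc n +_) (sym eq)) (ring b n))
          where
          ring : ∀ b n → suc b * suc n + suc n ≡ suc (suc b) * n + suc (suc b)
          ring = solve-∀

      -- The ends of the sequence are pushed outwards, `u` through `X` and `w` through `Y`, while
      -- `f` bounds the steps left. When neither can move, their neighbours in `X` and `Y` all lie
      -- on the sequence, which has fewer than n + g members; so two of them are placed as the
      -- exchange needs, and it saves a piece, against `bare`. Two sets are carried because the core
      -- and its surroundings have different degree bounds.
      cross : ∀ X Y α β → (∀ v → X v ≡ true → S v ≡ true) → (∀ v → Y v ≡ true → S v ≡ true) →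
        (∀ u → X u ≡ true → α ≤ deg E X u) → (∀ w → Y w ≡ true → β ≤ deg E Y w) → n + g + 1 ≤ α + β →
        ∀ f w M u → let Q = w ∷ (M ++ u ∷ []) in
        Unique Q → All (λ v → S v ≡ true) Q → N ≤ length Q + f → n ≤ length Q → Y w ≡ true → X u ≡ true →
        pieces Q ≤ suc (suc b) → ⊥
      cross X Y α β X⊆ Y⊆ degX degY αβ f w M u uq sq fuel long yw xu few
        with Finₚ.any? (λ v → (X v ∧ E u v) Boolₚ.≟ true ×-dec ¬? (v ∈? (w ∷ (M ++ u ∷ []))))
           | Finₚ.any? (λ v → (Y v ∧ E w v) Boolₚ.≟ true ×-dec ¬? (v ∈? (w ∷ (M ++ u ∷ []))))
      ... | yes (v , xe , v∉) | _ = grow f fuel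
        where
        Q = w ∷ (M ++ u ∷ [])
        xv = proj₁ (∧-true xe)
        perm : v ∷ Q ↭ w ∷ ((M ++ u ∷ []) ++ v ∷ [])
        perm = ↭ₚ.∷↭∷ʳ v Q
        uq′ = Unique-↭ perm (All.tabulate (λ { p refl → v∉ p }) ∷ uq)
        few′ : pieces (w ∷ ((M ++ u ∷ []) ++ v ∷ [])) ≤ suc (suc b)
        few′ = s≤s⁻¹ (≤-trans (pieces-join (w ∷ M) u v [] (proj₂ (∧-true {X v} xe)))
                 (≤-trans (≤-reflexive (+-comm _ 1)) (s≤s few)))
        len : length (w ∷ ((M ++ u ∷ []) ++ v ∷ [])) ≡ suc (length Q)
        len = sym (↭ₚ.↭-length perm)
        grow : ∀ f → N ≤ length Q + f → ⊥
        grow zero fuel = <⇒≱ (subst (_≤ N) len (length≤n _ uq′)) (subst (N ≤_) (+-identityʳ _) fuel)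
        grow (suc f) fuel = cross X Y α β X⊆ Y⊆ degX degY αβ f w (M ++ u ∷ []) v uq′
          (↭ₚ.All-resp-↭ perm (X⊆ v xv ∷ sq))
          (subst (λ m → N ≤ m + f) (sym len) (subst (N ≤_) (+-suc _ f) fuel))
          (≤-trans long (subst (length Q ≤_) (sym len) (n≤1+n _))) yw xv few′
      ... | no _ | yes (v , ye , v∉) = grow f fuel
        where
        Q = w ∷ (M ++ u ∷ [])
        yv = proj₁ (∧-true ye)
        uq′ : Unique (v ∷ Q)
        uq′ = All.tabulate (λ { p refl → v∉ p }) ∷ uq
        few′ : pieces (v ∷ Q) ≤ suc (suc b)
        few′ = subst (λ e → ⟦ not e ⟧ + pieces Q ≤ suc (suc b))
                 (sym (trans (symm v w) (proj₂ (∧-true {Y v} ye)))) few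
        grow : ∀ f → N ≤ length Q + f → ⊥
        grow zero fuel = <⇒≱ (length≤n _ uq′) (subst (N ≤_) (+-identityʳ _) fuel)
        grow (suc f) fuel = cross X Y α β X⊆ Y⊆ degX degY αβ f v (w ∷ M) u uq′
          (Y⊆ v yv ∷ sq) (subst (N ≤_) (+-suc _ f) fuel) (m≤n⇒m≤1+n long) yv xu few′
      ... | no noX | no noY with consecutive (E u) (E w) w (M ++ u ∷ [])
      ...   | inj₁ (l₁ , x , y , l₂ , eq , ux , wy) with exchange w M u l₁ x y l₂ eq ux wy few
      ...     | l′ , perm , few′ = bare (l′ , Unique-↭ perm uq , ↭ₚ.All-resp-↭ perm sq ,
                  subst (n ≤_) (↭ₚ.↭-length perm) long , few′)
      cross X Y α β X⊆ Y⊆ degX degY αβ f w M u uq sq fuel long yw xu few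
        | no noX | no noY | inj₂ small =
        <⇒≱ (short Q uq sq few) (+-cancelʳ-≤ 1 _ _ (≤-trans αβ (≤-trans (+-mono-≤ cα cβ)
          (≤-trans (≤-reflexive (+-suc _ _)) (≤-trans (s≤s small) (≤-reflexive (+-comm 1 _)))))))
        where
        Q = w ∷ (M ++ u ∷ [])
        inQ : ∀ (X : VSet N) u → ¬ (∃ λ v → (X v ∧ E u v) ≡ true × v ∉ Q) → ∀ v → (X v ∧ E u v) ≡ true → v ∈ Q
        inQ X u none v p with v ∈? Q
        ... | yes q = q
        ... | no q = ⊥-elim (none (v , p , q))
        cα : α ≤ countᴸ (E u) Q
        cα = ≤-trans (degX u xu) (≤-trans (#≤countᴸ _ Q (inQ X u noX)) (countᴸ-mono (λ v → proj₂ ∘ ∧-true {X v}) Q))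
        -- The head `w` is left out of the count and, as loops are not excluded, may be its own
        -- neighbour: hence the 1 in `n + g + 1`.
        cβ : β ≤ suc (countᴸ (E w) (M ++ u ∷ []))
        cβ = ≤-trans (degY w yw) (≤-trans (#≤countᴸ _ Q (inQ Y w noY))
               (≤-trans (countᴸ-mono (λ v → proj₂ ∘ ∧-true {Y v}) Q) (+-monoˡ-≤ _ (⟦⟧≤1 (E w w)))))

-- Added edges and the shape of the edge bound

enumerate : ∀ {N} s (f : VSet N) → # f ≡ s → ∃ λ l → Unique l × All (λ v → f v ≡ true) l × length l ≡ s
enumerate zero f eq = [] , [] , [] , refl
enumerate (suc s) f eq with #-pos f (subst (0 <_) (sym eq) z<s)
... | v , fv with enumerate s (f ∖ v) (suc-injective (trans (sym (#-remove f v fv)) eq))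
... | l , ul , al , len = v ∷ l , All.map (λ p → λ { refl → true≢false (==-refl v) (not-true (proj₂ (∧-true {f v} p))) }) al ∷ ul ,
    fv ∷ All.map (proj₁ ∘ ∧-true) al , cong suc len

module _ {N : ℕ} where

  private V = Fin N

  clique-pieces : ∀ (E : Graph N) (K : VSet N) → (∀ u w → K u ≡ true → K w ≡ true → u ≢ w → E u w ≡ true) →
    ∀ l → Unique l → All (λ v → K v ≡ true) l → Pieces.pieces E l ≤ 1
  clique-pieces E K cl [] _ _ = z≤n
  clique-pieces E K cl (a ∷ []) _ _ = ≤-refl
  clique-pieces E K cl (a ∷ b ∷ l) ((a≢b ∷ _) ∷ u) (ka ∷ kb ∷ kl) rewrite cl a b ka kb a≢b =
    clique-pieces E K cl (b ∷ l) u (kb ∷ kl)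

  isPair : V → V → V → V → Bool
  isPair u w x y = ((x == u) ∧ (y == w)) ∨ ((x == w) ∧ (y == u))

  addEdge : V → V → Graph N → Graph N
  addEdge u w E x y = E x y ∨ isPair u w x y

  isPair-sound : ∀ u w x y → isPair u w x y ≡ true → (x ≡ u × y ≡ w) ⊎ (x ≡ w × y ≡ u)
  isPair-sound u w x y p with (x == u) ∧ (y == w) in eq
  ... | true = let a , b = ∧-true {x == u} eq in inj₁ (==-sound a , ==-sound b)
  ... | false = let a , b = ∧-true {x == w} p in inj₂ (==-sound a , ==-sound b)

  isPair-sym : ∀ u w x y → isPair u w x y ≡ isPair u w y x
  isPair-sym u w x y = trans (Boolₚ.∨-comm ((x == u) ∧ (y == w)) _)
    (cong₂ _∨_ (Boolₚ.∧-comm (x == w) _) (Boolₚ.∧-comm (x == u) _))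

  addEdge-sym : ∀ u w {E : Graph N} → (∀ x y → E x y ≡ E y x) → ∀ x y → addEdge u w E x y ≡ addEdge u w E y x
  addEdge-sym u w symm x y = cong₂ _∨_ (symm x y) (isPair-sym u w x y)

  addEdge-⊇ : ∀ u w (E : Graph N) x y → E x y ≡ true → addEdge u w E x y ≡ true
  addEdge-⊇ u w E x y e rewrite e = refl

  total : Graph N → ℕ
  total E = sum (λ x → sum (λ y → ⟦ E x y ⟧))

  total≤ : ∀ E → total E ≤ N * N
  total≤ E = ≤-trans (sum-mono (λ x → #≤n (E x))) (≤-reflexive (sum-const N N))

  total-addEdge : ∀ u w E → E u w ≡ false → total E < total (addEdge u w E)
  total-addEdge u w E e = sum-mono-< (λ x → #-mono (addEdge-⊇ u w E x)) u
    (sum-mono-< (λ y → ⟦⟧-mono (addEdge-⊇ u w E u y)) w (subst₂ (λ a b → ⟦ a ⟧ < ⟦ b ⟧) (sym e) (sym new) z<s))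
    where
    new : addEdge u w E u w ≡ true
    new rewrite ==-refl u | ==-refl w = Boolₚ.∨-zeroʳ _

  edges-addEdge : ∀ u w E S → edges E S ≤ edges (addEdge u w E) S
  edges-addEdge u w E S = sum-mono λ x → sum-mono λ y → ⟦⟧-mono λ p →
    let sx , q = ∧-true {S x} p ; sy , e = ∧-true {S y} q in ∧-intro sx (∧-intro sy (addEdge-⊇ u w E x y e))

  pieces-fresh : ∀ u w E a l → a ≡ u ⊎ a ≡ w → a ∉ l → Pieces.pieces E l ≤ Pieces.pieces (addEdge u w E) l
  pieces-fresh u w E a [] _ _ = z≤n
  pieces-fresh u w E a (x ∷ []) _ _ = ≤-refl
  pieces-fresh u w E a (x ∷ y ∷ l) end a∉ = +-mono-≤ (≤-reflexive (cong (⟦_⟧ ∘ not) (same end)))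
      (pieces-fresh u w E a (y ∷ l) end (a∉ ∘ there))
    where
    same : a ≡ u ⊎ a ≡ w → E x y ≡ addEdge u w E x y
    same end with isPair u w x y in eq
    ... | false = sym (Boolₚ.∨-identityʳ _)
    ... | true with isPair-sound u w x y eq | end
    ...   | inj₁ (refl , refl) | inj₁ refl = ⊥-elim (a∉ (here refl))
    ...   | inj₁ (refl , refl) | inj₂ refl = ⊥-elim (a∉ (there (here refl)))
    ...   | inj₂ (refl , refl) | inj₁ refl = ⊥-elim (a∉ (there (here refl)))
    ...   | inj₂ (refl , refl) | inj₂ refl = ⊥-elim (a∉ (here refl))

  -- A sequence of distinct vertices uses the new edge at most once. Cutting there gives two
  -- sequences whose facing ends are `u` and `w`, and the number of pieces rises by at most one.
  pieces-addEdge : ∀ u w E a l → Unique (a ∷ l) → let open Pieces in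
    pieces E (a ∷ l) ≤ pieces (addEdge u w E) (a ∷ l)
    ⊎ (∃₂ λ l₁ p → ∃₂ λ r l₂ → a ∷ l ≡ l₁ ++ p ∷ r ∷ l₂ × ((p ≡ u × r ≡ w) ⊎ (p ≡ w × r ≡ u))
        × pieces E (l₁ ++ p ∷ []) + pieces E (r ∷ l₂) ≤ suc (pieces (addEdge u w E) (a ∷ l)))
  pieces-addEdge u w E a [] _ = inj₁ ≤-refl
  pieces-addEdge u w E a (b ∷ l) (a∉ ∷ ul) with isPair u w a b in eq
  ... | true = inj₂ ([] , a , b , l , refl , isPair-sound u w a b eq ,
          s≤s (≤-trans (pieces-fresh u w E a (b ∷ l) (end (isPair-sound u w a b eq)) (λ p → All.lookup a∉ p refl)) (m≤n+m _ _)))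
    where
    end : (a ≡ u × b ≡ w) ⊎ (a ≡ w × b ≡ u) → a ≡ u ⊎ a ≡ w
    end (inj₁ (p , _)) = inj₁ p
    end (inj₂ (p , _)) = inj₂ p
  ... | false with pieces-addEdge u w E b l ul
  ...   | inj₁ le = inj₁ (+-mono-≤ (≤-reflexive (cong (⟦_⟧ ∘ not) (sym (Boolₚ.∨-identityʳ (E a b))))) le)
  ...   | inj₂ ([] , p , r , l₂ , refl , pr , le) = inj₂ (a ∷ [] , p , r , l₂ , refl , pr ,
            subst (λ e → ⟦ not (E a b) ⟧ + 1 + Pieces.pieces E (r ∷ l₂) ≤ suc (⟦ not e ⟧ + Pieces.pieces (addEdge u w E) (p ∷ r ∷ l₂)))
              (sym (Boolₚ.∨-identityʳ (E a b)))
              (≤-trans (≤-reflexive (+-assoc ⟦ not (E a b) ⟧ 1 _))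
                (≤-trans (+-monoʳ-≤ ⟦ not (E a b) ⟧ le) (≤-reflexive (+-suc _ _)))))
  ...   | inj₂ (c ∷ l₁ , p , r , l₂ , refl , pr , le) = inj₂ (a ∷ c ∷ l₁ , p , r , l₂ , refl , pr ,
            subst (λ e → ⟦ not (E a b) ⟧ + Pieces.pieces E (c ∷ l₁ ++ p ∷ []) + Pieces.pieces E (r ∷ l₂)
                    ≤ suc (⟦ not e ⟧ + Pieces.pieces (addEdge u w E) (c ∷ l₁ ++ p ∷ r ∷ l₂)))
              (sym (Boolₚ.∨-identityʳ (E a b)))
              (≤-trans (≤-reflexive (+-assoc ⟦ not (E a b) ⟧ _ _))
                (≤-trans (+-monoʳ-≤ ⟦ not (E a b) ⟧ le) (≤-reflexive (+-suc _ _)))))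

-- A clique on x of v vertices, with the others peeled off at degree 4t - x, gives x² + 2(4t - x)(v
-- - x) ordered pairs. This is convex in x; its values at x = 4t and x = 2t are the two bounds,
-- which agree at v = 5t. The terms in `g` are the error.
Bounded : (t g v e : ℕ) → Set
Bounded t g v e = (v ≤ 5 * t → e ≤ 16 * (t * t) + 4 * (g * v)) × (5 * t ≤ v → e + 4 * (t * t) ≤ 4 * (t * v) + 4 * (g * v))

-- Permits reasoning by contradiction: edge-maximality can only be exploited once the bound is
-- assumed to fail.
Bounded-stable : ∀ t g v e → ¬ ¬ Bounded t g v e → Bounded t g v e
Bounded-stable t g v e nn =
  (λ le → ≮⇒≥ λ lt → nn λ { (p , _) → <⇒≱ lt (p le) }) , (λ le → ≮⇒≥ λ lt → nn λ { (_ , p) → <⇒≱ lt (p le) })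

Bounded-mono : ∀ t g v {e e′} → e ≤ e′ → Bounded t g v e′ → Bounded t g v e
Bounded-mono t g v e≤ (p , q) = (λ le → ≤-trans e≤ (p le)) , (λ le → ≤-trans (+-monoˡ-≤ _ e≤) (q le))

Bounded-small : ∀ t g v e → 1 ≤ t → v ≤ 4 * t → e ≤ v * v → Bounded t g v e
Bounded-small t g v e 1≤t v≤ e≤ =
  (λ _ → ≤-trans e≤ (≤-trans (*-mono-≤ v≤ v≤) (≤-trans (≤-reflexive (idn t)) (m≤m+n _ _)))) ,
  (λ le → ⊥-elim (<⇒≱ (≤-trans v< le) ≤-refl))
  where
  idn : ∀ t → 4 * t * (4 * t) ≡ 16 * (t * t)
  idn = solve-∀
  v< : v < 5 * t
  v< = ≤-<-trans v≤ (m<n+m (4 * t) 1≤t)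

-- The case without a core: all but `c` vertices were peeled off, each with degree below `c`.
Bounded-sparse : ∀ t g j e → let c = 2 * t + g in e ≤ c * c + 2 * c * j → Bounded t g (c + j) e
Bounded-sparse t g j e e≤ =
  (λ le → ≤-trans e≤ (lin _ _ _ (*-monoʳ-≤ (4 * t) le) (idn₁ t g j))) ,
  (λ _ → lin _ _ _ e≤ (idn₂ t g j e))
  where
  idn₁ : ∀ t g j → 16 * (t * t) + 4 * (g * (2 * t + g + j)) + 4 * t * (2 * t + g + j)
    ≡ (2 * t + g) * (2 * t + g) + 2 * (2 * t + g) * j + 4 * t * (5 * t) + (2 * (g * (2 * t + g + j)) + 4 * (t * g) + g * g)
  idn₁ = solve-∀
  idn₂ : ∀ t g j e → 4 * (t * (2 * t + g + j)) + 4 * (g * (2 * t + g + j)) + e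
    ≡ e + 4 * (t * t) + ((2 * t + g) * (2 * t + g) + 2 * (2 * t + g) * j) + (2 * (g * (2 * t + g + j)) + 4 * (t * g) + g * g)
  idn₂ = solve-∀

-- A clique of size 2t + y together with vertices of degree at most 2t - y + 2g.
Bounded-clique : ∀ t g y r j e → 2 * t ≡ y + r → let s = y + r + y in
  e ≤ s * s + 2 * (r + 2 * g) * j → Bounded t g (s + j) e
Bounded-clique t g y r j e 2t≡ e≤ =
  (λ le → subst (λ m → e ≤ m + 4 * (g * (y + r + y + j))) (sym (quad t (y + r) 2t≡))
     (≤-trans e≤ (lin _ _ _ (*-monoʳ-≤ r (twice le)) (idn₁ g y r j)))) ,
  (λ le → subst₂ (λ m m′ → e + m ≤ m′ + 4 * (g * (y + r + y + j))) (sym (quad′ t (y + r) 2t≡)) (sym (lin4 t (y + r) (y + r + y + j) 2t≡))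
     (lin _ _ _ (+-mono-≤ e≤ (*-monoʳ-≤ y (twice′ le))) (idn₂ g y r j e)))
  where
  quad : ∀ t T → 2 * t ≡ T → 16 * (t * t) ≡ 4 * (T * T)
  quad t _ refl = ring t
    where ring : ∀ t → 16 * (t * t) ≡ 4 * (2 * t * (2 * t))
          ring = solve-∀
  quad′ : ∀ t T → 2 * t ≡ T → 4 * (t * t) ≡ T * T
  quad′ t _ refl = ring t
    where ring : ∀ t → 4 * (t * t) ≡ 2 * t * (2 * t)
          ring = solve-∀
  lin4 : ∀ t T v → 2 * t ≡ T → 4 * (t * v) ≡ 2 * (T * v)
  lin4 t _ v refl = ring t v
    where ring : ∀ t v → 4 * (t * v) ≡ 2 * (2 * t * v)
          ring = solve-∀
  five : ∀ t T → 2 * t ≡ T → 2 * (5 * t) ≡ 5 * T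
  five t _ refl = ring t
    where ring : ∀ t → 2 * (5 * t) ≡ 5 * (2 * t)
          ring = solve-∀
  twice : ∀ {v} → v ≤ 5 * t → 2 * v ≤ 5 * (y + r)
  twice {v} le = subst (2 * v ≤_) (five t (y + r) 2t≡) (*-monoʳ-≤ 2 le)
  twice′ : ∀ {v} → 5 * t ≤ v → 5 * (y + r) ≤ 2 * v
  twice′ {v} le = subst (_≤ 2 * v) (five t (y + r) 2t≡) (*-monoʳ-≤ 2 le)
  idn₁ : ∀ g y r j → 4 * ((y + r) * (y + r)) + 4 * (g * (y + r + y + j)) + r * (2 * (y + r + y + j))
    ≡ (y + r + y) * (y + r + y) + 2 * (r + 2 * g) * j + r * (5 * (y + r)) + (3 * (y * r) + 4 * (g * (y + r + y)))
  idn₁ = solve-∀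
  idn₂ : ∀ g y r j e → 2 * ((y + r) * (y + r + y + j)) + 4 * (g * (y + r + y + j)) + (e + y * (5 * (y + r)))
    ≡ e + (y + r) * (y + r) + ((y + r + y) * (y + r + y) + 2 * (r + 2 * g) * j + y * (2 * (y + r + y + j))) + (3 * (y * r) + 4 * (g * (y + r + y)))
  idn₂ = solve-∀

-- Kopylov's bound for graphs without long sequences

module _ {N : ℕ} where

  private V = Fin N

  -- Kopylov's argument: in an edge-maximal counterexample the core of minimum
  -- degree 2t + g is a clique, and no vertex outside it has large degree.
  few-edges : ∀ (S : VSet N) t g b → 2 ≤ g → g ≤ t → 4 * t ≡ suc b * g →
    ∀ f E → (∀ x y → E x y ≡ E y x) → N * N ≤ total E + f → ¬ Covered E S (4 * t) (suc b) →
    Bounded t g (# S) (edges E S)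
  few-edges S t g b 2≤g g≤t n≡ f E symm fuel bare = Bounded-stable t g (# S) (edges E S) contra
    where
    1≤t : 1 ≤ t
    1≤t = ≤-trans (≤-trans (s≤s z≤n) 2≤g) g≤t

    contra : ¬ ¬ Bounded t g (# S) (edges E S)
    contra unbounded with ≤-total (# S) (2 * t + g)
    ... | inj₁ small = unbounded (Bounded-small t g (# S) _ 1≤t
            (≤-trans small (lin _ _ _ g≤t (ring t g))) (edges≤#² E S))
      where
      ring : ∀ t g → 4 * t + g ≡ 2 * t + g + t + t
      ring = solve-∀
    ... | inj₂ large with m≤n⇒∃[o]m+o≡n large
    ... | j , size with peel E symm (λ _ → false) S (λ _ ()) (2 * t + g) (2 * t + g) j (sym size)
    ... | inj₂ few = unbounded (subst (λ v → Bounded t g v (edges E S)) size (Bounded-sparse t g j _ few))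
    ... | inj₁ (K , _ , K⊆S , c<K , highK , lowK) = main
      where
      -- The new edge lowers the fuel. If the larger graph had no long sequence, its bound would
      -- hold by induction and carry over to `E`.
      saturated : ∀ u w → E u w ≡ false → ¬ ¬ Covered (addEdge u w E) S (4 * t) (suc b)
      saturated u w e bare′ = go f fuel
        where
        go : ∀ f → N * N ≤ total E + f → ⊥
        go zero fuel = <⇒≱ (total-addEdge u w E e) (≤-trans (total≤ (addEdge u w E)) (subst (N * N ≤_) (+-identityʳ _) fuel))
        go (suc f) fuel = unbounded (Bounded-mono t g (# S) (edges-addEdge u w E S)
          (few-edges S t g b 2≤g g≤t n≡ f (addEdge u w E) (addEdge-sym u w symm)
            (≤-trans fuel (≤-trans (≤-reflexive (+-suc _ f)) (+-monoˡ-≤ f (total-addEdge u w E e)))) bare′))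

      adjacent : ∀ X Y α β → (∀ v → X v ≡ true → S v ≡ true) → (∀ v → Y v ≡ true → S v ≡ true) →
        (∀ u → X u ≡ true → α ≤ deg E X u) → (∀ w → Y w ≡ true → β ≤ deg E Y w) → 4 * t + g + 1 ≤ α + β →
        ∀ u w → X u ≡ true → Y w ≡ true → E u w ≡ true
      adjacent X Y α β X⊆ Y⊆ degX degY αβ u w xu yw with E u w in e
      ... | true = refl
      ... | false = ⊥-elim (saturated u w e rotate)
        where
        rotate : ¬ Covered (addEdge u w E) S (4 * t) (suc b)
        rotate ([] , _ , _ , long , _) = <⇒≱ (≤-trans 1≤t (m≤m+n t _)) long
        rotate (a ∷ l , ul , sl , long , few) with pieces-addEdge u w E a l ul
        ... | inj₁ le = bare (a ∷ l , ul , sl , long , ≤-trans le few)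
        ... | inj₂ (l₁ , p , r , l₂ , eq , pr , le) = ends pr
          where
          open Pieces E
          -- The two parts change places, so that the ends of the removed edge become the ends of
          -- the sequence.
          Q = r ∷ ((l₂ ++ l₁) ++ p ∷ [])
          Q≡ : (r ∷ l₂) ++ (l₁ ++ p ∷ []) ≡ Q
          Q≡ = cong (r ∷_) (sym (++-assoc l₂ l₁ (p ∷ [])))
          perm : a ∷ l ↭ Q
          perm = ↭-trans (↭-reflexive (trans eq (sym (++-assoc l₁ (p ∷ []) (r ∷ l₂)))))
            (↭-trans (↭ₚ.++-comm (l₁ ++ p ∷ []) (r ∷ l₂)) (↭-reflexive Q≡))
          fewQ : pieces Q ≤ suc (suc b)
          fewQ = begin
            pieces Q                                   ≡⟨ cong pieces Q≡ ⟨
            pieces ((r ∷ l₂) ++ (l₁ ++ p ∷ []))        ≤⟨ pieces-++ (r ∷ l₂) (l₁ ++ p ∷ []) ⟩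
            pieces (r ∷ l₂) + pieces (l₁ ++ p ∷ [])    ≡⟨ +-comm (pieces (r ∷ l₂)) _ ⟩
            pieces (l₁ ++ p ∷ []) + pieces (r ∷ l₂)    ≤⟨ le ⟩
            suc (Pieces.pieces (addEdge u w E) (a ∷ l)) ≤⟨ s≤s few ⟩
            suc (suc b) ∎
            where open ≤-Reasoning
          uQ = Unique-↭ perm ul
          sQ = ↭ₚ.All-resp-↭ perm sl
          longQ = subst (4 * t ≤_) (↭ₚ.↭-length perm) long
          ends : ((p ≡ u × r ≡ w) ⊎ (p ≡ w × r ≡ u)) → ⊥
          ends (inj₁ (refl , refl)) = cross E symm S (4 * t) b g n≡ bare X Y α β X⊆ Y⊆ degX degY αβ
            N r (l₂ ++ l₁) p uQ sQ (m≤n+m N _) longQ yw xu fewQ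
          ends (inj₂ (refl , refl)) = cross E symm S (4 * t) b g n≡ bare Y X β α Y⊆ X⊆ degY degX
            (≤-trans αβ (≤-reflexive (+-comm α β))) N r (l₂ ++ l₁) p uQ sQ (m≤n+m N _) longQ xu yw fewQ

      degK : ∀ u → K u ≡ true → 2 * t + g ≤ deg E K u
      degK u ku = highK u ku refl

      clique : ∀ u w → K u ≡ true → K w ≡ true → E u w ≡ true
      clique = adjacent K K (2 * t + g) (2 * t + g) K⊆S K⊆S degK degK (lin _ _ _ 2≤g (ring t g))
        where
        ring : ∀ t g → 2 * t + g + (2 * t + g) + 2 ≡ 4 * t + g + 1 + g + 1
        ring = solve-∀

      K<4t : # K < 4 * t
      K<4t = ≰⇒> λ le → let l , ul , kl , len = enumerate (# K) K refl in
        bare (l , ul , All.map (K⊆S _) kl , subst (4 * t ≤_) (sym len) le ,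
          ≤-trans (clique-pieces E K (λ u w ku kw _ → clique u w ku kw) l ul kl) (s≤s z≤n))

      main : ⊥
      -- Here `y` is the size of `K` minus 2t, and `r` is 4t minus that size. The threshold r + 2g
      -- is tuned to the exchange: the size of `K` minus 1, plus r + 2g, is at least 4t + g + 1
      -- because g ≥ 2.
      main with m≤n⇒∃[o]m+o≡n (≤-trans (m≤m+n (2 * t) g) (<⇒≤ c<K)) | m≤n⇒∃[o]m+o≡n (<⇒≤ K<4t) | m≤n⇒∃[o]m+o≡n (#-mono K⊆S)
      ... | y , y≡ | r , r≡ | i , i≡ with peel E symm K S K⊆S (r + 2 * g) (# K) i (sym i≡)
      ... | inj₂ few = unbounded (subst (λ v → Bounded t g v (edges E S)) (trans (cong (_+ i) (sym s≡)) i≡)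
              (Bounded-clique t g y r i _ 2t≡ (subst (λ s → edges E S ≤ s * s + 2 * (r + 2 * g) * i) s≡ few)))
        where
        2t≡ : 2 * t ≡ y + r
        2t≡ = +-cancelˡ-≡ (2 * t) _ _ (trans (ring t) (trans (sym r≡) (trans (cong (_+ r) (sym y≡)) (+-assoc (2 * t) y r))))
          where ring : ∀ t → 2 * t + 2 * t ≡ 4 * t
                ring = solve-∀
        s≡ : # K ≡ y + r + y
        s≡ = trans (sym y≡) (cong (_+ y) 2t≡)
      ... | inj₁ (H , K⊆H , H⊆S , K<H , highH , _)
          with Finₚ.any? (λ w → (H w ∧ not (K w)) Boolₚ.≟ true)
      ... | no none = <⇒≱ K<H (#-mono λ v hv → inK v hv)
        where
        inK : ∀ v → H v ≡ true → K v ≡ true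
        inK v hv with K v in kv
        ... | true = refl
        ... | false = ⊥-elim (none (v , ∧-intro hv (cong not kv)))
      -- A survivor `w` outside `K` has fewer than 2t + g neighbours in the larger set `K`, hence a
      -- non-neighbour there, which `adjacent` contradicts.
      ... | yes (w , hw) with Finₚ.any? (λ u → (K u ∧ not (E w u)) Boolₚ.≟ true)
      ... | no none = <⇒≱ (lowK w (H⊆S w (proj₁ (∧-true hw))) (not-true (proj₂ (∧-true {H w} hw))))
              (≤-trans (<⇒≤ c<K) (#-mono λ u ku → ∧-intro ku (inE u ku)))
        where
        inE : ∀ u → K u ≡ true → E w u ≡ true
        inE u ku with E w u in e
        ... | true = refl
        ... | false = ⊥-elim (none (u , ∧-intro ku (cong not e)))
      ... | yes (u , ku) = true≢false
              (adjacent K H (pred (# K)) (r + 2 * g) K⊆S H⊆S degK′ degH sum≥ u w (proj₁ (∧-true ku)) (proj₁ (∧-true hw)))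
              (trans (symm u w) (not-true (proj₂ (∧-true {K u} ku))))
        where
        degK′ : ∀ u → K u ≡ true → pred (# K) ≤ deg E K u
        degK′ u ku = subst (λ s → pred s ≤ deg E K u) (sym (#-remove K u ku))
          (#-mono λ v p → let kv , _ = ∧-true {K v} p in ∧-intro kv (clique u v ku kv))
        r≤ : r + 2 * g ≤ 2 * t + g
        r≤ = lin _ _ _ (+-mono-≤ (≤-reflexive r≡) (<⇒≤ c<K)) (ring t g r (# K))
          where
          ring : ∀ t g r s → 2 * t + g + (s + r + (2 * t + g)) ≡ r + 2 * g + (4 * t + s) + 0
          ring = solve-∀
        degH : ∀ v → H v ≡ true → r + 2 * g ≤ deg E H v
        degH v hv with K v in kv
        ... | true = ≤-trans r≤ (≤-trans (degK v kv) (deg-mono E K⊆H v))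
        ... | false = highH v hv kv
        sum≥ : 4 * t + g + 1 ≤ pred (# K) + (r + 2 * g)
        sum≥ = s≤s⁻¹ (≤-trans (lin _ _ _ (+-mono-≤ (≤-reflexive (sym r≡)) 2≤g) (ring t g r (# K)))
                 (≤-reflexive (cong (_+ (r + 2 * g)) (sym (suc-pred (# K) {{>-nonZero (≤-<-trans z≤n c<K)}})))))
          where
          ring : ∀ t g r s → s + (r + 2 * g) + (4 * t + 2) ≡ suc (4 * t + g + 1) + (s + r + g) + 0
          ring = solve-∀

-- Parity, walks and connectors

length-cartesianProduct : ∀ {A B : Set} (xs : List A) (ys : List B) →
  length (cartesianProduct xs ys) ≡ length xs * length ys
length-cartesianProduct [] ys = refl
length-cartesianProduct (x ∷ xs) ys = trans (length-++ (map (x ,_) ys))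
  (cong₂ _+_ (length-map (x ,_) ys) (length-cartesianProduct xs ys))

par : ℕ → Bool
par zero = false
par (suc n) = not (par n)

xor-not : ∀ a b → a xor not b ≡ not a xor b
xor-not a b = trans (sym (Boolₚ.not-distribʳ-xor a b)) (Boolₚ.not-distribˡ-xor a b)

par-+ : ∀ m n → par (m + n) ≡ par m xor par n
par-+ zero n = refl
par-+ (suc m) n = trans (cong not (par-+ m n)) (Boolₚ.not-distribˡ-xor (par m) (par n))

∧-loss : ∀ a b c → ⟦ a ∧ not (b ∧ c) ⟧ ≤ ⟦ a ∧ not b ⟧ + ⟦ a ∧ not c ⟧
∧-loss false _ _ = z≤n
∧-loss true true c = ≤-refl
∧-loss true false c = m≤m+n _ _

module _ {V : Set} where

  -- The list leaves out the start and contains the end, so its length is the number of edges.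
  data Chain (R : V → V → Set) : V → List V → V → Set where
    []  : ∀ {a} → Chain R a [] a
    _∷_ : ∀ {a x l b} → R a x → Chain R x l b → Chain R a (x ∷ l) b

  chain-++ : ∀ {R a l b l′ c} → Chain R a l b → Chain R b l′ c → Chain R a (l ++ l′) c
  chain-++ [] d = d
  chain-++ (r ∷ c) d = r ∷ chain-++ c d

  chain-map : ∀ {R R′ : V → V → Set} → (∀ {x y} → R x y → R′ x y) → ∀ {a l b} → Chain R a l b → Chain R′ a l b
  chain-map f [] = []
  chain-map f (r ∷ c) = f r ∷ chain-map f c

  chain-suffix : ∀ {R x l b a} → Chain R x l b → Unique (x ∷ l) → a ∈ x ∷ l →
    ∃ λ l′ → Chain R a l′ b × Unique (a ∷ l′) × (∀ {y} → y ∈ l′ → y ∈ l)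
  chain-suffix c u (here refl) = _ , c , u , λ p → p
  chain-suffix (r ∷ c) (_ ∷ u) (there p) with chain-suffix c u p
  ... | l′ , c′ , u′ , sub = l′ , c′ , u′ , there ∘ sub

  -- Loop erasure. In general it changes the parity of the length; connectors recover the parity
  -- from a bipartition.
  simplify : (∀ (x y : V) → Dec (x ≡ y)) → ∀ {R a l b} → Chain R a l b →
    ∃ λ l′ → Chain R a l′ b × Unique (a ∷ l′) × (∀ {y} → y ∈ l′ → y ∈ l)
  simplify _≟_ [] = [] , [] , [] ∷ [] , λ p → p
  simplify _≟_ {a = a} {x ∷ l} (r ∷ c) with simplify _≟_ c
  ... | l′ , c′ , u′ , sub with a ∈? (x ∷ l′)
    where open import Data.List.Membership.DecPropositional _≟_ using (_∈?_)
  ... | yes p = let l″ , c″ , u″ , sub″ = chain-suffix c′ u′ p in l″ , c″ , u″ , there ∘ sub ∘ sub″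
  ... | no p = x ∷ l′ , r ∷ c′ , All.tabulate (λ { q refl → p q }) ∷ u′ ,
                 λ { (here refl) → here refl ; (there q) → there (sub q) }

module _ {N : ℕ} where

  private V = Fin N

  open import Data.List.Membership.DecPropositional (Fin._≟_ {N}) using (_∈?_)

  listed : List V → VSet N
  listed L v = does (v ∈? L)

  #-listed : ∀ L → # (listed L) ≤ length L
  #-listed L = ≤-trans (#≤countᴸ (listed L) L mem) (count≤ L)
    where
    mem : ∀ v → listed L v ≡ true → v ∈ L
    mem v p with v ∈? L
    ... | yes q = q
    count≤ : ∀ M → countᴸ (listed L) M ≤ length M
    count≤ [] = z≤n
    count≤ (x ∷ M) = +-mono-≤ (⟦⟧≤1 (listed L x)) (count≤ M)

  unique-length : ∀ (l L : List V) → Unique l → (∀ {x} → x ∈ l → x ∈ L) → length l ≤ length L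
  unique-length l L u sub = ≤-trans (length≤# (listed L) l u (All.tabulate (λ {x} p → dec-true (x ∈? L) (sub p)))) (#-listed L)

  -- Only the parity of the length is recorded, `true` for odd: it is all that survives when a walk
  -- is rerouted through reserved edges.
  data Walk (E : Graph N) : Bool → V → V → Set where
    stay : ∀ {a} → Walk E false a a
    step : ∀ {π a b c} → E a b ≡ true → Walk E π b c → Walk E (not π) a c

  walk-++ : ∀ {E π ρ a b c} → Walk E π a b → Walk E ρ b c → Walk E (π xor ρ) a c
  walk-++ stay w = w
  walk-++ {E} {ρ = ρ} (step {π} e v) w = subst (λ σ → Walk E σ _ _) (Boolₚ.not-distribˡ-xor π ρ) (step e (walk-++ v w))

  walk-reverse : ∀ {E π a b} → (∀ x y → E x y ≡ E y x) → Walk E π a b → Walk E π b a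
  walk-reverse s stay = stay
  walk-reverse {E} s (step {π} e w) = subst (λ σ → Walk E σ _ _) (Boolₚ.xor-comm π true)
    (walk-++ (walk-reverse s w) (step (trans (s _ _) e) stay))

  module Link (G : Graph N) (symm : ∀ x y → G x y ≡ G y x) (irr : ∀ x → G x x ≡ false) where

    Adj : V → V → Set
    Adj x y = G x y ≡ true

    hits : List V → V → Bool
    hits [] u = false
    hits (r ∷ R) u = G r u ∨ hits R u

    hits-sound : ∀ R u → hits R u ≡ true → ∃ λ r → r ∈ R × Adj r u
    hits-sound (r ∷ R) u p with G r u in e
    ... | true = r , here refl , e
    ... | false = let r′ , q , e′ = hits-sound R u p in r′ , there q , e′

    missed : List V → V → ℕ
    missed R v = # (λ u → G v u ∧ not (hits R u))

    -- Greedy choice: each new member of R is adjacent to θ vertices not yet dominated.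
    dominate : ∀ θ → 1 ≤ θ → ∀ Z → ∃ λ R → (∀ {r} → r ∈ R → r ∉ Z) × length R * θ ≤ N
      × (∀ v → v ∉ Z → v ∉ R → missed R v < θ)
    dominate θ 1≤θ Z = loop N [] (λ ()) (#≤n _) (#≤n _)
      where
      loop : ∀ f R → (∀ {r} → r ∈ R → r ∉ Z) → length R * θ + # (not ∘ hits R) ≤ N → # (not ∘ hits R) ≤ f →
        ∃ λ R → (∀ {r} → r ∈ R → r ∉ Z) × length R * θ ≤ N × (∀ v → v ∉ Z → v ∉ R → missed R v < θ)
      loop f R fresh inv fuel with Finₚ.any? (λ v → ¬? (v ∈? Z) ×-dec ¬? (v ∈? R) ×-dec (θ ≤? missed R v))
      ... | no none = R , fresh , m+n≤o⇒m≤o _ inv , λ v v∉Z v∉R → ≰⇒> λ le → none (v , v∉Z , v∉R , le)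
      ... | yes (v , v∉Z , v∉R , le) = next f fuel
        where
        drop : # (not ∘ hits (v ∷ R)) + θ ≤ # (not ∘ hits R)
        drop = ≤-trans (+-monoʳ-≤ _ le) (≤-trans (≤-reflexive (sym (∑-distrib-+ (λ u → ⟦ not (hits (v ∷ R) u) ⟧) (λ u → ⟦ G v u ∧ not (hits R u) ⟧))))
                 (sum-mono λ u → cell (G v u) (hits R u)))
          where
          cell : ∀ a b → ⟦ not (a ∨ b) ⟧ + ⟦ a ∧ not b ⟧ ≤ ⟦ not b ⟧
          cell true b = ≤-refl
          cell false b = ≤-reflexive (+-identityʳ _)
        next : ∀ f → # (not ∘ hits R) ≤ f → _
        next f fuel with ≤-trans drop fuel
        next zero _ | le = ⊥-elim (<⇒≱ (≤-trans 1≤θ (m≤n+m θ _)) le)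
        next (suc f) _ | le = loop f (v ∷ R) (λ { (here refl) → v∉Z ; (there p) → fresh p })
          (≤-trans (lin _ _ 0 drop (ring θ (length R) (# (not ∘ hits (v ∷ R))) (# (not ∘ hits R)))) inv)
          (s≤s⁻¹ (≤-trans (≤-trans (≤-reflexive (+-comm 1 _)) (+-monoʳ-≤ _ 1≤θ)) le))
          where
          ring : ∀ θ l a b → l * θ + b + (a + θ) ≡ (θ + l * θ) + a + b + 0
          ring = solve-∀

    Disj : List V → List V → Set
    Disj l l′ = ∀ {x} → x ∈ l → x ∉ l′

    Served : (s₀ s₁ : List V) → V × V → Set
    Served s₀ s₁ (r , r′) = ∃₂ λ x y → x ∈ s₀ × y ∈ s₁ × Adj r x × Adj x y × Adj y r′

    -- A pair for which nothing is reserved has no suitable edge left outside the reserved vertices.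
    reserve : ∀ Z ps s₀ s₁ → Disj s₀ s₁ → ∃₂ λ t₀ t₁ → Disj t₀ t₁
      × (∀ {x} → x ∈ s₀ → x ∈ t₀) × (∀ {x} → x ∈ s₁ → x ∈ t₁)
      × (∀ {x} → x ∈ t₀ → x ∈ s₀ ⊎ x ∉ Z) × (∀ {x} → x ∈ t₁ → x ∈ s₁ ⊎ x ∉ Z)
      × length t₀ + length t₁ ≤ length s₀ + length s₁ + 2 * length ps
      × (∀ {r r′} → (r , r′) ∈ ps → ∀ u v → u ∉ Z → u ∉ t₀ → u ∉ t₁ → v ∉ Z → v ∉ t₀ → v ∉ t₁ →
          Adj r u → Adj u v → Adj v r′ → Served t₀ t₁ (r , r′))
    reserve Z [] s₀ s₁ dis = s₀ , s₁ , dis , (λ p → p) , (λ p → p) , inj₁ , inj₁ , m≤m+n _ _ , λ ()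
    reserve Z ((r , r′) ∷ ps) s₀ s₁ dis
      with Finₚ.any? (λ x → Finₚ.any? (λ y → ¬? (x ∈? Z) ×-dec ¬? (x ∈? s₀) ×-dec ¬? (x ∈? s₁)
             ×-dec ¬? (y ∈? Z) ×-dec ¬? (y ∈? s₀) ×-dec ¬? (y ∈? s₁)
             ×-dec (G r x Boolₚ.≟ true) ×-dec (G x y Boolₚ.≟ true) ×-dec (G y r′ Boolₚ.≟ true)))
    ... | no none with reserve Z ps s₀ s₁ dis
    ...   | t₀ , t₁ , dis′ , sub₀ , sub₁ , fr₀ , fr₁ , len , serve = t₀ , t₁ , dis′ , sub₀ , sub₁ , fr₀ , fr₁ ,
            ≤-trans len (+-monoʳ-≤ _ (*-monoʳ-≤ 2 (n≤1+n _))) ,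
            λ { (here refl) u v u∉Z u∉₀ u∉₁ v∉Z v∉₀ v∉₁ a b c →
                  ⊥-elim (none (u , v , u∉Z , u∉₀ ∘ sub₀ , u∉₁ ∘ sub₁ , v∉Z , v∉₀ ∘ sub₀ , v∉₁ ∘ sub₁ , a , b , c))
              ; (there p) → serve p }
    reserve Z ((r , r′) ∷ ps) s₀ s₁ dis
      | yes (x , y , x∉Z , x∉₀ , x∉₁ , y∉Z , y∉₀ , y∉₁ , rx , xy , yr)
      with reserve Z ps (x ∷ s₀) (y ∷ s₁)
             (λ { (here refl) (here refl) → true≢false xy (irr x)
                ; (here refl) (there q) → x∉₁ q ; (there p) (here refl) → y∉₀ p ; (there p) (there q) → dis p q })
    ... | t₀ , t₁ , dis′ , sub₀ , sub₁ , fr₀ , fr₁ , len , serve = t₀ , t₁ , dis′ , sub₀ ∘ there , sub₁ ∘ there ,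
            (λ p → old x∉Z (fr₀ p)) , (λ p → old y∉Z (fr₁ p)) ,
            ≤-trans len (≤-reflexive (ring (length s₀) (length s₁) (length ps))) ,
            λ { (here refl) _ _ _ _ _ _ _ _ _ _ _ → x , y , sub₀ (here refl) , sub₁ (here refl) , rx , xy , yr
              ; (there p) → serve p }
      where
      old : ∀ {x v s} → x ∉ Z → v ∈ x ∷ s ⊎ v ∉ Z → v ∈ s ⊎ v ∉ Z
      old x∉ (inj₁ (here refl)) = inj₂ x∉
      old x∉ (inj₁ (there p)) = inj₁ p
      old x∉ (inj₂ q) = inj₂ q
      ring : ∀ a b c → suc a + suc b + 2 * c ≡ a + b + 2 * suc c
      ring = solve-∀

    -- `Z` is what has been spent before. `I` holds the inner vertices of a path from `a` to `b`,
    -- one fewer than its edges, so the last condition of `link` says that the path has the parity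
    -- of the walk. `zs` is fixed before `E`, so one connector serves every admissible graph.
    record Connector (Z : List V) (θ ℓ : ℕ) : Set where
      field
        zs : List V
        ok : VSet N
        fresh : ∀ {v} → v ∈ zs → v ∉ Z
        size : length zs ≤ ℓ
        loss : ∀ v → v ∉ Z → v ∉ zs → # (λ u → G v u ∧ not (ok u)) ≤ 2 * θ
        link : ∀ (E : Graph N) →
          (∀ u v → E u v ≡ true → Adj u v × (u ∉ Z × u ∉ zs × ok u ≡ true) × (v ∉ Z × v ∉ zs × ok v ≡ true)) →
          ∀ {π a b} → ok a ≡ true → Walk E π a b →
          ∃ λ I → Chain Adj a (I ++ b ∷ []) b × Unique I × (∀ {x} → x ∈ I → x ∈ zs) × par (length I) ≡ not π

    -- Every edge of the path between two hubs crosses from one of `s₀` and `s₁` to the other. The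
    -- sides of its ends therefore determine the parity of its length, and loop erasure is harmless.
    Side : (s₀ s₁ : List V) → V → V → Set
    Side s₀ s₁ u v = Adj u v × ((u ∈ s₀ × v ∈ s₁) ⊎ (u ∈ s₁ × v ∈ s₀))

    On : (s₀ s₁ : List V) → Bool → V → Set
    On s₀ s₁ false v = v ∈ s₀
    On s₀ s₁ true v = v ∈ s₁

    side-parity : ∀ s₀ s₁ → Disj s₀ s₁ → ∀ β {x l y} → On s₀ s₁ β x → Chain (Side s₀ s₁) x l y →
      On s₀ s₁ (par (length l) xor β) y
    side-parity s₀ s₁ dis β o [] = o
    side-parity s₀ s₁ dis β {x} {_ ∷ l} o ((e , s) ∷ c) =
      subst (λ γ → On s₀ s₁ γ _) (xor-not (par (length l)) β) (side-parity s₀ s₁ dis (not β) (flip β o s) c)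
      where
      flip : ∀ β {x y} → On s₀ s₁ β x → (x ∈ s₀ × y ∈ s₁) ⊎ (x ∈ s₁ × y ∈ s₀) → On s₀ s₁ (not β) y
      flip false o (inj₁ (_ , q)) = q
      flip false o (inj₂ (p , _)) = ⊥-elim (dis o p)
      flip true o (inj₁ (p , _)) = ⊥-elim (dis p o)
      flip true o (inj₂ (_ , q)) = q

    on-unique : ∀ s₀ s₁ → Disj s₀ s₁ → ∀ β γ {v} → On s₀ s₁ β v → On s₀ s₁ γ v → β ≡ γ
    on-unique s₀ s₁ dis false false _ _ = refl
    on-unique s₀ s₁ dis false true p q = ⊥-elim (dis p q)
    on-unique s₀ s₁ dis true false p q = ⊥-elim (dis q p)
    on-unique s₀ s₁ dis true true _ _ = refl

    side-members : ∀ s₀ s₁ {x l y} → Chain (Side s₀ s₁) x l y → ∀ {v} → v ∈ l → v ∈ s₀ ++ s₁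
    side-members s₀ s₁ ((_ , inj₁ (_ , q)) ∷ c) (here refl) = Anyₚ.++⁺ʳ s₀ q
    side-members s₀ s₁ ((_ , inj₂ (_ , q)) ∷ c) (here refl) = Anyₚ.++⁺ˡ q
    side-members s₀ s₁ (_ ∷ c) (there p) = side-members s₀ s₁ c p

    -- Two disjoint dominating sets give each surviving vertex a hub in `R₁` and one in `R₂`. A walk
    -- is followed by hubs alternating between the sets, each edge of it being replaced by three
    -- edges, of which the middle one is reserved. The size counts at most `q` hubs in each set and
    -- two vertices for each pair of hubs.
    connector : ∀ Z θ q → 1 ≤ θ → N ≤ q * θ → Connector Z θ (2 * q + 2 * (q * q))
    connector Z θ q 1≤θ N≤ with dominate θ 1≤θ Z
    ... | R₁ , fresh₁ , len₁ , miss₁ with dominate θ 1≤θ (R₁ ++ Z)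
    -- With `R₂` on the side of the first reserved vertex and `R₁` on that of the second, each path
    -- r, x, y, r′ alternates between the sides.
    ... | R₂ , fresh₂ , len₂ , miss₂ with reserve Z (cartesianProduct R₁ R₂) R₂ R₁ (λ p q → fresh₂ p (Anyₚ.++⁺ˡ q))
    ... | s₀ , s₁ , dis , sub₀ , sub₁ , fr₀ , fr₁ , len , serve = record
      { zs = s₀ ++ s₁
      ; ok = λ u → hits R₁ u ∧ hits R₂ u
      ; fresh = λ p → [ (λ p₀ → [ (λ r → fresh₂ r ∘ Anyₚ.++⁺ʳ R₁) , (λ n → n) ]′ (fr₀ p₀))
                      , (λ p₁ → [ (λ r → fresh₁ r) , (λ n → n) ]′ (fr₁ p₁)) ]′ (Anyₚ.++⁻ s₀ p)
      ; size = size
      ; loss = loss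
      ; link = link
      }
      where
      few : ∀ (R : List V) → length R * θ ≤ N → length R ≤ q
      few R h = *-cancelʳ-≤ (length R) q θ {{>-nonZero 1≤θ}} (≤-trans h N≤)
      size : length (s₀ ++ s₁) ≤ 2 * q + 2 * (q * q)
      size = begin
        length (s₀ ++ s₁)                                                    ≡⟨ length-++ s₀ ⟩
        length s₀ + length s₁                                                ≤⟨ len ⟩
        length R₂ + length R₁ + 2 * length (cartesianProduct R₁ R₂)          ≡⟨ cong (λ m → length R₂ + length R₁ + 2 * m) (length-cartesianProduct R₁ R₂) ⟩
        length R₂ + length R₁ + 2 * (length R₁ * length R₂)                  ≤⟨ +-mono-≤ (+-mono-≤ (few R₂ len₂) (few R₁ len₁)) (*-monoʳ-≤ 2 (*-mono-≤ (few R₁ len₁) (few R₂ len₂))) ⟩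
        q + q + 2 * (q * q)                                                  ≡⟨ cong (λ m → q + m + 2 * (q * q)) (sym (+-identityʳ q)) ⟩
        2 * q + 2 * (q * q)                                                  ∎
        where open ≤-Reasoning
      loss : ∀ v → v ∉ Z → v ∉ s₀ ++ s₁ → # (λ u → G v u ∧ not (hits R₁ u ∧ hits R₂ u)) ≤ 2 * θ
      loss v v∉Z v∉ = ≤-trans (sum-mono λ u → ∧-loss (G v u) (hits R₁ u) (hits R₂ u))
          (≤-trans (≤-reflexive (∑-distrib-+ (λ u → ⟦ G v u ∧ not (hits R₁ u) ⟧) (λ u → ⟦ G v u ∧ not (hits R₂ u) ⟧)))
            (≤-trans (+-mono-≤ (<⇒≤ (miss₁ v v∉Z v∉R₁)) (<⇒≤ (miss₂ v (λ p → [ v∉R₁ , v∉Z ]′ (Anyₚ.++⁻ R₁ p)) v∉R₂)))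
              (≤-reflexive (cong (θ +_) (sym (+-identityʳ θ))))))
        where
        v∉R₁ : v ∉ R₁
        v∉R₁ p = v∉ (Anyₚ.++⁺ʳ s₀ (sub₁ p))
        v∉R₂ : v ∉ R₂
        v∉R₂ p = v∉ (Anyₚ.++⁺ˡ (sub₀ p))
      H : Bool → List V
      H false = R₁
      H true = R₂
      onH : ∀ π {r} → r ∈ H π → On s₀ s₁ (not π) r
      onH false p = sub₁ p
      onH true p = sub₀ p
      link : ∀ (E : Graph N) →
          (∀ u v → E u v ≡ true → Adj u v × (u ∉ Z × u ∉ s₀ ++ s₁ × hits R₁ u ∧ hits R₂ u ≡ true)
            × (v ∉ Z × v ∉ s₀ ++ s₁ × hits R₁ v ∧ hits R₂ v ≡ true)) →
          ∀ {π a b} → hits R₁ a ∧ hits R₂ a ≡ true → Walk E π a b →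
          ∃ λ I → Chain Adj a (I ++ b ∷ []) b × Unique I × (∀ {x} → x ∈ I → x ∈ s₀ ++ s₁) × par (length I) ≡ not π
      link E inE {π} {a} {b} oka w with hits-sound R₁ a (proj₁ (∧-true oka))
      ... | r , r∈ , ra with trace false r∈ ra w
        where
        hub : ∀ β u → hits R₁ u ∧ hits R₂ u ≡ true → ∃ λ r → r ∈ H β × Adj r u
        hub false u p = hits-sound R₁ u (proj₁ (∧-true p))
        hub true u p = hits-sound R₂ u (proj₂ (∧-true {hits R₁ u} p))
        -- The edge from `u` to `v` is itself a candidate for this pair of hubs, so an edge was
        -- reserved for the pair. For `β = true` the reserved path is run backwards.
        hop : ∀ β {r r′ u v} → r ∈ H β → r′ ∈ H (not β) → Adj r u → Adj r′ v → E u v ≡ true →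
          ∃ λ l → Chain (Side s₀ s₁) r l r′
        hop false {r} {r′} {u} {v} p q ru rv e with inE u v e
        ... | uv , (u∉Z , u∉ , _) , (v∉Z , v∉ , _)
            with serve (∈-cartesianProduct⁺ p q) u v u∉Z (u∉ ∘ Anyₚ.++⁺ˡ) (u∉ ∘ Anyₚ.++⁺ʳ s₀)
                   v∉Z (v∉ ∘ Anyₚ.++⁺ˡ) (v∉ ∘ Anyₚ.++⁺ʳ s₀) ru uv (trans (symm v r′) rv)
        ... | x , y , x∈ , y∈ , rx , xy , yr = x ∷ y ∷ r′ ∷ [] ,
              (rx , inj₂ (sub₁ p , x∈)) ∷ (xy , inj₁ (x∈ , y∈)) ∷ (yr , inj₂ (y∈ , sub₀ q)) ∷ []
        hop true {r} {r′} {u} {v} p q ru rv e with inE u v e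
        ... | uv , (u∉Z , u∉ , _) , (v∉Z , v∉ , _)
            with serve (∈-cartesianProduct⁺ q p) v u v∉Z (v∉ ∘ Anyₚ.++⁺ˡ) (v∉ ∘ Anyₚ.++⁺ʳ s₀)
                   u∉Z (u∉ ∘ Anyₚ.++⁺ˡ) (u∉ ∘ Anyₚ.++⁺ʳ s₀) rv (trans (symm v u) uv) (trans (symm u r) ru)
        ... | x , y , x∈ , y∈ , rx , xy , yr = y ∷ x ∷ r′ ∷ [] ,
              (trans (symm r y) yr , inj₁ (sub₀ p , y∈)) ∷ (trans (symm y x) xy , inj₂ (y∈ , x∈))
              ∷ (trans (symm x r′) rx , inj₁ (x∈ , sub₁ q)) ∷ []
        trace : ∀ β {π r a b} → r ∈ H β → Adj r a → Walk E π a b →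
          ∃₂ λ l r′ → Chain (Side s₀ s₁) r l r′ × r′ ∈ H (π xor β) × Adj r′ b
        trace β {r = r} p ra stay = [] , r , [] , p , ra
        trace β p ra (step {π} {a} {c} e w) with hub (not β) c (proj₂ (proj₂ (proj₂ (proj₂ (inE a c e)))))
        ... | r″ , p″ , rc with hop β p p″ ra rc e | trace (not β) p″ rc w
        ... | l₁ , c₁ | l₂ , r‴ , c₂ , p‴ , rb = l₁ ++ l₂ , r‴ , chain-++ c₁ c₂ ,
              subst (λ γ → r‴ ∈ H γ) (xor-not π β) p‴ , rb
      -- The first hub lies in `s₁` and the last on the side given by `π`, so the parity is known
      -- even after loops are erased.
      ... | l , r′ , c , r′∈ , r′b with simplify Fin._≟_ c
      ... | l′ , c′ , u′ , _ = r ∷ l′ ,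
            trans (symm a r) ra ∷ chain-++ (chain-map proj₁ c′) (r′b ∷ []) , u′ ,
            (λ { (here refl) → Anyₚ.++⁺ʳ s₀ (sub₁ r∈) ; (there p) → side-members s₀ s₁ c′ p }) ,
            cong not (bit _ _ (on-unique s₀ s₁ dis _ _ (side-parity s₀ s₁ dis true (sub₁ r∈) c′)
              (onH (π xor false) r′∈)))
        where
        bit : ∀ p π → p xor true ≡ not (π xor false) → p ≡ π
        bit false false _ = refl
        bit false true ()
        bit true false ()
        bit true true _ = refl

-- Filling gaps, and hubs for adjusting the length

split-list : ∀ {A : Set} {P Q : A → Set} (L : List A) → (∀ {v} → v ∈ L → P v ⊎ Q v) →
  ∃₂ λ L₁ L₂ → L₁ ⊆ L × L₂ ⊆ L × length L₁ + length L₂ ≡ length L × (∀ {v} → v ∈ L₁ → P v) × (∀ {v} → v ∈ L₂ → Q v)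
split-list [] _ = [] , [] , [] , [] , refl , (λ ()) , (λ ())
split-list (x ∷ L) h with split-list L (h ∘ there) | h (here refl)
... | L₁ , L₂ , s₁ , s₂ , len , p , q | inj₁ px = x ∷ L₁ , L₂ , refl ∷ s₁ , x ∷ʳ s₂ , cong suc len ,
  (λ { (here refl) → px ; (there m) → p m }) , q
... | L₁ , L₂ , s₁ , s₂ , len , p , q | inj₂ qx = L₁ , x ∷ L₂ , x ∷ʳ s₁ , refl ∷ s₂ , trans (+-suc _ _) (cong suc len) ,
  p , (λ { (here refl) → qx ; (there m) → q m })

⊆⇒∈ : ∀ {A : Set} {l l′ : List A} → l ⊆ l′ → ∀ {x} → x ∈ l → x ∈ l′
⊆⇒∈ (_ ∷ʳ s) p = there (⊆⇒∈ s p)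
⊆⇒∈ (refl ∷ s) (here refl) = here refl
⊆⇒∈ (refl ∷ s) (there p) = there (⊆⇒∈ s p)

par-even : ∀ n → par n ≡ false → ∃ λ a → n ≡ 2 * a
par-even zero _ = 0 , refl
par-even (suc (suc n)) p with par-even n (trans (sym (Boolₚ.not-involutive (par n))) p)
... | a , refl = suc a , cong suc (sym (+-suc a (a + 0)))

par-double : ∀ a → par (2 * a) ≡ false
par-double a = trans (par-+ a (a + 0)) (trans (cong (λ m → par a xor par m) (+-identityʳ a)) (Boolₚ.xor-same (par a)))

module Assemble {N : ℕ} (G : Graph N) (symm : ∀ x y → G x y ≡ G y x) (irr : ∀ x → G x x ≡ false) where

  private V = Fin N

  open Link G symm irr

  -- Each connector avoids all earlier ones, so that all can be used in one cycle; `Z′` collects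
  -- everything spent.
  data Connectors (θ ℓ : ℕ) : ℕ → List V → List V → Set where
    []  : ∀ {Z} → Connectors θ ℓ 0 Z Z
    _∷_ : ∀ {J Z Z′} (C : Connector Z θ ℓ) → Connectors θ ℓ J (Connector.zs C ++ Z) Z′ → Connectors θ ℓ (suc J) Z Z′

  module _ {θ ℓ : ℕ} where

    allOk : ∀ {J Z Z′} → Connectors θ ℓ J Z Z′ → VSet N
    allOk [] v = true
    allOk (C ∷ cs) v = Connector.ok C v ∧ allOk cs v

    connectors-⊆ : ∀ {J Z Z′} → Connectors θ ℓ J Z Z′ → ∀ {x} → x ∈ Z → x ∈ Z′
    connectors-⊆ [] p = p
    connectors-⊆ (C ∷ cs) p = connectors-⊆ cs (Anyₚ.++⁺ʳ (Connector.zs C) p)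

    zs-⊆ : ∀ {J Z Z′} (C : Connector Z θ ℓ) → Connectors θ ℓ J (Connector.zs C ++ Z) Z′ → ∀ {x} → x ∈ Connector.zs C → x ∈ Z′
    zs-⊆ C cs p = connectors-⊆ cs (Anyₚ.++⁺ˡ p)

    connectors-size : ∀ {J Z Z′} → Connectors θ ℓ J Z Z′ → length Z′ ≤ length Z + J * ℓ
    connectors-size [] = m≤m+n _ _
    connectors-size {suc J} {Z} (C ∷ cs) = ≤-trans (connectors-size cs) (≤-trans (+-monoˡ-≤ (J * ℓ)
      (≤-trans (≤-reflexive (length-++ (Connector.zs C))) (+-monoˡ-≤ (length Z) (Connector.size C))))
      (≤-reflexive (ring ℓ (length Z) (J * ℓ))))
      where
      ring : ∀ a b c → a + b + c ≡ b + (a + c)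
      ring = solve-∀

    connectors-loss : ∀ {J Z Z′} (cs : Connectors θ ℓ J Z Z′) v → v ∉ Z′ → # (λ u → G v u ∧ not (allOk cs u)) ≤ J * (2 * θ)
    connectors-loss [] v v∉ = ≤-reflexive (trans (sum-cong-≗ (λ u → cong ⟦_⟧ (Boolₚ.∧-zeroʳ (G v u)))) (trans (sum-const N 0) (*-zeroʳ N)))
    connectors-loss (C ∷ cs) v v∉ = ≤-trans (sum-mono λ u → ∧-loss (G v u) (Connector.ok C u) (allOk cs u))
      (≤-trans (≤-reflexive (∑-distrib-+ (λ u → ⟦ G v u ∧ not (Connector.ok C u) ⟧) (λ u → ⟦ G v u ∧ not (allOk cs u) ⟧)))
        (+-mono-≤ (Connector.loss C v (v∉ ∘ connectors-⊆ (C ∷ cs)) (v∉ ∘ zs-⊆ C cs)) (connectors-loss cs v v∉)))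

    Inside : ∀ {J Z Z′} → Connectors θ ℓ J Z Z′ → V → Set
    Inside {Z′ = Z′} cs v = v ∉ Z′ × allOk cs v ≡ true

    -- One connector bridges each gap. The walk in the conclusion has the parity of the path built,
    -- whatever lengths the connectors had; this tells in which parity the cycle has to be closed.
    fill : ∀ {J Z Z′} (cs : Connectors θ ℓ J Z Z′) (E : Graph N) →
      (∀ u v → E u v ≡ true → Adj u v × Inside cs u × Inside cs v) →
      ∀ a l → (∀ {x} → x ∈ a ∷ l → Inside cs x) → Unique (a ∷ l) → Pieces.pieces E (a ∷ l) ≤ suc J →
      (∀ {x y} → x ∈ a ∷ l → y ∈ a ∷ l → ∃ λ π → Walk E π x y) →
      ∃₂ λ F b → Chain Adj a F b × Unique (a ∷ F) × (∀ {x} → x ∈ F → x ∈ l ⊎ (x ∈ Z′ × x ∉ Z)) × b ∈ a ∷ l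
        × Walk E (par (length F)) a b × length l ≤ length F × length F ≤ length l + J * ℓ
    fill cs E inE a [] ins u few walks = [] , a , [] , [] ∷ [] , (λ ()) , here refl , stay , z≤n , z≤n
    fill {J} {Z} {Z′} cs E inE a (b ∷ l) ins (a∉ ∷ u) few walks with E a b in e
    ... | true with fill cs E inE b l (ins ∘ there) u few (λ p q → walks (there p) (there q))
    ...   | F , z , c , uF , mem , z∈ , w , lo , hi = b ∷ F , z , proj₁ (inE a b e) ∷ c ,
            All.tabulate fresh ∷ uF , (λ { (here refl) → inj₁ (here refl) ; (there p) → lift (mem p) }) ,
            there z∈ , step e w , s≤s lo , s≤s hi
      where
      fresh : ∀ {x} → x ∈ b ∷ F → a ≢ x
      fresh (here refl) = All.lookup a∉ (here refl)
      fresh (there p) with mem p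
      ... | inj₁ q = All.lookup a∉ (there q)
      ... | inj₂ (q , _) = λ { refl → proj₁ (ins (here refl)) q }
      lift : ∀ {x} → x ∈ l ⊎ (x ∈ Z′ × x ∉ Z) → x ∈ b ∷ l ⊎ (x ∈ Z′ × x ∉ Z)
      lift (inj₁ p) = inj₁ (there p)
      lift (inj₂ p) = inj₂ p
    fill [] E inE a (b ∷ l) ins (a∉ ∷ u) few walks | false =
      ⊥-elim (<⇒≱ (Pieces.pieces-pos E b l) (s≤s⁻¹ few))
    fill {suc J} {Z} {Z′} (C ∷ cs) E inE a (b ∷ l) ins (a∉ ∷ u) few walks | false
      with fill cs E (λ x y p → let xy , (nx , ox) , (ny , oy) = inE x y p in
                        xy , (nx , proj₂ (∧-true {ok x} ox)) , (ny , proj₂ (∧-true {ok y} oy)))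
             b l (λ p → let nx , ox = ins (there p) in nx , proj₂ (∧-true {ok _} ox)) u (s≤s⁻¹ few) (λ p q → walks (there p) (there q))
         | walks (here refl) (there (here refl))
      where open Connector C using (ok)
    ... | F , z , c , uF , mem , z∈ , w , lo , hi | π , v
        with Connector.link C E (λ x y p → let xy , (nx , ox) , (ny , oy) = inE x y p in
               xy , (nx ∘ connectors-⊆ (C ∷ cs) , nx ∘ zs-⊆ C cs , proj₁ (∧-true ox)) , (ny ∘ connectors-⊆ (C ∷ cs) , ny ∘ zs-⊆ C cs , proj₁ (∧-true oy)))
               (proj₁ (∧-true (proj₂ (ins (here refl))))) v
    ... | I , d , uI , memI , parI = I ++ b ∷ F , z ,
          subst (λ m → Chain Adj a m z) (++-assoc I (b ∷ []) F) (chain-++ d c) ,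
          All.tabulate fresh ∷ Uniqueₚ.++⁺ uI uF (λ { (p , q) → apart p q }) ,
          mem′ , there z∈ , subst (λ σ → Walk E σ a z) parity′ (walk-++ v w) ,
          ≤-trans (s≤s lo) (≤-trans (m≤n+m _ (length I)) (≤-reflexive (sym (length-++ I)))) ,
          ≤-trans (≤-reflexive (length-++ I)) (≤-trans (+-mono-≤ I≤ (s≤s hi)) (≤-reflexive (ring ℓ (length l) (J * ℓ))))
      where
      open Connector C using (zs; size)
      inside : ∀ {x} → x ∈ a ∷ b ∷ l → x ∉ Z′
      inside p = proj₁ (ins p)
      apart : ∀ {x} → x ∈ I → x ∉ b ∷ F
      apart p (here refl) = inside (there (here refl)) (zs-⊆ C cs (memI p))
      apart p (there q) with mem q
      ... | inj₁ r = inside (there (there r)) (zs-⊆ C cs (memI p))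
      ... | inj₂ (_ , n) = n (Anyₚ.++⁺ˡ (memI p))
      fresh : ∀ {x} → x ∈ I ++ b ∷ F → a ≢ x
      fresh p refl with Anyₚ.++⁻ I p
      ... | inj₁ q = inside (here refl) (zs-⊆ C cs (memI q))
      ... | inj₂ (here refl) = All.lookup a∉ (here refl) refl
      ... | inj₂ (there q) with mem q
      ...   | inj₁ r = All.lookup a∉ (there r) refl
      ...   | inj₂ (r , _) = inside (here refl) r
      mem′ : ∀ {x} → x ∈ I ++ b ∷ F → x ∈ b ∷ l ⊎ (x ∈ Z′ × x ∉ Z)
      mem′ p with Anyₚ.++⁻ I p
      ... | inj₁ q = inj₂ (zs-⊆ C cs (memI q) , Connector.fresh C (memI q))
      ... | inj₂ (here refl) = inj₁ (here refl)
      ... | inj₂ (there q) with mem q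
      ...   | inj₁ r = inj₁ (there r)
      ...   | inj₂ (r , n) = inj₂ (r , n ∘ Anyₚ.++⁺ʳ zs)
      parity′ : π xor par (length F) ≡ par (length (I ++ b ∷ F))
      parity′ = sym (trans (cong par (length-++ I)) (trans (par-+ (length I) _)
        (trans (cong (_xor not (par (length F))) parI) (flip π (par (length F))))))
        where
        flip : ∀ a b → not a xor not b ≡ a xor b
        flip false b = Boolₚ.not-involutive b
        flip true b = refl
      I≤ : length I ≤ ℓ
      I≤ = ≤-trans (unique-length I zs uI memI) size
      ring : ∀ a b c → a + suc (b + c) ≡ suc b + (a + c)
      ring = solve-∀

    connectors : ∀ q → 1 ≤ θ → N ≤ q * θ → ℓ ≡ 2 * q + 2 * (q * q) → ∀ J Z → ∃ (Connectors θ ℓ J Z)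
    connectors q 1≤θ N≤ refl zero Z = Z , []
    connectors q 1≤θ N≤ refl (suc J) Z = let C = connector Z θ q 1≤θ N≤ ; Z′ , cs = connectors q 1≤θ N≤ refl J (Connector.zs C ++ Z) in Z′ , C ∷ cs

  -- The levels are disjoint dominating sets: a vertex hit by all of them has a hub on each, and
  -- hubs of different levels are distinct.
  data Hubs (θ : ℕ) : ℕ → List V → List V → Set where
    []    : ∀ {Z} → Hubs θ 0 Z Z
    level : ∀ {T Z Z′} (R : List V) → (∀ {r} → r ∈ R → r ∉ Z) → length R * θ ≤ N →
            (∀ v → v ∉ Z → v ∉ R → missed R v < θ) → Hubs θ T (R ++ Z) Z′ → Hubs θ (suc T) Z Z′

  hubs : ∀ θ → 1 ≤ θ → ∀ T Z → ∃ (Hubs θ T Z)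
  hubs θ 1≤θ zero Z = Z , []
  hubs θ 1≤θ (suc T) Z = let R , fr , len , miss = dominate θ 1≤θ Z ; Z′ , hs = hubs θ 1≤θ T (R ++ Z) in
    Z′ , level R fr len miss hs

  module _ {θ : ℕ} where

    allHit : ∀ {T Z Z′} → Hubs θ T Z Z′ → VSet N
    allHit [] v = true
    allHit (level R _ _ _ hs) v = hits R v ∧ allHit hs v

    hubs-⊆ : ∀ {T Z Z′} → Hubs θ T Z Z′ → ∀ {x} → x ∈ Z → x ∈ Z′
    hubs-⊆ [] p = p
    hubs-⊆ (level R _ _ _ hs) p = hubs-⊆ hs (Anyₚ.++⁺ʳ R p)

    hubs-size : ∀ {T Z Z′} q → 1 ≤ θ → N ≤ q * θ → Hubs θ T Z Z′ → length Z′ ≤ length Z + T * q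
    hubs-size q 1≤θ N≤ [] = m≤m+n _ _
    hubs-size {suc T} {Z} q 1≤θ N≤ (level R _ len _ hs) = ≤-trans (hubs-size q 1≤θ N≤ hs) (≤-trans (+-monoˡ-≤ (T * q)
      (≤-trans (≤-reflexive (length-++ R)) (+-monoˡ-≤ (length Z)
        (*-cancelʳ-≤ (length R) q θ {{>-nonZero 1≤θ}} (≤-trans len N≤)))))
      (≤-reflexive (ring q (length Z) (T * q))))
      where
      ring : ∀ a b c → a + b + c ≡ b + (a + c)
      ring = solve-∀

    hubs-loss : ∀ {T Z Z′} (hs : Hubs θ T Z Z′) v → v ∉ Z′ → # (λ u → G v u ∧ not (allHit hs u)) ≤ T * θ
    hubs-loss [] v v∉ = ≤-reflexive (trans (sum-cong-≗ (λ u → cong ⟦_⟧ (Boolₚ.∧-zeroʳ (G v u)))) (trans (sum-const N 0) (*-zeroʳ N)))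
    hubs-loss (level R fr len miss hs) v v∉ = ≤-trans (sum-mono λ u → ∧-loss (G v u) (hits R u) (allHit hs u))
      (≤-trans (≤-reflexive (∑-distrib-+ (λ u → ⟦ G v u ∧ not (hits R u) ⟧) (λ u → ⟦ G v u ∧ not (allHit hs u) ⟧)))
        (+-mono-≤ (<⇒≤ (miss v (v∉ ∘ hubs-⊆ hs ∘ Anyₚ.++⁺ʳ R) (v∉ ∘ hubs-⊆ hs ∘ Anyₚ.++⁺ˡ))) (hubs-loss hs v v∉)))

    pigeon : ∀ R L m → (∀ {v} → v ∈ L → hits R v ≡ true) → length R * m < length L →
      ∃₂ λ r L′ → r ∈ R × L′ ⊆ L × m < length L′ × (∀ {v} → v ∈ L′ → Adj r v)
    pigeon [] (x ∷ L) m hit _ = case hit (here refl) of λ ()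
    pigeon (r ∷ R) L m hit big with split-list {P = Adj r} {Q = λ v → hits R v ≡ true} L (λ {v} p → either v (hit p))
      where
      either : ∀ v → G r v ∨ hits R v ≡ true → Adj r v ⊎ hits R v ≡ true
      either v h with G r v
      ... | true = inj₁ refl
      ... | false = inj₂ h
    ... | L₁ , L₂ , s₁ , s₂ , len , p , q with m <? length L₁
    ... | yes lt = r , L₁ , here refl , s₁ , lt , p
    ... | no ge with pigeon R L₂ m q (+-cancelˡ-< m _ _ (<-≤-trans big (≤-trans (≤-reflexive (sym len)) (+-monoˡ-≤ _ (≮⇒≥ ge)))))
    ... | r′ , L′ , r′∈ , s′ , lt , adj = r′ , L′ , there r′∈ , ⊆-trans s′ s₂ , lt , adj

    -- On each level the pigeonhole principle leaves at least a share 1/q of the vertices attached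
    -- to a single hub.
    pick : ∀ {T Z Z′} (hs : Hubs θ T Z Z′) q → 1 ≤ θ → N ≤ q * θ → ∀ m L → (∀ {v} → v ∈ L → allHit hs v ≡ true) → q ^ T * m < length L →
      ∃₂ λ rs L′ → length rs ≡ T × Unique rs × (∀ {r} → r ∈ rs → r ∈ Z′ × r ∉ Z) × L′ ⊆ L × m < length L′
        × (∀ {r v} → r ∈ rs → v ∈ L′ → Adj r v)
    pick [] q 1≤θ N≤ m L hit big = [] , L , refl , [] , (λ ()) , ⊆-refl , subst (_< length L) (+-identityʳ m) big , λ ()
    pick {suc T} (level R fr len miss hs) q 1≤θ N≤ m L hit big
      with pigeon R L (q ^ T * m) (λ p → proj₁ (∧-true (hit p)))
             (≤-<-trans (*-monoˡ-≤ (q ^ T * m) (*-cancelʳ-≤ (length R) q θ {{>-nonZero 1≤θ}} (≤-trans len N≤)))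
               (subst (_< length L) (*-assoc q (q ^ T) m) big))
    ... | r , L₁ , r∈ , s₁ , lt₁ , adj₁
        with pick hs q 1≤θ N≤ m L₁ (λ {v} p → proj₂ (∧-true {hits R v} (hit (⊆⇒∈ s₁ p)))) lt₁
    ... | rs , L₂ , lenr , ur , mem , s₂ , lt₂ , adj₂ = r ∷ rs , L₂ , cong suc lenr ,
          All.tabulate (λ { p refl → proj₂ (mem p) (Anyₚ.++⁺ˡ r∈) }) ∷ ur ,
          (λ { (here refl) → hubs-⊆ hs (Anyₚ.++⁺ˡ r∈) , fr r∈ ; (there p) → proj₁ (mem p) , proj₂ (mem p) ∘ Anyₚ.++⁺ʳ R }) ,
          ⊆-trans s₂ s₁ , lt₂ ,
          (λ { (here refl) q → adj₁ (⊆⇒∈ s₂ q) ; (there p) q → adj₂ p q })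

  -- The path is x, hub, y, hub, ..., hub, z, with `a` vertices of `ys` between a + 1 hubs, so its
  -- length can be set in steps of two.
  zigzag : ∀ a x z rs ys → (∀ {r} → r ∈ rs → Adj x r × Adj r z × (∀ {y} → y ∈ ys → Adj r y)) →
    Unique rs → Unique ys → Disj rs ys → a < length rs → a ≤ length ys →
    ∃ λ I → Chain Adj x (I ++ z ∷ []) z × length I ≡ suc (2 * a) × Unique I × (∀ {y} → y ∈ I → y ∈ rs ⊎ y ∈ ys)
  zigzag zero x z (r ∷ rs) ys adj ur uy dis a< a≤ = r ∷ [] ,
    proj₁ (adj (here refl)) ∷ proj₁ (proj₂ (adj (here refl))) ∷ [] , refl , [] ∷ [] , λ { (here refl) → inj₁ (here refl) }
  zigzag (suc a) x z (r ∷ rs) (y ∷ ys) adj (r∉ ∷ ur) (y∉ ∷ uy) dis (s≤s a<) (s≤s a≤)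
    with zigzag a y z rs ys (λ p → let _ , rz , ry = adj (there p) in trans (symm y _) (ry (here refl)) , rz , ry ∘ there)
           ur uy (λ p q → dis (there p) (there q)) a< a≤
  ... | I , c , len , uI , mem = r ∷ y ∷ I ,
        proj₁ (adj (here refl)) ∷ proj₂ (proj₂ (adj (here refl))) (here refl) ∷ c ,
        cong (λ m → suc (suc m)) (trans len (sym (+-suc a (a + 0)))) ,
        All.tabulate freshR ∷ All.tabulate freshY ∷ uI ,
        (λ { (here refl) → inj₁ (here refl) ; (there (here refl)) → inj₂ (here refl) ; (there (there p)) → lift (mem p) })
    where
    freshR : ∀ {v} → v ∈ y ∷ I → r ≢ v
    freshR (here refl) refl = dis (here refl) (here refl)
    freshR (there p) refl with mem p
    ... | inj₁ q = All.lookup r∉ q refl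
    ... | inj₂ q = dis (here refl) (there q)
    freshY : ∀ {v} → v ∈ I → y ≢ v
    freshY p refl with mem p
    ... | inj₁ q = dis (there q) (here refl)
    ... | inj₂ q = All.lookup y∉ q refl
    lift : ∀ {v} → v ∈ rs ⊎ v ∈ ys → v ∈ r ∷ rs ⊎ v ∈ y ∷ ys
    lift (inj₁ p) = inj₁ (there p)
    lift (inj₂ p) = inj₂ (there p)

-- Closing up to a cycle of the exact length

cut-at : ∀ {A : Set} m (l : List A) → m ≤ length l → ∃₂ λ l₁ l₂ → l ≡ l₁ ++ l₂ × length l₁ ≡ m
cut-at zero l _ = [] , l , refl , refl
cut-at (suc m) (x ∷ l) (s≤s le) = let l₁ , l₂ , eq , len = cut-at m l le in x ∷ l₁ , l₂ , cong (x ∷_) eq , cong suc len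

unique-++⁻ : ∀ {A : Set} (l l′ : List A) → Unique (l ++ l′) → Unique l × Unique l′ × (∀ {x} → x ∈ l → x ∉ l′)
unique-++⁻ [] l′ u = [] , u , λ ()
unique-++⁻ (x ∷ l) l′ (x∉ ∷ u) with unique-++⁻ l l′ u
... | ul , ul′ , dis = All.tabulate (λ p → All.lookup x∉ (Anyₚ.++⁺ˡ p)) ∷ ul , ul′ ,
  λ { (here refl) q → All.lookup x∉ (Anyₚ.++⁺ʳ l q) refl ; (there p) → dis p }

module Closing {N : ℕ} (G : Graph N) (symm : ∀ x y → G x y ≡ G y x) (irr : ∀ x → G x x ≡ false) where

  private V = Fin N

  open Link G symm irr
  open Assemble G symm irr

  ClosedWalk : ℕ → Set
  ClosedWalk n = ∃₂ λ x L → Chain Adj x (L ++ x ∷ []) x × Unique (x ∷ L) × suc (length L) ≡ n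

  front-pair : ∀ (E : Graph N) → (∀ x y → E x y ≡ E y x) → ∀ T z ρ L → (∀ {v} → v ∈ L → Walk E ρ z v) → suc T < length L →
    ∃₂ λ x₀ x₁ → ∃ λ ys → (x₀ ∷ x₁ ∷ ys) ⊆ L × T ≤ length ys × Walk E false x₁ x₀
  front-pair E symE T z ρ (x₀ ∷ x₁ ∷ ys) w (s≤s (s≤s le)) = x₀ , x₁ , ys , ⊆-refl , le ,
    subst (λ σ → Walk E σ x₁ x₀) (Boolₚ.xor-same ρ) (walk-++ (walk-reverse symE (w (there (here refl)))) (w (here refl)))
  front-pair E symE T z ρ (_ ∷ []) _ (s≤s ())

  -- Sort `L` by the parity of a walk from its first vertex. One class has at least T + 2 members,
  -- any two of them joined by an even walk; two become the ends of the zigzag, the others its inner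
  -- vertices.
  twins : ∀ (E : Graph N) → (∀ x y → E x y ≡ E y x) → ∀ T L →
    (∀ {x y} → x ∈ L → y ∈ L → ∃ λ π → Walk E π x y) → 2 * suc T < length L →
    ∃₂ λ x₀ x₁ → ∃ λ ys → (x₀ ∷ x₁ ∷ ys) ⊆ L × T ≤ length ys × Walk E false x₁ x₀
  twins E symE T (z ∷ L) walks big
    with split-list {P = Walk E false z} {Q = Walk E true z} (z ∷ L) (λ {v} p → byParity v (walks (here refl) p))
    where
    byParity : ∀ v → (∃ λ π → Walk E π z v) → Walk E false z v ⊎ Walk E true z v
    byParity v (false , w) = inj₁ w
    byParity v (true , w) = inj₂ w
  ... | L₁ , L₂ , s₁ , s₂ , len , w₁ , w₂ with suc T <? length L₁
  ... | yes lt = let x₀ , x₁ , ys , s , r = front-pair E symE T z false L₁ w₁ lt in x₀ , x₁ , ys , ⊆-trans s s₁ , r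
  ... | no ge = let x₀ , x₁ , ys , s , r = front-pair E symE T z true L₂ w₂ big₂ in x₀ , x₁ , ys , ⊆-trans s s₂ , r
    where
    big₂ = +-cancelˡ-< (suc T) _ _ (<-≤-trans (subst (_< suc (length L)) (cong (suc T +_) (+-identityʳ (suc T))) big)
                  (≤-trans (≤-reflexive (sym len)) (+-monoˡ-≤ _ (≮⇒≥ ge))))

  Alive : ∀ {θ₁ ℓ J Z₀ Zc θ₂ T Z} → Connectors θ₁ ℓ J Z₀ Zc → Hubs θ₂ T Zc Z → V → Set
  Alive {Z = Z} cs hs v = v ∉ Z × allOk cs v ≡ true × allHit hs v ≡ true

  -- The four parts of the cycle live in disjoint zones: hubs in Z ∖ Zc, the closing
  -- connector in zs, the other connectors in Zc ∖ zs, all remaining vertices outside Z.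
  assemble : ∀ (Z Zc zs : List V) → (∀ {x} → x ∈ Zc → x ∈ Z) → (∀ {x} → x ∈ zs → x ∈ Zc) →
    ∀ x₀ x₁ ys rs Q → Unique (x₀ ∷ x₁ ∷ ys) → (∀ {x} → x ∈ x₀ ∷ x₁ ∷ ys → x ∉ Z × x ∉ Q) →
    (∀ {x} → x ∈ Q → x ∉ Z) → (∀ {x} → x ∈ rs → x ∈ Z × x ∉ Zc) →
    ∀ Y → Chain Adj x₀ (Y ++ x₁ ∷ []) x₁ → Unique Y → (∀ {x} → x ∈ Y → x ∈ rs ⊎ x ∈ ys) →
    ∀ F b → Chain Adj x₁ F b → Unique (x₁ ∷ F) → (∀ {x} → x ∈ F → x ∈ Q ⊎ (x ∈ Zc × x ∉ zs)) →
    ∀ I → Chain Adj b (I ++ x₀ ∷ []) x₀ → Unique I → (∀ {x} → x ∈ I → x ∈ zs) →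
    ClosedWalk (suc (length (Y ++ (x₁ ∷ F) ++ I)))
  assemble Z Zc zs Zc⊆ zs⊆ x₀ x₁ ys rs Q ((x₀≢x₁ ∷ x₀∉ys) ∷ (x₁∉ys ∷ uys)) out outQ memr Y cY uY memY F b cF uF memF I cI uI memI =
    x₀ , Y ++ (x₁ ∷ F) ++ I ,
    subst (λ m → Chain Adj x₀ m x₀) assoc (chain-++ cY (chain-++ cF cI)) ,
    All.tabulate first ∷ Uniqueₚ.++⁺ uY (Uniqueₚ.++⁺ uF uI (λ { (m , m′) → apartFI m m′ })) (λ { (m , m′) → apartY m m′ }) ,
    refl
    where
    x∉F : ∀ {x} → x ∈ x₀ ∷ x₁ ∷ ys → x ∉ F
    x∉F m m′ with memF m′
    ... | inj₁ q = proj₂ (out m) q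
    ... | inj₂ (q , _) = proj₁ (out m) (Zc⊆ q)
    x∉I : ∀ {x} → x ∈ x₀ ∷ x₁ ∷ ys → x ∉ I
    x∉I m m′ = proj₁ (out m) (Zc⊆ (zs⊆ (memI m′)))
    apartFI : ∀ {x} → x ∈ x₁ ∷ F → x ∉ I
    apartFI (here refl) m = x∉I (there (here refl)) m
    apartFI (there m′) m with memF m′
    ... | inj₁ q = outQ q (Zc⊆ (zs⊆ (memI m)))
    ... | inj₂ (_ , n) = n (memI m)
    apartY : ∀ {x} → x ∈ Y → x ∉ (x₁ ∷ F) ++ I
    apartY m m′ with memY m | Anyₚ.++⁻ (x₁ ∷ F) m′
    ... | inj₁ r | inj₁ (here refl) = proj₁ (out (there (here refl))) (proj₁ (memr r))
    ... | inj₂ y | inj₁ (here refl) = All.lookup x₁∉ys y refl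
    ... | inj₂ y | inj₁ (there f) = x∉F (there (there y)) f
    ... | inj₂ y | inj₂ i = x∉I (there (there y)) i
    ... | inj₁ r | inj₂ i = proj₂ (memr r) (zs⊆ (memI i))
    ... | inj₁ r | inj₁ (there f) with memF f
    ...   | inj₁ q = outQ q (proj₁ (memr r))
    ...   | inj₂ (z , _) = proj₂ (memr r) z
    first : ∀ {x} → x ∈ Y ++ (x₁ ∷ F) ++ I → x₀ ≢ x
    first m refl with Anyₚ.++⁻ Y m
    ... | inj₁ j with memY j
    ...   | inj₁ r = proj₁ (out (here refl)) (proj₁ (memr r))
    ...   | inj₂ y = All.lookup x₀∉ys y refl
    first m refl | inj₂ m′ with Anyₚ.++⁻ (x₁ ∷ F) m′
    ...   | inj₁ (here refl) = x₀≢x₁ refl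
    ...   | inj₁ (there f) = x∉F (here refl) f
    ...   | inj₂ i = x∉I (here refl) i
    assoc : (Y ++ x₁ ∷ []) ++ (F ++ (I ++ x₀ ∷ [])) ≡ (Y ++ (x₁ ∷ F) ++ I) ++ x₀ ∷ []
    assoc = trans (++-assoc Y (x₁ ∷ []) _) (trans (cong (λ m → Y ++ x₁ ∷ m) (sym (++-assoc F I (x₀ ∷ [])))) (sym (++-assoc Y ((x₁ ∷ F) ++ I) (x₀ ∷ []))))

  -- The cycle consists of x₀, the zigzag, x₁, the `f` vertices of the filled path and the `i` of
  -- the last connector. With the shortest zigzag these are f + i + 3, an even number since the last
  -- connector makes f + i odd. The rest of the even `n` is made up by `a` pairs, fewer than `W`
  -- because f ≥ n - W.
  adjust : ∀ n p f i W → par n ≡ false → W + p ≡ n → p ≤ f → f + i + 3 ≤ n → par i ≡ not (par f xor false) →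
    ∃ λ a → suc (suc (2 * a) + (suc f + i)) ≡ n × a < W
  adjust n p f i W even W+p p≤f X≤ pi with m≤n⇒∃[o]m+o≡n X≤
  ... | d , eq with par-even d (trans (cong (_xor par d) (sym parX)) (trans (sym (par-+ (f + i + 3) d)) (trans (cong par eq) even)))
    where
    odd : ∀ a → (a xor not (a xor false)) xor true ≡ false
    odd false = refl
    odd true = refl
    parX : par (f + i + 3) ≡ false
    parX = trans (par-+ (f + i) 3) (trans (cong (_xor true) (trans (par-+ f i) (cong (par f xor_) pi))) (odd (par f)))
  ... | a , refl = a , trans (ring a f i) eq ,
        +-cancelʳ-≤ p _ _ (lin _ _ _ (+-mono-≤ p≤f (≤-reflexive (trans eq (sym W+p)))) (ring′ W p f i a))
    where
    ring : ∀ a f i → suc (suc (2 * a) + (suc f + i)) ≡ f + i + 3 + 2 * a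
    ring = solve-∀
    ring′ : ∀ W p f i a → W + p + (p + (f + i + 3 + 2 * a)) ≡ suc a + p + (f + (W + p)) + (2 + i + a)
    ring′ = solve-∀

  module _ {θ₁ ℓ B Zc θ₂ T Z} (C : Connector [] θ₁ ℓ) (cs : Connectors θ₁ ℓ B (Connector.zs C ++ []) Zc) (hs : Hubs θ₂ T Zc Z)
    (E : Graph N) (symE : ∀ x y → E x y ≡ E y x)
    (inE : ∀ u v → E u v ≡ true → Adj u v × Alive (C ∷ cs) hs u × Alive (C ∷ cs) hs v) where

    ∉Zc : ∀ {x} → Alive (C ∷ cs) hs x → x ∉ Zc
    ∉Zc (n , _) = n ∘ hubs-⊆ hs

    inside : ∀ {x} → Alive (C ∷ cs) hs x → Inside cs x
    inside a@(_ , o , _) = ∉Zc a , proj₂ (∧-true {Connector.ok C _} o)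

    route : ∀ h W p → W ≡ suc B * ℓ + 3 → W + p ≡ 2 * h → W ≤ T →
      ∀ x₀ x₁ ys rs Q → Unique (x₀ ∷ x₁ ∷ ys) → (∀ {x} → x ∈ x₀ ∷ x₁ ∷ ys → Alive (C ∷ cs) hs x × x ∉ Q) →
      (∀ {x} → x ∈ Q → Alive (C ∷ cs) hs x) → Unique Q → length Q ≡ p → Pieces.pieces E Q ≤ B →
      (∀ {x y} → x ∈ x₁ ∷ Q → y ∈ x₁ ∷ Q → ∃ λ π → Walk E π x y) → Walk E false x₁ x₀ →
      length rs ≡ T → Unique rs → (∀ {x} → x ∈ rs → x ∈ Z × x ∉ Zc) → T ≤ length ys →
      (∀ {r v} → r ∈ rs → v ∈ x₀ ∷ x₁ ∷ ys → Adj r v) → ClosedWalk (2 * h)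
    route h W p W≡ W+p W≤T x₀ x₁ ys rs Q u@(_ ∷ (_ ∷ uys)) out aliveQ uQ lenQ few walks w₁₀ lenr ur memr T≤ adjr
      with fill cs E (λ u v e → let a , au , av = inE u v e in a , inside au , inside av) x₁ Q
             (λ { (here refl) → inside (proj₁ (out (there (here refl)))) ; (there m) → inside (aliveQ m) })
             (All.tabulate (λ { m refl → proj₂ (out (there (here refl))) m }) ∷ uQ)
             (≤-trans (Pieces.pieces-∷-≤ E x₁ Q) (s≤s few)) walks
    ... | F , b , cF , uF , memF , b∈ , wF , loF , hiF
        with Connector.link C E
             (λ u v e → let a , au , av = inE u v e in a ,
               ((λ ()) , ∉Zc au ∘ zs-⊆ C cs , proj₁ (∧-true (proj₁ (proj₂ au)))) ,
               ((λ ()) , ∉Zc av ∘ zs-⊆ C cs , proj₁ (∧-true (proj₁ (proj₂ av)))))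
             -- The closing walk leads back from `b` to `x₁` with the parity of `length F`, then by
             -- an even walk to `x₀`.
             (okb b∈) (walk-++ (walk-reverse symE wF) w₁₀)
      where
      okb : ∀ {b} → b ∈ x₁ ∷ Q → Connector.ok C b ≡ true
      okb (here refl) = proj₁ (∧-true (proj₁ (proj₂ (proj₁ (out (there (here refl)))))))
      okb (there m) = proj₁ (∧-true (proj₁ (proj₂ (aliveQ m))))
    ... | I , cI , uI , memI , parI
        with adjust (2 * h) p (length F) (length I) W (par-double h) W+p (subst (_≤ length F) lenQ loF) X≤ parI
      where
      X≤ : length F + length I + 3 ≤ 2 * h
      X≤ = ≤-trans (+-monoˡ-≤ 3 (+-mono-≤ hiF (≤-trans (unique-length I (Connector.zs C) uI memI) (Connector.size C))))
             (≤-trans (≤-reflexive (trans (cong (λ m → m + B * ℓ + ℓ + 3) lenQ) (trans (ring p ℓ (B * ℓ)) (cong (_+ p) (sym W≡))))) (≤-reflexive W+p))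
        where
        ring : ∀ p l m → p + m + l + 3 ≡ l + m + 3 + p
        ring = solve-∀
    ... | a , len , a<W
        with zigzag a x₀ x₁ rs ys
          (λ m → trans (symm x₀ _) (adjr m (here refl)) , adjr m (there (here refl)) , λ m′ → adjr m (there (there m′)))
          ur uys (λ m m′ → proj₁ (proj₁ (out (there (there m′)))) (proj₁ (memr m)))
          (subst (a <_) (sym lenr) (<-≤-trans a<W W≤T)) (≤-trans (<⇒≤ (<-≤-trans a<W W≤T)) T≤)
    ... | Y , cY , lenY , uY , memY = subst ClosedWalk
          (trans (cong suc (trans (length-++ Y) (cong₂ _+_ lenY (length-++ (x₁ ∷ F))))) len)
          (assemble Z Zc (Connector.zs C) (hubs-⊆ hs) (zs-⊆ C cs) x₀ x₁ ys rs Q u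
            (λ m → proj₁ (proj₁ (out m)) , proj₂ (out m)) (proj₁ ∘ aliveQ) memr Y cY uY memY F b cF uF
            (λ m → weaken (memF m)) I cI uI memI)
      where
      weaken : ∀ {x} → x ∈ Q ⊎ (x ∈ Zc × x ∉ Connector.zs C ++ []) → x ∈ Q ⊎ (x ∈ Zc × x ∉ Connector.zs C)
      weaken (inj₁ m) = inj₁ m
      weaken (inj₂ (m , n)) = inj₂ (m , n ∘ Anyₚ.++⁺ˡ)

    -- The first `σ` members of `Q` are spent on finding hubs; the next 2h - W form the bulk of the
    -- cycle. The margin `W` covers the worst case: all `suc B` connectors at full size `ℓ`, the
    -- twins and one hub.
    close-up : ∀ q → 1 ≤ θ₂ → N ≤ q * θ₂ → ∀ h W σ → W ≡ suc B * ℓ + 3 → W ≤ T → W ≤ 2 * h → q ^ T * (2 * suc T) < σ →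
      ∀ Q → Unique Q → (∀ {x} → x ∈ Q → Alive (C ∷ cs) hs x) → Pieces.pieces E Q ≤ B →
      (∀ {x y} → x ∈ Q → y ∈ Q → ∃ λ π → Walk E π x y) → 2 * h + σ ≤ length Q → ClosedWalk (2 * h)
    close-up q 1≤θ₂ N≤ h W σ W≡ W≤T W≤n big Q uQ alive few walks long
      with cut-at σ Q (m+n≤o⇒n≤o (2 * h) long) | m≤n⇒∃[o]m+o≡n W≤n
    ... | S , D , refl , lenS | p , W+p with cut-at p D p≤D
      where
      p≤D : p ≤ length D
      p≤D = +-cancelˡ-≤ (length S) _ _ (≤-trans (+-mono-≤ (≤-reflexive lenS) (≤-trans (m≤n+m p W) (≤-reflexive W+p)))
              (≤-trans (≤-reflexive (+-comm σ (2 * h))) (≤-trans long (≤-reflexive (length-++ S)))))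
    ... | Q₂ , D′ , refl , lenQ₂ with unique-++⁻ S (Q₂ ++ D′) uQ
    ... | uS , uD , disS with unique-++⁻ Q₂ D′ uD
    ... | uQ₂ , _ , _ with pick hs q 1≤θ₂ N≤ (2 * suc T) S (λ m → proj₂ (proj₂ (alive (Anyₚ.++⁺ˡ m)))) (<-≤-trans big (≤-reflexive (sym lenS)))
    ... | rs , L , lenr , ur , memr , L⊆S , bigL , adjr
        with twins E symE T L (λ m m′ → walks (Anyₚ.++⁺ˡ (⊆⇒∈ L⊆S m)) (Anyₚ.++⁺ˡ (⊆⇒∈ L⊆S m′))) bigL
    ... | x₀ , x₁ , ys , tw⊆L , T≤ys , w₁₀ =
      route h W p W≡ W+p W≤T x₀ x₁ ys rs Q₂ (Unique-⊆ (⊆-trans tw⊆L L⊆S) uS)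
        (λ m → alive (Anyₚ.++⁺ˡ (inS m)) , λ m′ → disS (inS m) (Anyₚ.++⁺ˡ m′))
        (λ m → alive (Anyₚ.++⁺ʳ S (Anyₚ.++⁺ˡ m))) uQ₂ lenQ₂
        (≤-trans (≤-trans (Pieces.pieces-++ˡ E Q₂ D′) (Pieces.pieces-++ʳ E S (Q₂ ++ D′))) few)
        (λ m m′ → walks (inQ m) (inQ m′)) w₁₀ lenr ur memr T≤ys (λ m m′ → adjr m (⊆⇒∈ tw⊆L m′))
      where
      inS : ∀ {x} → x ∈ x₀ ∷ x₁ ∷ ys → x ∈ S
      inS = ⊆⇒∈ (⊆-trans tw⊆L L⊆S)
      inQ : ∀ {x} → x ∈ x₁ ∷ Q₂ → x ∈ S ++ Q₂ ++ D′
      inQ (here refl) = Anyₚ.++⁺ˡ (inS (there (here refl)))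
      inQ (there m) = Anyₚ.++⁺ʳ S (Anyₚ.++⁺ˡ m)

-- Components and the cleaned graph of one colour

module _ {N : ℕ} where

  private V = Fin N

  -- Components are coded by labelling vertices with vertices. Some labels may never be taken; sums
  -- over all labels tolerate empty classes.
  Sound : Graph N → (V → V) → Set
  Sound E κ = ∀ x y → κ x ≡ κ y → ∃ λ π → Walk E π x y

  merge : (V → V) → V → V → V → V
  merge κ u v x = if κ x == κ u then κ v else κ x

  merge-sound : ∀ E → (∀ x y → E x y ≡ E y x) → ∀ κ → Sound E κ → ∀ u v → E u v ≡ true → Sound E (merge κ u v)
  merge-sound E symE κ sound u v e x y eq with κ x Fin.≟ κ u | κ y Fin.≟ κ u
  ... | yes p | yes q = sound x y (trans p (sym q))
  ... | yes p | no _ = let _ , w = sound x u p ; _ , w′ = sound v y eq in _ , walk-++ w (step e w′)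
  ... | no _ | yes q = let _ , w = sound x v eq ; _ , w′ = sound u y (sym q) in _ , walk-++ w (step (trans (symE v u) e) w′)
  ... | no _ | no _ = sound x y eq

  merge-keeps : ∀ κ u v x y → κ x ≡ κ y → merge κ u v x ≡ merge κ u v y
  merge-keeps κ u v x y eq rewrite eq = refl

  merge-joins : ∀ κ u v → merge κ u v u ≡ merge κ u v v
  merge-joins κ u v rewrite ==-refl (κ u) with κ v Fin.≟ κ u
  ... | yes _ = refl
  ... | no _ = refl

  components-over : ∀ E → (∀ x y → E x y ≡ E y x) → ∀ ps κ → Sound E κ → ∃ λ κ′ → Sound E κ′
    × (∀ x y → κ x ≡ κ y → κ′ x ≡ κ′ y) × (∀ {u v} → (u , v) ∈ ps → E u v ≡ true → κ′ u ≡ κ′ v)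
  components-over E symE [] κ sound = κ , sound , (λ _ _ p → p) , λ ()
  components-over E symE ((u , v) ∷ ps) κ sound with E u v in e
  ... | false with components-over E symE ps κ sound
  ...   | κ′ , sound′ , keep , join = κ′ , sound′ , keep , λ { (here refl) e′ → true≢false e′ e ; (there p) → join p }
  components-over E symE ((u , v) ∷ ps) κ sound | true
      with components-over E symE ps (merge κ u v) (merge-sound E symE κ sound u v e)
  ...   | κ′ , sound′ , keep , join = κ′ , sound′ , (λ x y p → keep x y (merge-keeps κ u v x y p)) ,
            λ { (here refl) _ → keep u v (merge-joins κ u v) ; (there p) → join p }

  components : ∀ E → (∀ x y → E x y ≡ E y x) → ∃ λ κ → Sound E κ × (∀ u v → E u v ≡ true → κ u ≡ κ v)
  components E symE
    with components-over E symE (cartesianProduct (allFin N) (allFin N)) (λ x → x) (λ { x .x refl → false , stay })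
  ... | κ , sound , _ , join = κ , sound , λ u v → join (∈-cartesianProduct⁺ (∈-allFin u) (∈-allFin v))

  walk-edge : ∀ {E : Graph N} {π x y} → Walk E π x y → x ≢ y → ∃ λ z → E x z ≡ true
  walk-edge stay x≢y = ⊥-elim (x≢y refl)
  walk-edge (step e _) _ = _ , e

  other : ∀ {l : List V} → Unique l → 2 ≤ length l → ∀ {x} → x ∈ l → ∃ λ y → y ∈ l × x ≢ y
  other {a ∷ b ∷ l} ((a≢b ∷ _) ∷ _) (s≤s (s≤s _)) (here refl) = b , there (here refl) , a≢b
  other {a ∷ b ∷ l} (a∉ ∷ _) (s≤s (s≤s _)) (there p) = a , here refl , λ { refl → All.lookup a∉ p refl }
  other {_ ∷ []} _ (s≤s ())

module Structure {N : ℕ} (G : Graph N) (symm : ∀ x y → G x y ≡ G y x) (irr : ∀ x → G x x ≡ false) where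

  private V = Fin N

  open import Data.List.Membership.DecPropositional (Fin._≟_ {N}) using (_∈?_)
  open Link G symm irr
  open Assemble G symm irr
  open Closing G symm irr

  restrict : VSet N → Graph N
  restrict A u v = G u v ∧ (A u ∧ A v)

  restrict-sym : ∀ A x y → restrict A x y ≡ restrict A y x
  restrict-sym A x y = cong₂ _∧_ (symm x y) (Boolₚ.∧-comm (A x) (A y))

  -- A lost pair has an end in `Z`, to which it is charged, or else an end that fails `O`, and is
  -- charged to the other end. A row then costs at most `N` or `τ`; the factor 2 is for the two
  -- orders.
  restrict-loss : ∀ Z (O : VSet N) τ → (∀ v → v ∉ Z → # (λ u → G v u ∧ not (O u)) ≤ τ) →
    total G ≤ total (restrict (λ v → not (listed Z v) ∧ O v)) + 2 * ((length Z + τ) * N)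
  restrict-loss Z O τ loss = begin
    total G
      ≤⟨ sum-mono (λ u → sum-mono (cell u)) ⟩
    sum (λ u → sum (λ v → ⟦ E u v ⟧ + (f u v + f v u)))
      ≡⟨ sum-cong-≗ (λ u → trans (∑-distrib-+ (λ v → ⟦ E u v ⟧) (λ v → f u v + f v u)) (cong (# (E u) +_) (∑-distrib-+ (f u) (λ v → f v u)))) ⟩
    sum (λ u → # (E u) + (sum (f u) + sum (λ v → f v u)))
      ≡⟨ trans (∑-distrib-+ (λ u → # (E u)) (λ u → sum (f u) + sum (λ v → f v u)))
           (cong (total E +_) (∑-distrib-+ (λ u → sum (f u)) (λ u → sum (λ v → f v u)))) ⟩
    total E + (sum (λ u → sum (f u)) + sum (λ u → sum (λ v → f v u)))
      ≡⟨ cong (λ m → total E + (sum (λ u → sum (f u)) + m)) (trans (∑-comm (λ u v → f v u)) (sym (+-identityʳ _))) ⟩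
    total E + 2 * sum (λ u → sum (f u))
      ≤⟨ +-monoʳ-≤ (total E) (*-monoʳ-≤ 2 half) ⟩
    total E + 2 * ((length Z + τ) * N) ∎
    where
    open ≤-Reasoning
    inZ : VSet N
    inZ = listed Z
    E = restrict (λ v → not (inZ v) ∧ O v)
    f : V → V → ℕ
    f u v = ⟦ inZ u ⟧ + ⟦ not (inZ u) ∧ (G u v ∧ not (O v)) ⟧
    bits : ∀ g a b o p → ⟦ g ⟧ ≤ ⟦ g ∧ ((not a ∧ o) ∧ (not b ∧ p)) ⟧ + ((⟦ a ⟧ + ⟦ not a ∧ (g ∧ not p) ⟧) + (⟦ b ⟧ + ⟦ not b ∧ (g ∧ not o) ⟧))
    bits false a b o p = z≤n
    bits true true b o p = ≤-trans (s≤s z≤n) (m≤n+m _ ⟦ true ∧ ((not true ∧ o) ∧ (not b ∧ p)) ⟧)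
    bits true false true o p = ≤-trans (≤-trans (s≤s z≤n) (m≤n+m _ (0 + ⟦ true ∧ (true ∧ not p) ⟧))) (m≤n+m _ ⟦ true ∧ ((true ∧ o) ∧ false) ⟧)
    bits true false false true true = ≤-refl
    bits true false false true false = ≤-refl
    bits true false false false true = ≤-refl
    bits true false false false false = s≤s z≤n
    cell : ∀ u v → ⟦ G u v ⟧ ≤ ⟦ E u v ⟧ + (f u v + f v u)
    cell u v = subst (λ g → ⟦ G u v ⟧ ≤ ⟦ E u v ⟧ + (f u v + (⟦ inZ v ⟧ + ⟦ not (inZ v) ∧ (g ∧ not (O u)) ⟧)))
      (symm u v) (bits (G u v) (inZ u) (inZ v) (O u) (O v))
    row : ∀ u → sum (f u) ≤ ⟦ inZ u ⟧ * N + τ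
    row u with u ∈? Z
    ... | yes _ = ≤-trans (≤-reflexive (trans (sum-const N 1) (trans (*-identityʳ N) (sym (+-identityʳ N))))) (m≤m+n (N + 0) τ)
    ... | no u∉ = loss u u∉
    half : sum (λ u → sum (f u)) ≤ (length Z + τ) * N
    half = begin
      sum (λ u → sum (f u))                          ≤⟨ sum-mono row ⟩
      sum (λ u → ⟦ inZ u ⟧ * N + τ)                  ≡⟨ ∑-distrib-+ (λ u → ⟦ inZ u ⟧ * N) (λ _ → τ) ⟩
      sum (λ u → ⟦ inZ u ⟧ * N) + sum {N} (λ _ → τ)  ≡⟨ cong₂ _+_ (sym (*-distribʳ-sum N (λ u → ⟦ inZ u ⟧))) (trans (sum-const N τ) (*-comm N τ)) ⟩
      # inZ * N + τ * N                              ≤⟨ +-monoˡ-≤ (τ * N) (*-monoˡ-≤ N (#-listed Z)) ⟩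
      length Z * N + τ * N                           ≡⟨ *-distribʳ-+ N (length Z) τ ⟨
      (length Z + τ) * N                             ∎

  -- Connectors and hubs are set aside before the components are formed. The same ones serve every
  -- component, since a single cycle in any of them is already a contradiction.
  structure : ∀ t g b h θ₁ θ₂ q₁ q₂ ℓ W T σ → 2 ≤ g → g ≤ t → 4 * t ≡ suc b * g → 1 ≤ θ₁ → 1 ≤ θ₂ → N ≤ q₁ * θ₁ → N ≤ q₂ * θ₂ →
    ℓ ≡ 2 * q₁ + 2 * (q₁ * q₁) → W ≡ suc (suc b) * ℓ + 3 → W ≤ T → W ≤ 2 * h → q₂ ^ T * (2 * suc T) < σ → 2 * h + σ ≤ 4 * t →
    2 * ((suc (suc b) * ℓ + T * q₂) + (suc (suc b) * (2 * θ₁) + T * θ₂)) ≤ g → ¬ ClosedWalk (2 * h) →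
    ∃₂ λ (E : Graph N) (κ : V → V) → (∀ u v → E u v ≡ true → Adj u v) × (∀ u v → E u v ≡ true → κ u ≡ κ v)
      × total G ≤ total E + g * N × (∀ i → Bounded t g (# (λ v → κ v == i)) (edges E (λ v → κ v == i)))
  structure t g b h θ₁ θ₂ q₁ q₂ ℓ W T σ 2≤g g≤t n≡ 1≤θ₁ 1≤θ₂ N≤₁ N≤₂ ℓ≡ W≡ W≤T W≤n big long small none
    with connectors q₁ 1≤θ₁ N≤₁ ℓ≡ (suc (suc b)) []
  ... | Zc , C ∷ cs with hubs θ₂ 1≤θ₂ T Zc
  ... | Z , hs = E , proj₁ comp , (λ u v e → proj₁ (∧-true e)) , proj₂ (proj₂ comp) , loss , bounded
    where
    O : VSet N
    O v = allOk (C ∷ cs) v ∧ allHit hs v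
    A : VSet N
    A v = not (listed Z v) ∧ O v
    E = restrict A
    comp = components E (restrict-sym A)
    alive : ∀ v → A v ≡ true → Alive (C ∷ cs) hs v
    alive v p with v ∈? Z
    ... | no v∉ = v∉ , ∧-true p
    inE : ∀ u v → E u v ≡ true → Adj u v × Alive (C ∷ cs) hs u × Alive (C ∷ cs) hs v
    inE u v e = let uv , q = ∧-true {G u v} e ; au , av = ∧-true {A u} q in uv , alive u au , alive v av
    τ = suc (suc b) * (2 * θ₁) + T * θ₂
    missing : ∀ v → v ∉ Z → # (λ u → G v u ∧ not (O u)) ≤ τ
    missing v v∉ = ≤-trans (sum-mono λ u → ∧-loss (G v u) (allOk (C ∷ cs) u) (allHit hs u))
      (≤-trans (≤-reflexive (∑-distrib-+ (λ u → ⟦ G v u ∧ not (allOk (C ∷ cs) u) ⟧) (λ u → ⟦ G v u ∧ not (allHit hs u) ⟧)))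
        (+-mono-≤ (connectors-loss (C ∷ cs) v (v∉ ∘ hubs-⊆ hs)) (hubs-loss hs v v∉)))
    Z≤ : length Z ≤ suc (suc b) * ℓ + T * q₂
    Z≤ = ≤-trans (hubs-size q₂ 1≤θ₂ N≤₂ hs) (+-monoˡ-≤ (T * q₂) (connectors-size (C ∷ cs)))
    loss : total G ≤ total E + g * N
    loss = ≤-trans (restrict-loss Z O τ missing) (+-monoʳ-≤ (total E)
      (≤-trans (≤-reflexive (sym (*-assoc 2 (length Z + τ) N))) (*-monoˡ-≤ N (≤-trans (*-monoʳ-≤ 2 (+-monoˡ-≤ τ Z≤)) small))))
    bounded : ∀ i → Bounded t g (# (λ v → proj₁ comp v == i)) (edges E (λ v → proj₁ comp v == i))
    bounded i = few-edges (λ v → proj₁ comp v == i) t g b 2≤g g≤t n≡ (N * N) E (restrict-sym A) (m≤n+m _ _) uncovered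
      where
      uncovered : ¬ Covered E (λ v → proj₁ comp v == i) (4 * t) (suc b)
      uncovered (Q , uQ , sQ , longQ , few) = none (close-up C cs hs E (restrict-sym A) inE q₂ 1≤θ₂ N≤₂ h W σ W≡ W≤T W≤n big
          Q uQ aliveQ few walks (≤-trans long longQ))
        where
        walks : ∀ {x y} → x ∈ Q → y ∈ Q → ∃ λ π → Walk E π x y
        walks {x} {y} p q = proj₁ (proj₂ comp) x y (trans (==-sound (All.lookup sQ p)) (sym (==-sound (All.lookup sQ q))))
        aliveQ : ∀ {x} → x ∈ Q → Alive (C ∷ cs) hs x
        -- A walk leads from `x` to a second vertex of `Q`, so `x` has an edge in `E`; isolated
        -- vertices, such as those of `Z`, are excluded in this way.
        aliveQ {x} p = let y , q , x≢y = other uQ (≤-trans 2≤g (≤-trans g≤t (≤-trans (m≤m+n t _) longQ))) p ; z , e = walk-edge (proj₂ (walks p q)) x≢y in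
          proj₁ (proj₂ (inE x z e))

-- Counting edges in one colour

sum-squares : ∀ M {n} (x : Fin n → ℕ) → (∀ i → x i ≤ M) → ∀ q r → r ≤ M → sum x ≤ q * M + r →
  sum (λ i → x i * x i) ≤ q * (M * M) + r * r
sum-squares M {zero} x x≤ q r r≤ h = z≤n
sum-squares M {suc n} x x≤ q r r≤ h with ≤-total (x zero) r
-- The extreme case has `q` entries `M` and one `r`. An entry a ≤ r is taken out of the remainder,
-- as a² + (r - a)² ≤ r². A larger one is charged to a full `M`, and the difference is moved to the
-- remainder.
... | inj₁ le with m≤n⇒∃[o]m+o≡n le
...   | d , refl = ≤-trans (+-monoʳ-≤ (x zero * x zero) (sum-squares M (x ∘ suc) (x≤ ∘ suc) q d (m+n≤o⇒n≤o (x zero) r≤) (lin _ _ _ h (ring₁ (x zero) d (q * M) _))))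
                 (lin _ _ _ (≤-refl {0}) (ring₂ (x zero) d (q * (M * M))))
  where
  ring₁ : ∀ a d q s → q + d + (a + s) ≡ s + (q + (a + d)) + 0
  ring₁ = solve-∀
  ring₂ : ∀ a d q → q + (a + d) * (a + d) + 0 ≡ a * a + (q + d * d) + 0 + 2 * (a * d)
  ring₂ = solve-∀
sum-squares M {suc n} x x≤ q r r≤ h | inj₂ ge with m≤n⇒∃[o]m+o≡n (x≤ zero) | m≤n⇒∃[o]m+o≡n ge
sum-squares M {suc n} x x≤ zero r r≤ h | inj₂ ge | d , refl | f , eq =
  ≤-trans (+-mono-≤ (≤-trans (*-monoˡ-≤ (x zero) x≤r) (*-monoʳ-≤ r x≤r)) (≤-trans (sum-squares M (x ∘ suc) (x≤ ∘ suc) 0 0 z≤n rest) z≤n))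
    (≤-reflexive (+-identityʳ _))
  where
  x≤r : x zero ≤ r
  x≤r = m+n≤o⇒m≤o (x zero) h
  rest : sum (x ∘ suc) ≤ 0
  rest = +-cancelˡ-≤ (x zero) _ _ (≤-trans h (≤-trans ge (≤-reflexive (sym (+-identityʳ _)))))
sum-squares M {suc n} x x≤ (suc q) r r≤ h | inj₂ ge | d , dM | f , eq =
  ≤-trans (+-monoʳ-≤ (x zero * x zero) (sum-squares M (x ∘ suc) (x≤ ∘ suc) q (d + r) dr≤
      (+-cancelˡ-≤ (x zero) _ _ (≤-trans h (≤-reflexive (trans (cong (λ m → m + q * M + r) (sym dM)) (ring₁ (x zero) d r (q * M))))))))
    (subst (λ m → x zero * x zero + (q * (M * M) + (d + r) * (d + r)) ≤ m * m + q * (M * M) + r * r) dM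
      (lin _ _ 0 (*-monoʳ-≤ (2 * d) ge) (ring₂ (x zero) d r (q * (M * M)))))
  where
  dr≤ : d + r ≤ M
  dr≤ = subst (d + r ≤_) dM (≤-trans (+-monoʳ-≤ d ge) (≤-reflexive (+-comm d _)))
  ring₁ : ∀ a d r q → a + d + q + r ≡ a + (q + (d + r))
  ring₁ = solve-∀
  ring₂ : ∀ a d r q → (a + d) * (a + d) + q + r * r + 2 * d * r ≡ a * a + (q + (d + r) * (d + r)) + 2 * d * a + 0
  ring₂ = solve-∀

fibres : ∀ {m n} (κ : Fin n → Fin m) (f : Fin m → ℕ) → sum (λ x → f (κ x)) ≡ sum (λ i → # (λ x → κ x == i) * f i)
fibres κ f = trans (sum-cong-≗ (λ x → sym (sum-δ f (κ x)))) (trans (∑-comm (λ x i → ⟦ i == κ x ⟧ * f i))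
  (sum-cong-≗ (λ i → trans (sum-cong-≗ (λ x → cong (λ e → ⟦ e ⟧ * f i) (==-sym i (κ x)))) (sym (*-distribʳ-sum (f i) (λ x → ⟦ κ x == i ⟧))))))

module Colour {N : ℕ} (E : Graph N) (κ : Fin N → Fin N) (joined : ∀ u v → E u v ≡ true → κ u ≡ κ v) where

  size : Fin N → ℕ
  size i = # (λ v → κ v == i)

  sum-size : sum size ≡ N
  sum-size = trans (sum-cong-≗ (λ i → sym (*-identityʳ (size i)))) (trans (sym (fibres κ (λ _ → 1))) (trans (sum-const N 1) (*-identityʳ N)))

  total≤edges : total E ≤ sum (λ i → edges E (λ v → κ v == i))
  total≤edges = begin
    sum (λ x → sum (λ y → ⟦ E x y ⟧))                   ≤⟨ sum-mono (λ x → sum-mono (λ y → cell x y)) ⟩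
    sum (λ x → sum (λ y → sum (λ i → c i x y)))         ≡⟨ sum-cong-≗ (λ x → ∑-comm (λ y i → c i x y)) ⟩
    sum (λ x → sum (λ i → sum (λ y → c i x y)))         ≡⟨ ∑-comm (λ x i → sum (λ y → c i x y)) ⟩
    sum (λ i → edges E (λ v → κ v == i))                ∎
    where
    open ≤-Reasoning
    c : Fin N → Fin N → Fin N → ℕ
    c i x y = ⟦ (κ x == i) ∧ ((κ y == i) ∧ E x y) ⟧
    cell : ∀ x y → ⟦ E x y ⟧ ≤ sum (λ i → c i x y)
    cell x y with E x y in e
    ... | false = z≤n
    ... | true = ≤-trans (≤-reflexive (sym (cong₂ (λ a b → ⟦ a ∧ (b ∧ true) ⟧) (==-refl (κ x)) (trans (cong (_== κ x) (sym (joined x y e))) (==-refl (κ x))))))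
                   (term≤sum (λ i → ⟦ (κ x == i) ∧ ((κ y == i) ∧ true) ⟧) (κ x))

  module _ (t g : ℕ) (bounded : ∀ i → Bounded t g (size i) (edges E (λ v → κ v == i))) where

    -- A component of size v ≤ 4t has at most v² pairs; beyond that both bounds lie below 4tv up to
    -- the error.
    linear : ∀ i → edges E (λ v → κ v == i) ≤ 4 * t * size i + 4 * g * size i
    linear i with ≤-total (size i) (4 * t)
    ... | inj₁ le = ≤-trans (edges≤#² E _) (≤-trans (*-monoˡ-≤ (size i) le) (m≤m+n _ _))
    ... | inj₂ ge with ≤-total (size i) (5 * t)
    ...   | inj₁ le = ≤-trans (proj₁ (bounded i) le) (lin _ _ _ (*-monoʳ-≤ (4 * t) ge) (ring t g (size i)))
      where
      ring : ∀ t g v → 4 * t * v + 4 * g * v + 4 * t * (4 * t) ≡ 16 * (t * t) + 4 * (g * v) + 4 * t * v + 0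
      ring = solve-∀
    ...   | inj₂ ge′ = ≤-trans (m≤m+n _ (4 * (t * t))) (≤-trans (proj₂ (bounded i) ge′) (≤-reflexive (ring t g (size i))))
      where
      ring : ∀ t g v → 4 * (t * v) + 4 * (g * v) ≡ 4 * t * v + 4 * g * v
      ring = solve-∀

    giant : ∀ j → 5 * t ≤ size j → total E + 4 * (t * t) ≤ 4 * t * N + 4 * g * N
    giant j ge = begin
      total E + 4 * (t * t)
        ≤⟨ +-mono-≤ total≤edges (≤-reflexive (sym (sum-δ (λ _ → 4 * (t * t)) j))) ⟩
      sum (λ i → edges E (λ v → κ v == i)) + sum (λ i → ⟦ i == j ⟧ * (4 * (t * t)))
        ≡⟨ ∑-distrib-+ (λ i → edges E (λ v → κ v == i)) (λ i → ⟦ i == j ⟧ * (4 * (t * t))) ⟨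
      sum (λ i → edges E (λ v → κ v == i) + ⟦ i == j ⟧ * (4 * (t * t)))
        ≤⟨ sum-mono cell ⟩
      sum (λ i → 4 * t * size i + 4 * g * size i)
        ≡⟨ ∑-distrib-+ (λ i → 4 * t * size i) (λ i → 4 * g * size i) ⟩
      sum (λ i → 4 * t * size i) + sum (λ i → 4 * g * size i)
        ≡⟨ cong₂ _+_ (trans (sym (*-distribˡ-sum (4 * t) size)) (cong (4 * t *_) sum-size)) (trans (sym (*-distribˡ-sum (4 * g) size)) (cong (4 * g *_) sum-size)) ⟩
      4 * t * N + 4 * g * N ∎
      where
      open ≤-Reasoning
      ring : ∀ t g v → 4 * (t * v) + 4 * (g * v) ≡ 4 * t * v + 4 * g * v
      ring = solve-∀
      cell : ∀ i → edges E (λ v → κ v == i) + ⟦ i == j ⟧ * (4 * (t * t)) ≤ 4 * t * size i + 4 * g * size i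
      cell i with i Fin.≟ j
      ... | yes refl = ≤-trans (+-monoʳ-≤ (edges E (λ v → κ v == j)) (≤-reflexive (+-identityʳ (4 * (t * t))))) (≤-trans (proj₂ (bounded j) ge) (≤-reflexive (ring t g (size j))))
      ... | no _ = ≤-trans (≤-reflexive (+-identityʳ _)) (linear i)

    -- By the first bound a component of size between 4t and 5t has, up to the error, no more pairs
    -- than a clique of size 4t; its further vertices are wasted.
    capped : Fin N → ℕ
    capped i = size i ⊓ (4 * t)

    excess : Fin N → ℕ
    excess i = size i ∸ 4 * t

    capped+excess : sum capped + sum excess ≡ N
    capped+excess = trans (sym (∑-distrib-+ capped excess)) (trans (sum-cong-≗ (λ i → trans (cong (_+ excess i) (⊓-comm (size i) (4 * t))) (m⊓n+n∸m≡n (4 * t) (size i)))) sum-size)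

    dwarfs : (∀ i → size i ≤ 5 * t) → total E ≤ sum (λ i → capped i * capped i) + 4 * g * N
    dwarfs small = ≤-trans total≤edges (≤-trans (sum-mono cell) (≤-reflexive
        (trans (∑-distrib-+ (λ i → capped i * capped i) (λ i → 4 * g * size i)) (cong (sum (λ i → capped i * capped i) +_)
          (trans (sym (*-distribˡ-sum (4 * g) size)) (cong (4 * g *_) sum-size))))))
      where
      ring : ∀ t g v → 16 * (t * t) + 4 * (g * v) ≡ 4 * t * (4 * t) + 4 * g * v
      ring = solve-∀
      cell : ∀ i → edges E (λ v → κ v == i) ≤ capped i * capped i + 4 * g * size i
      cell i with ≤-total (size i) (4 * t)
      ... | inj₁ le rewrite m≤n⇒m⊓n≡m le = ≤-trans (edges≤#² E _) (m≤m+n _ _)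
      ... | inj₂ ge rewrite m≥n⇒m⊓n≡n ge = ≤-trans (proj₁ (bounded i) (small i)) (≤-reflexive (ring t g (size i)))

    square-excess : (∀ i → size i ≤ 5 * t) → sum (λ i → size i * excess i) ≤ 5 * t * sum excess
    square-excess small = ≤-trans (sum-mono (λ i → *-monoˡ-≤ (excess i) (small i))) (≤-reflexive (sym (*-distribˡ-sum (5 * t) excess)))

    sum-size² : sum (λ i → size i * size i) ≤ 4 * t * N + sum (λ i → size i * excess i)
    sum-size² = ≤-trans (sum-mono cell) (≤-reflexive (trans (∑-distrib-+ (λ i → 4 * t * size i) (λ i → size i * excess i))
        (cong (_+ sum (λ i → size i * excess i)) (trans (sym (*-distribˡ-sum (4 * t) size)) (cong (4 * t *_) sum-size)))))
      where
      cell : ∀ i → size i * size i ≤ 4 * t * size i + size i * excess i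
      cell i = ≤-trans (*-monoʳ-≤ (size i) (m≤n+m∸n (size i) (4 * t))) (≤-reflexive (trans (*-distribˡ-+ (size i) (4 * t) (excess i)) (cong (_+ size i * excess i) (*-comm (size i) (4 * t)))))

-- Dense colours, and why two of them collide

am-gm : ∀ a b → 2 * (a * b) ≤ a * a + b * b
am-gm a b with ≤-total a b
... | inj₁ le with m≤n⇒∃[o]m+o≡n le
...   | d , refl = ≤-trans (m≤m+n _ (d * d)) (≤-reflexive (ring a d))
  where ring : ∀ a d → 2 * (a * (a + d)) + d * d ≡ a * a + (a + d) * (a + d)
        ring = solve-∀
am-gm a b | inj₂ le with m≤n⇒∃[o]m+o≡n le
...   | d , refl = ≤-trans (m≤m+n _ (d * d)) (≤-reflexive (ring b d))
  where ring : ∀ b d → 2 * ((b + d) * b) + d * d ≡ (b + d) * (b + d) + b * b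
        ring = solve-∀

-- (M - a) (M - b) ≥ - M ((a ∸ M) + (b ∸ M)), with all terms moved to the positive side.
product-bound : ∀ M a b → M * a + M * b ≤ a * b + M * (a ∸ M) + M * (b ∸ M) + M * M
product-bound M a b with ≤-total a M | ≤-total b M
... | inj₂ ge | _ with m≤n⇒∃[o]m+o≡n ge
...   | d , refl rewrite m+n∸m≡n M d = lin _ _ _ z≤n (ring M d b (b ∸ M))
  where ring : ∀ M d b c → (M + d) * b + M * d + M * c + M * M + 0 ≡ M * (M + d) + M * b + 0 + (d * b + M * c)
        ring = solve-∀
product-bound M a b | inj₁ _ | inj₂ ge with m≤n⇒∃[o]m+o≡n ge
...   | d , refl rewrite m+n∸m≡n M d = lin _ _ _ z≤n (ring M d a (a ∸ M))
  where ring : ∀ M d a c → a * (M + d) + M * c + M * d + M * M + 0 ≡ M * a + M * (M + d) + 0 + (a * d + M * c)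
        ring = solve-∀
product-bound M a b | inj₁ le | inj₁ le′ with m≤n⇒∃[o]m+o≡n le | m≤n⇒∃[o]m+o≡n le′
...   | d , refl | f , eq = lin _ _ _ (≤-reflexive (cong (d *_) eq)) (ring a b d f ((a + d) * (a ∸ (a + d))) ((a + d) * (b ∸ (a + d))))
  where
  ring : ∀ a b d f p q → a * b + p + q + (a + d) * (a + d) + d * (b + f) ≡ (a + d) * a + (a + d) * b + d * (a + d) + (d * f + p + q)
  ring = solve-∀

fibres₂ : ∀ {n} (κ μ : Fin n → Fin n) (f : Fin n → Fin n → ℕ) →
  sum (λ x → f (κ x) (μ x)) ≡ sum (λ i → sum (λ j → # (λ x → (κ x == i) ∧ (μ x == j)) * f i j))
fibres₂ κ μ f = begin
  sum (λ x → f (κ x) (μ x))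
    ≡⟨ sum-cong-≗ (λ x → trans (sum-cong-≗ (λ i → cong (⟦ i == κ x ⟧ *_) (sum-δ (f i) (μ x)))) (sum-δ (λ i → f i (μ x)) (κ x))) ⟨
  sum (λ x → sum (λ i → ⟦ i == κ x ⟧ * sum (λ j → ⟦ j == μ x ⟧ * f i j)))
    ≡⟨ ∑-comm (λ x i → ⟦ i == κ x ⟧ * sum (λ j → ⟦ j == μ x ⟧ * f i j)) ⟩
  sum (λ i → sum (λ x → ⟦ i == κ x ⟧ * sum (λ j → ⟦ j == μ x ⟧ * f i j)))
    ≡⟨ sum-cong-≗ (λ i → sum-cong-≗ (λ x → *-distribˡ-sum ⟦ i == κ x ⟧ (λ j → ⟦ j == μ x ⟧ * f i j))) ⟩
  sum (λ i → sum (λ x → sum (λ j → ⟦ i == κ x ⟧ * (⟦ j == μ x ⟧ * f i j))))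
    ≡⟨ sum-cong-≗ (λ i → ∑-comm (λ x j → ⟦ i == κ x ⟧ * (⟦ j == μ x ⟧ * f i j))) ⟩
  sum (λ i → sum (λ j → sum (λ x → ⟦ i == κ x ⟧ * (⟦ j == μ x ⟧ * f i j))))
    ≡⟨ sum-cong-≗ (λ i → sum-cong-≗ (λ j → trans (sum-cong-≗ (λ x → cell i j x)) (sym (*-distribʳ-sum (f i j) (λ x → ⟦ (κ x == i) ∧ (μ x == j) ⟧))))) ⟩
  sum (λ i → sum (λ j → # (λ x → (κ x == i) ∧ (μ x == j)) * f i j)) ∎
  where
  open ≡-Reasoning
  bits : ∀ a b c → ⟦ a ⟧ * (⟦ b ⟧ * c) ≡ ⟦ a ∧ b ⟧ * c
  bits true b c = +-identityʳ _
  bits false b c = refl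
  cell : ∀ i j x → ⟦ i == κ x ⟧ * (⟦ j == μ x ⟧ * f i j) ≡ ⟦ (κ x == i) ∧ (μ x == j) ⟧ * f i j
  cell i j x = trans (bits (i == κ x) (j == μ x) (f i j)) (cong₂ (λ a b → ⟦ a ∧ b ⟧ * f i j) (==-sym i (κ x)) (==-sym j (μ x)))

-- The target length is 4t = 8u, and N = (k - 1/4) 8u + s for k = K + 1 colours.
module Compact {N : ℕ} (E : Graph N) (κ : Fin N → Fin N) (joined : ∀ u v → E u v ≡ true → κ u ≡ κ v)
  (u g s K : ℕ) (N≡ : N ≡ 8 * (u * K) + 6 * u + s) (s≤u : s ≤ u) (1≤u : 1 ≤ u)
  (bounded : ∀ i → Bounded (2 * u) g (# (λ v → κ v == i)) (edges E (λ v → κ v == i)))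
  (dense : 4 * (2 * u) * N + 4 * g * N < total E + 4 * (2 * u * (2 * u))) where

  open Colour E κ joined

  small : ∀ i → size i ≤ 5 * (2 * u)
  small i = ≮⇒≥ λ lt → <⇒≱ dense (giant (2 * u) g bounded i (<⇒≤ lt))

  private
    c = capped (2 * u) g bounded
    x = excess (2 * u) g bounded
    c≤ : ∀ i → c i ≤ 4 * (2 * u)
    c≤ i = m⊓n≤n (size i) (4 * (2 * u))

  squares : 4 * (2 * u) * N < sum (λ i → c i * c i) + 4 * (2 * u * (2 * u))
  squares = +-cancelʳ-< (4 * g * N) _ _ (<-≤-trans dense (≤-trans (+-monoˡ-≤ _ (dwarfs (2 * u) g bounded small)) (≤-reflexive (ring (sum (λ i → c i * c i)) (4 * g * N) _))))
    where
    ring : ∀ a b c → a + b + c ≡ a + c + b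
    ring = solve-∀

  -- If `u` vertices were wasted, the squares would be at most those of K parts of size 8u and one
  -- of size 5u + s. Since 25u² + 16u² falls short of 48u² by more than the terms in s ≤ u, the
  -- colour would not be dense.
  little-excess : sum x ≤ u
  little-excess = ≮⇒≥ λ lt → <⇒≱ squares (contra (<⇒≤ lt))
    where
    contra : u ≤ sum x → sum (λ i → c i * c i) + 4 * (2 * u * (2 * u)) ≤ 4 * (2 * u) * N
    contra le = ≤-trans (+-monoˡ-≤ _ (sum-squares (4 * (2 * u)) c c≤ K (5 * u + s) r≤ tot))
        (subst (λ n → K * (4 * (2 * u) * (4 * (2 * u))) + (5 * u + s) * (5 * u + s) + 4 * (2 * u * (2 * u)) ≤ 4 * (2 * u) * n) (sym N≡)
          (lin _ _ _ (+-mono-≤ (*-monoʳ-≤ (2 * u) s≤u) (*-mono-≤ s≤u s≤u)) (ring u s K)))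
      where
      r≤ : 5 * u + s ≤ 4 * (2 * u)
      r≤ = lin _ _ _ s≤u (ring₀ u s)
        where
        ring₀ : ∀ u s → 4 * (2 * u) + s ≡ 5 * u + s + u + 2 * u
        ring₀ = solve-∀
      tot : sum c ≤ K * (4 * (2 * u)) + (5 * u + s)
      tot = lin _ _ _ (+-mono-≤ le (≤-reflexive (trans (capped+excess (2 * u) g bounded) N≡))) (ring₁ u s K (sum c) (sum x))
        where
        ring₁ : ∀ u s K a b → K * (4 * (2 * u)) + (5 * u + s) + (u + (a + b)) ≡ a + (b + (8 * (u * K) + 6 * u + s)) + 0
        ring₁ = solve-∀
      ring : ∀ u s K → 4 * (2 * u) * (8 * (u * K) + 6 * u + s) + (2 * u * s + s * s)
        ≡ K * (4 * (2 * u) * (4 * (2 * u))) + (5 * u + s) * (5 * u + s) + 4 * (2 * u * (2 * u)) + (2 * u * u + u * u) + 4 * (u * u)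
      ring = solve-∀

  -- The extreme case, K parts of size 8u and one of size 6u + s, exceeds the bound for ordinary
  -- colours by exactly (2u + s)².
  almost : total E + 4 * (2 * u * (2 * u)) ≤ 4 * (2 * u) * N + 4 * g * N + (2 * u + s) * (2 * u + s)
  almost = ≤-trans (+-monoˡ-≤ _ (≤-trans (dwarfs (2 * u) g bounded small) (+-monoˡ-≤ _ (sum-squares (4 * (2 * u)) c c≤ K (6 * u + s) r≤ tot))))
      (lin _ _ _ (≤-reflexive (cong (4 * (2 * u) *_) (sym N≡))) (ring u s K g N))
    where
    r≤ : 6 * u + s ≤ 4 * (2 * u)
    r≤ = lin _ _ _ s≤u (ring₀ u s)
      where
      ring₀ : ∀ u s → 4 * (2 * u) + s ≡ 6 * u + s + u + u
      ring₀ = solve-∀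
    tot : sum c ≤ K * (4 * (2 * u)) + (6 * u + s)
    tot = lin _ _ _ (≤-reflexive (trans (capped+excess (2 * u) g bounded) N≡)) (ring₁ u s K (sum c) (sum x))
      where
      ring₁ : ∀ u s K a b → K * (4 * (2 * u)) + (6 * u + s) + (a + b) ≡ a + (8 * (u * K) + 6 * u + s) + b
      ring₁ = solve-∀
    ring : ∀ u s K g N → 4 * (2 * u) * N + 4 * g * N + (2 * u + s) * (2 * u + s) + 4 * (2 * u) * (8 * (u * K) + 6 * u + s)
      ≡ K * (4 * (2 * u) * (4 * (2 * u))) + (6 * u + s) * (6 * u + s) + 4 * g * N + 4 * (2 * u * (2 * u)) + 4 * (2 * u) * N + 0
    ring = solve-∀

  X : ℕ
  X = sum (λ i → size i * (size i ∸ 4 * (2 * u)))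

  X≤ : X ≤ 10 * (u * u)
  X≤ = ≤-trans (square-excess (2 * u) g bounded small) (≤-trans (*-monoʳ-≤ (5 * (2 * u)) little-excess) (≤-reflexive (ring u)))
    where
    ring : ∀ u → 5 * (2 * u) * u ≡ 10 * (u * u)
    ring = solve-∀

  SS : ℕ
  SS = sum (λ i → size i * size i)

  SS≤ : SS ≤ 4 * (2 * u) * N + X
  SS≤ = sum-size² (2 * u) g bounded

-- O counts the ordered pairs inside a common component of the two colours; a family of
-- N/8u equal parts in both colours would give O = (8u)² > 52u².
no-overlap : ∀ N u O Q Π A B → 1 ≤ u → 30 * u ≤ N → let M = 4 * (2 * u) in
  O + Q ≤ 52 * (u * u) → M * M * N ≤ Π + M * Q → 2 * (N * Π) ≤ N * N * O + A * B →
  A ≤ M * N + 10 * (u * u) → B ≤ M * N + 10 * (u * u) → ⊥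
no-overlap N u O Q Π A B 1≤u 30u≤N h₁ h₂ h₃ h₄ h₅ with m≤n⇒∃[o]m+o≡n 30u≤N
... | w , refl = <⇒≱ (m<m+n Y pos) (≤-trans (≤-reflexive (ring₅ u w)) (≤-trans (*-monoʳ-≤ (2 * N) h₂) step₃))
  where
  M = 4 * (2 * u)
  L = M * N + 10 * (u * u)
  Y = N * N * (52 * (u * u)) + L * L
  -- The difference of 2M²N² and `Y`, namely u²(12N² - 160uN - 100u²), written out at N = 30u + w.
  R = 5900 * (u * u * (u * u)) + (560 * (u * u * (u * w)) + 12 * (u * u * (w * w)))
  pos : 0 < R
  pos = ≤-trans (≤-trans (*-mono-≤ (*-mono-≤ 1≤u 1≤u) (*-mono-≤ 1≤u 1≤u)) (m≤n*m (u * u * (u * u)) 5900)) (m≤m+n _ _)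
  ring₅ : ∀ u w → (30 * u + w) * (30 * u + w) * (52 * (u * u)) + (4 * (2 * u) * (30 * u + w) + 10 * (u * u)) * (4 * (2 * u) * (30 * u + w) + 10 * (u * u))
      + (5900 * (u * u * (u * u)) + (560 * (u * u * (u * w)) + 12 * (u * u * (w * w))))
    ≡ 2 * (30 * u + w) * (4 * (2 * u) * (4 * (2 * u)) * (30 * u + w))
  ring₅ = solve-∀
  2M≤N : 2 * M ≤ N
  2M≤N = ≤-trans (lin _ _ _ (≤-refl {0}) (ring u)) (m≤m+n (30 * u) w)
    where
    ring : ∀ u → 30 * u + 0 ≡ 2 * (4 * (2 * u)) + 0 + 14 * u
    ring = solve-∀
  step₃ : 2 * N * (Π + M * Q) ≤ Y
  step₃ = begin
    2 * N * (Π + M * Q)                        ≡⟨ ring₁ N Π M Q ⟩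
    2 * (N * Π) + N * (2 * M) * Q              ≤⟨ +-mono-≤ h₃ (*-monoˡ-≤ Q (*-monoʳ-≤ N 2M≤N)) ⟩
    N * N * O + A * B + N * N * Q              ≡⟨ ring₂ (N * N) O (A * B) Q ⟩
    N * N * (O + Q) + A * B                    ≤⟨ +-mono-≤ (*-monoʳ-≤ (N * N) h₁) (*-mono-≤ h₄ h₅) ⟩
    Y                                          ∎
    where
    open ≤-Reasoning
    ring₁ : ∀ N Π M Q → 2 * N * (Π + M * Q) ≡ 2 * (N * Π) + N * (2 * M) * Q
    ring₁ = solve-∀
    ring₂ : ∀ n O a Q → n * O + a + n * Q ≡ n * (O + Q) + a
    ring₂ = solve-∀

module Pair {N : ℕ} (E₁ : Graph N) (κ : Fin N → Fin N) (joined₁ : ∀ u v → E₁ u v ≡ true → κ u ≡ κ v)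
  (E₂ : Graph N) (μ : Fin N → Fin N) (joined₂ : ∀ u v → E₂ u v ≡ true → μ u ≡ μ v)
  (disjoint : ∀ x y → E₁ x y ≡ true → E₂ x y ≡ true → ⊥) where

  private
    V = Fin N
    a = Colour.size E₁ κ joined₁
    b = Colour.size E₂ μ joined₂

  common : V → V → ℕ
  common i j = # (λ v → (κ v == i) ∧ (μ v == j))

  shared : ℕ
  shared = sum (λ i → sum (λ j → common i j * common i j))

  -- Inclusion and exclusion: the disjoint edge sets lie in the union of the two partition
  -- relations, whose intersection has `shared` pairs.
  union : total E₁ + total E₂ + shared ≤ sum (λ i → a i * a i) + sum (λ j → b j * b j)
  union = begin
    total E₁ + total E₂ + shared
      ≡⟨ cong (total E₁ + total E₂ +_) (fibres₂ κ μ common) ⟨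
    total E₁ + total E₂ + sum (λ x → common (κ x) (μ x))
      ≡⟨ cong (_+ sum (λ x → common (κ x) (μ x))) (∑-distrib-+ (λ x → # (E₁ x)) (λ x → # (E₂ x))) ⟨
    sum (λ x → # (E₁ x) + # (E₂ x)) + sum (λ x → common (κ x) (μ x))
      ≡⟨ ∑-distrib-+ (λ x → # (E₁ x) + # (E₂ x)) (λ x → common (κ x) (μ x)) ⟨
    sum (λ x → # (E₁ x) + # (E₂ x) + common (κ x) (μ x))
      ≤⟨ sum-mono row ⟩
    sum (λ x → a (κ x) + b (μ x))
      ≡⟨ ∑-distrib-+ (λ x → a (κ x)) (λ x → b (μ x)) ⟩
    sum (λ x → a (κ x)) + sum (λ x → b (μ x))
      ≡⟨ cong₂ _+_ (fibres κ a) (fibres μ b) ⟩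
    sum (λ i → a i * a i) + sum (λ j → b j * b j) ∎
    where
    open ≤-Reasoning
    bits : ∀ e f p q → (e ≡ true → p ≡ true) → (f ≡ true → q ≡ true) → (e ≡ true → f ≡ true → ⊥) →
      ⟦ e ⟧ + ⟦ f ⟧ + ⟦ p ∧ q ⟧ ≤ ⟦ p ⟧ + ⟦ q ⟧
    bits true true p q _ _ d = ⊥-elim (d refl refl)
    bits true false p q hp _ _ rewrite hp refl = ≤-refl
    bits false true p q _ hq _ rewrite hq refl | Boolₚ.∧-identityʳ p = ≤-reflexive (+-comm 1 ⟦ p ⟧)
    bits false false true q _ _ _ = n≤1+n ⟦ q ⟧
    bits false false false q _ _ _ = z≤n
    row : ∀ x → # (E₁ x) + # (E₂ x) + common (κ x) (μ x) ≤ a (κ x) + b (μ x)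
    row x = begin
      # (E₁ x) + # (E₂ x) + common (κ x) (μ x)
        ≡⟨ cong (_+ common (κ x) (μ x)) (∑-distrib-+ (λ y → ⟦ E₁ x y ⟧) (λ y → ⟦ E₂ x y ⟧)) ⟨
      sum (λ y → ⟦ E₁ x y ⟧ + ⟦ E₂ x y ⟧) + common (κ x) (μ x)
        ≡⟨ ∑-distrib-+ (λ y → ⟦ E₁ x y ⟧ + ⟦ E₂ x y ⟧) (λ y → ⟦ (κ y == κ x) ∧ (μ y == μ x) ⟧) ⟨
      sum (λ y → ⟦ E₁ x y ⟧ + ⟦ E₂ x y ⟧ + ⟦ (κ y == κ x) ∧ (μ y == μ x) ⟧)
        ≤⟨ sum-mono (λ y → bits (E₁ x y) (E₂ x y) (κ y == κ x) (μ y == μ x)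
             (λ e → trans (cong (_== κ x) (sym (joined₁ x y e))) (==-refl (κ x)))
             (λ e → trans (cong (_== μ x) (sym (joined₂ x y e))) (==-refl (μ x))) (disjoint x y)) ⟩
      sum (λ y → ⟦ κ y == κ x ⟧ + ⟦ μ y == μ x ⟧)
        ≡⟨ ∑-distrib-+ (λ y → ⟦ κ y == κ x ⟧) (λ y → ⟦ μ y == μ x ⟧) ⟩
      a (κ x) + b (μ x) ∎

  mixed : ℕ
  mixed = sum (λ x → a (κ x) * b (μ x))

  -- Apply 2xy ≤ x² + y² with x the overlap of two classes times `N` and y the product of their
  -- sizes, which agree for independent partitions. Summed over all pairs of classes, y² factors.
  cauchy : 2 * (N * mixed) ≤ N * N * shared + sum (λ i → a i * a i) * sum (λ j → b j * b j)
  cauchy = begin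
    2 * (N * mixed)
      ≡⟨ cong (λ m → 2 * (N * m)) (fibres₂ κ μ (λ i j → a i * b j)) ⟩
    2 * (N * sum (λ i → sum (λ j → common i j * (a i * b j))))
      ≡⟨ trans (sym (*-assoc 2 N _)) (trans (*-distribˡ-sum (2 * N) (λ i → sum (λ j → common i j * (a i * b j)))) (sum-cong-≗ (λ i → *-distribˡ-sum (2 * N) (λ j → common i j * (a i * b j))))) ⟩
    sum (λ i → sum (λ j → 2 * N * (common i j * (a i * b j))))
      ≤⟨ sum-mono (λ i → sum-mono (λ j → cell (common i j) (a i) (b j))) ⟩
    sum (λ i → sum (λ j → N * N * (common i j * common i j) + a i * a i * (b j * b j)))
      ≡⟨ trans (sum-cong-≗ (λ i → ∑-distrib-+ (λ j → N * N * (common i j * common i j)) (λ j → a i * a i * (b j * b j)))) (∑-distrib-+ (λ i → sum (λ j → N * N * (common i j * common i j))) (λ i → sum (λ j → a i * a i * (b j * b j)))) ⟩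
    sum (λ i → sum (λ j → N * N * (common i j * common i j))) + sum (λ i → sum (λ j → a i * a i * (b j * b j)))
      ≡⟨ cong₂ _+_ (trans (sum-cong-≗ (λ i → sym (*-distribˡ-sum (N * N) (λ j → common i j * common i j)))) (sym (*-distribˡ-sum (N * N) (λ i → sum (λ j → common i j * common i j)))))
           (trans (sum-cong-≗ (λ i → sym (*-distribˡ-sum (a i * a i) (λ j → b j * b j)))) (sym (*-distribʳ-sum (sum (λ j → b j * b j)) (λ i → a i * a i)))) ⟩
    N * N * shared + sum (λ i → a i * a i) * sum (λ j → b j * b j) ∎
    where
    open ≤-Reasoning
    cell : ∀ o p q → 2 * N * (o * (p * q)) ≤ N * N * (o * o) + p * p * (q * q)
    cell o p q = ≤-trans (≤-reflexive (ring₁ N o p q)) (≤-trans (am-gm (N * o) (p * q)) (≤-reflexive (ring₂ N o p q)))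
      where
      ring₁ : ∀ N o p q → 2 * N * (o * (p * q)) ≡ 2 * (N * o * (p * q))
      ring₁ = solve-∀
      ring₂ : ∀ N o p q → N * o * (N * o) + p * q * (p * q) ≡ N * N * (o * o) + p * p * (q * q)
      ring₂ = solve-∀

  -- Sums `product-bound` over the vertices: when both sums of squares are near MN and the excess is
  -- small, `mixed` is not far below M²N.
  mixed≥ : ∀ M → M * (sum (λ i → a i * a i) + sum (λ j → b j * b j)) ≤
    mixed + M * (sum (λ i → a i * (a i ∸ M)) + sum (λ j → b j * (b j ∸ M))) + M * M * N
  mixed≥ M = begin
    M * (sum (λ i → a i * a i) + sum (λ j → b j * b j))
      ≡⟨ cong (M *_) (cong₂ _+_ (fibres κ a) (fibres μ b)) ⟨
    M * (sum (λ x → a (κ x)) + sum (λ x → b (μ x)))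
      ≡⟨ trans (*-distribˡ-+ M (sum (λ x → a (κ x))) (sum (λ x → b (μ x)))) (cong₂ _+_ (*-distribˡ-sum M (λ x → a (κ x))) (*-distribˡ-sum M (λ x → b (μ x)))) ⟩
    sum (λ x → M * a (κ x)) + sum (λ x → M * b (μ x))
      ≡⟨ ∑-distrib-+ (λ x → M * a (κ x)) (λ x → M * b (μ x)) ⟨
    sum (λ x → M * a (κ x) + M * b (μ x))
      ≤⟨ sum-mono (λ x → product-bound M (a (κ x)) (b (μ x))) ⟩
    sum (λ x → a (κ x) * b (μ x) + M * (a (κ x) ∸ M) + M * (b (μ x) ∸ M) + M * M)
      ≡⟨ trans (∑-distrib-+ (λ x → a (κ x) * b (μ x) + M * (a (κ x) ∸ M) + M * (b (μ x) ∸ M)) (λ _ → M * M))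
           (cong₂ _+_ (trans (∑-distrib-+ (λ x → a (κ x) * b (μ x) + M * (a (κ x) ∸ M)) (λ x → M * (b (μ x) ∸ M)))
             (cong₂ _+_ (trans (∑-distrib-+ (λ x → a (κ x) * b (μ x)) (λ x → M * (a (κ x) ∸ M)))
                (cong (mixed +_) (trans (sym (*-distribˡ-sum M (λ x → a (κ x) ∸ M))) (cong (M *_) (fibres κ (λ i → a i ∸ M))))))
                (trans (sym (*-distribˡ-sum M (λ x → b (μ x) ∸ M))) (cong (M *_) (fibres μ (λ i → b i ∸ M))))))
              (trans (sum-const N (M * M)) (*-comm N (M * M)))) ⟩
    mixed + M * sum (λ i → a i * (a i ∸ M)) + M * sum (λ j → b j * (b j ∸ M)) + M * M * N
      ≡⟨ ring mixed M (sum (λ i → a i * (a i ∸ M))) (sum (λ j → b j * (b j ∸ M))) (M * M * N) ⟩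
    mixed + M * (sum (λ i → a i * (a i ∸ M)) + sum (λ j → b j * (b j ∸ M))) + M * M * N ∎
    where
    open ≤-Reasoning
    ring : ∀ p M x y n → p + M * x + M * y + n ≡ p + M * (x + y) + n
    ring = solve-∀

  not-both : ∀ u g s K → N ≡ 8 * (u * K) + 6 * u + s → s ≤ u → 1 ≤ u → 3 ≤ K →
    (∀ i → Bounded (2 * u) g (a i) (edges E₁ (λ v → κ v == i))) → (∀ i → Bounded (2 * u) g (b i) (edges E₂ (λ v → μ v == i))) →
    4 * (2 * u) * N + 4 * g * N < total E₁ + 4 * (2 * u * (2 * u)) → 4 * (2 * u) * N + 4 * g * N < total E₂ + 4 * (2 * u * (2 * u)) → ⊥
  not-both u g s K N≡ s≤u 1≤u 3≤K bd₁ bd₂ d₁ d₂ with m≤n⇒∃[o]m+o≡n (+-mono-≤ C₁.SS≤ C₂.SS≤)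
    where
    module C₁ = Compact E₁ κ joined₁ u g s K N≡ s≤u 1≤u bd₁ d₁
    module C₂ = Compact E₂ μ joined₂ u g s K N≡ s≤u 1≤u bd₂ d₂
  -- `Q` is the amount by which the two sums of squares together fall short of their upper bounds.
  ... | Q , eq = no-overlap N u shared Q mixed C₁.SS C₂.SS 1≤u 30u≤N h₁ h₂ cauchy
        (≤-trans C₁.SS≤ (+-monoʳ-≤ _ C₁.X≤)) (≤-trans C₂.SS≤ (+-monoʳ-≤ _ C₂.X≤))
    where
    module C₁ = Compact E₁ κ joined₁ u g s K N≡ s≤u 1≤u bd₁ d₁
    module C₂ = Compact E₂ μ joined₂ u g s K N≡ s≤u 1≤u bd₂ d₂
    M = 4 * (2 * u)
    30u≤N : 30 * u ≤ N
    30u≤N = subst (30 * u ≤_) (sym N≡) (lin _ _ _ (*-monoʳ-≤ (8 * u) 3≤K) (ring u s K))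
      where
      ring : ∀ u s K → 8 * (u * K) + 6 * u + s + 8 * u * 3 ≡ 30 * u + 8 * u * K + s
      ring = solve-∀
    -- Twice 16u² from the density and twice 10u² from the excess.
    h₁ : shared + Q ≤ 52 * (u * u)
    h₁ = lin _ _ _ (+-mono-≤ (+-mono-≤ (+-mono-≤ (<⇒≤ d₁) (<⇒≤ d₂)) union) (+-mono-≤ (≤-reflexive eq) (+-mono-≤ C₁.X≤ C₂.X≤)))
      (ring (M * N) (4 * g * N) (total E₁) (total E₂) shared C₁.SS C₂.SS Q C₁.X C₂.X u)
      where
      ring : ∀ m g e f o p q r x y u → 52 * (u * u) + ((m + g) + (m + g) + (e + f + o) + (p + q + r + (x + y)))
        ≡ o + r + ((e + 4 * (2 * u * (2 * u))) + (f + 4 * (2 * u * (2 * u))) + (p + q) + (m + x + (m + y) + (10 * (u * u) + 10 * (u * u)))) + 2 * g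
      ring = solve-∀
    h₂ : M * M * N ≤ mixed + M * Q
    h₂ = lin _ _ 0 (+-mono-≤ (mixed≥ M) (≤-reflexive (cong (M *_) (sym eq))))
      (ring mixed M N C₁.SS C₂.SS Q C₁.X C₂.X)
      where
      ring : ∀ p M N a b Q x y → p + M * Q + (M * (a + b) + M * (M * N + x + (M * N + y))) ≡
        M * M * N + (p + M * (x + y) + M * M * N + M * (a + b + Q)) + 0
      ring = solve-∀

-- All colours together

counting : ∀ {K N} u g s → N ≡ 8 * (u * K) + 6 * u + s → s ≤ u → 1 ≤ u → 3 ≤ K → N + 5 * (suc K * (g * N)) < 8 * (u * (K * s)) →
  (E : Fin (suc K) → Graph N) (κ : Fin (suc K) → Fin N → Fin N) → (∀ i x y → E i x y ≡ true → κ i x ≡ κ i y) →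
  (∀ i l → Bounded (2 * u) g (# (λ v → κ i v == l)) (edges (E i) (λ v → κ i v == l))) →
  (∀ i j → i ≢ j → ∀ x y → E i x y ≡ true → E j x y ≡ true → ⊥) →
  (m : Fin (suc K) → ℕ) → (∀ i → m i ≤ total (E i) + g * N) → sum m + N ≡ N * N → ⊥
counting {K} {N} u g s N≡ s≤u 1≤u 3≤K gap E κ joined bounded disjoint m m≤ all = <⇒≱ gap final
  where
  D = 4 * (2 * u) * N + 4 * g * N
  q = 4 * (2 * u * (2 * u))
  r = (2 * u + s) * (2 * u + s)
  exceptional : ∃ λ j → ∀ i → total (E i) + q ≤ D + ⟦ i == j ⟧ * r
  exceptional with Finₚ.any? (λ i → D <? total (E i) + q)
  -- Without an exceptional colour any index will do.
  ... | no none = zero , λ i → ≤-trans (≮⇒≥ λ lt → none (i , lt)) (m≤m+n D _)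
  ... | yes (j , dj) = j , bound
    where
    bound : ∀ i → total (E i) + q ≤ D + ⟦ i == j ⟧ * r
    bound i with i Fin.≟ j
    ... | yes refl = ≤-trans (Compact.almost (E i) (κ i) (joined i) u g s K N≡ s≤u 1≤u (bounded i) dj) (≤-reflexive (cong (D +_) (sym (+-identityʳ r))))
    ... | no i≢j = ≤-trans (≮⇒≥ λ di → Pair.not-both (E i) (κ i) (joined i) (E j) (κ j) (joined j) (disjoint i j i≢j)
            u g s K N≡ s≤u 1≤u 3≤K (bounded i) (bounded j) di dj) (m≤m+n D _)
  summed : sum (λ i → total (E i)) + suc K * q ≤ suc K * D + r
  summed with exceptional
  ... | j , bound = begin
    sum (λ i → total (E i)) + suc K * q            ≡⟨ cong (sum (λ i → total (E i)) +_) (sum-const (suc K) q) ⟨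
    sum (λ i → total (E i)) + sum {suc K} (λ _ → q) ≡⟨ ∑-distrib-+ (λ i → total (E i)) (λ _ → q) ⟨
    sum (λ i → total (E i) + q)                    ≤⟨ sum-mono bound ⟩
    sum (λ i → D + ⟦ i == j ⟧ * r)                 ≡⟨ ∑-distrib-+ (λ _ → D) (λ i → ⟦ i == j ⟧ * r) ⟩
    sum {suc K} (λ _ → D) + sum (λ i → ⟦ i == j ⟧ * r) ≡⟨ cong₂ _+_ (sum-const (suc K) D) (sum-δ (λ _ → r) j) ⟩
    suc K * D + r                                  ∎
    where open ≤-Reasoning
  mass : N * N ≤ sum (λ i → total (E i)) + suc K * (g * N) + N
  mass = begin
    N * N                                              ≡⟨ all ⟨
    sum m + N                                          ≤⟨ +-monoˡ-≤ N (sum-mono m≤) ⟩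
    sum (λ i → total (E i) + g * N) + N                ≡⟨ cong (_+ N) (trans (∑-distrib-+ (λ i → total (E i)) (λ _ → g * N)) (cong (sum (λ i → total (E i)) +_) (sum-const (suc K) (g * N)))) ⟩
    sum (λ i → total (E i)) + suc K * (g * N) + N      ∎
    where open ≤-Reasoning
  -- At s = 0 the main terms for one exceptional and K ordinary colours add up to exactly N²; the
  -- `s` vertices leave 8uKs for the errors.
  square : N * N + suc K * q ≡ suc K * (4 * (2 * u) * N) + r + 8 * (u * (K * s))
  square = subst (λ n → n * n + suc K * q ≡ suc K * (4 * (2 * u) * n) + r + 8 * (u * (K * s))) (sym N≡) (ring u s K)
    where
    ring : ∀ u s K → (8 * (u * K) + 6 * u + s) * (8 * (u * K) + 6 * u + s) + suc K * (4 * (2 * u * (2 * u)))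
      ≡ suc K * (4 * (2 * u) * (8 * (u * K) + 6 * u + s)) + (2 * u + s) * (2 * u + s) + 8 * (u * (K * s))
    ring = solve-∀
  final : 8 * (u * (K * s)) ≤ N + 5 * (suc K * (g * N))
  final = lin _ _ 0 (+-mono-≤ (+-mono-≤ mass summed) (≤-reflexive (sym square)))
    (ring N g K (4 * (2 * u) * N) q r (8 * (u * (K * s))) (sum (λ i → total (E i))))
    where
    ring : ∀ N g K d q r e A → N + 5 * (suc K * (g * N)) + (N * N + (A + suc K * q) + (suc K * d + r + e))
      ≡ e + (A + suc K * (g * N) + N + (suc K * (d + 4 * g * N) + r) + (N * N + suc K * q)) + 0
    ring = solve-∀

-- From closed chains to monochromatic cycles

at : ∀ {A : Set} → A → List A → ℕ → A
at d [] i = d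
at d (x ∷ l) zero = x
at d (x ∷ l) (suc i) = at d l i

chain-at : ∀ {A : Set} {R : A → A → Set} {a l b} → Chain R a l b → ∀ d i → i < length l → R (at d (a ∷ l) i) (at d (a ∷ l) (suc i))
chain-at (r ∷ c) d zero _ = r
chain-at (r ∷ c) d (suc i) (s≤s lt) = chain-at c d i lt

at-++ : ∀ {A : Set} d (l l′ : List A) i → i < length l → at d (l ++ l′) i ≡ at d l i
at-++ d (x ∷ l) l′ zero _ = refl
at-++ d (x ∷ l) l′ (suc i) (s≤s lt) = at-++ d l l′ i lt

at-end : ∀ {A : Set} d (l : List A) x → at d (l ++ x ∷ []) (length l) ≡ x
at-end d [] x = refl
at-end d (y ∷ l) x = at-end d l x

at-∈ : ∀ {A : Set} d (l : List A) i → i < length l → at d l i ∈ l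
at-∈ d (x ∷ l) zero _ = here refl
at-∈ d (x ∷ l) (suc i) (s≤s lt) = there (at-∈ d l i lt)

at-injective : ∀ {A : Set} d (l : List A) → Unique l → ∀ i j → i < length l → j < length l → at d l i ≡ at d l j → i ≡ j
at-injective d (x ∷ l) u zero zero _ _ _ = refl
at-injective d (x ∷ l) (x∉ ∷ _) zero (suc j) _ (s≤s lt) eq = ⊥-elim (All.lookup x∉ (at-∈ d l j lt) eq)
at-injective d (x ∷ l) (x∉ ∷ _) (suc i) zero (s≤s lt) _ eq = ⊥-elim (All.lookup x∉ (at-∈ d l i lt) (sym eq))
at-injective d (x ∷ l) (_ ∷ u) (suc i) (suc j) (s≤s p) (s≤s q) eq = cong suc (at-injective d l u i j p q eq)

-- Vectors can be searched exhaustively. A decision is needed to get an actual cycle from the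
-- refutation of a colouring without one.
vec-any? : ∀ {N} n {P : Vec (Fin N) n → Set} → (∀ v → Dec (P v)) → Dec (∃ P)
vec-any? zero P? with P? []
... | yes p = yes ([] , p)
... | no ¬p = no λ { ([] , p) → ¬p p }
vec-any? (suc n) P? with Finₚ.any? (λ x → vec-any? n (λ v → P? (x ∷ v)))
... | yes (x , v , p) = yes (x ∷ v , p)
... | no ¬p = no λ { (x ∷ v , p) → ¬p (x , v , p) }

module Colouring {k N : ℕ} (c : Fin N → Fin N → Fin k) (c-sym : IsEdgeColouring k N c) where

  private V = Fin N

  graph : Fin k → Graph N
  graph i x y = not (x == y) ∧ (c x y == i)

  graph-sym : ∀ i x y → graph i x y ≡ graph i y x
  graph-sym i x y = cong₂ (λ a b → not a ∧ (b == i)) (==-sym x y) (c-sym x y)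

  graph-irr : ∀ i x → graph i x x ≡ false
  graph-irr i x rewrite ==-refl x = refl

  graph-colour : ∀ i x y → graph i x y ≡ true → c x y ≡ i
  graph-colour i x y e = ==-sound (proj₂ (∧-true {not (x == y)} e))

  graph-total : sum (λ i → total (graph i)) + N ≡ N * N
  graph-total = begin
    sum (λ i → total (graph i)) + N
      ≡⟨ cong₂ _+_ (trans (∑-comm (λ i x → # (graph i x))) (sum-cong-≗ (λ x → ∑-comm (λ i y → ⟦ graph i x y ⟧)))) (sym diagonal) ⟩
    sum (λ x → sum (off x)) + sum (λ x → sum (on x))
      ≡⟨ ∑-distrib-+ (λ x → sum (off x)) (λ x → sum (on x)) ⟨
    sum (λ x → sum (off x) + sum (on x))
      ≡⟨ sum-cong-≗ {N} (λ x → trans (sym (∑-distrib-+ (off x) (on x)))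
           (trans (sum-cong-≗ (cell x)) (trans (sum-const N 1) (*-identityʳ N)))) ⟩
    sum {N} (λ _ → N)
      ≡⟨ sum-const N N ⟩
    N * N ∎
    where
    open ≡-Reasoning
    off on : V → V → ℕ
    off x y = sum (λ i → ⟦ graph i x y ⟧)
    on x y = ⟦ y == x ⟧ * 1
    diagonal : sum (λ x → sum (on x)) ≡ N
    diagonal = trans (sum-cong-≗ {N} (λ x → sum-δ (λ _ → 1) x)) (trans (sum-const N 1) (*-identityʳ N))
    cell : ∀ x y → off x y + on x y ≡ 1
    cell x y rewrite ==-sym y x with x Fin.≟ y
    ... | yes _ = cong (_+ 1) (trans (sum-const k 0) (*-zeroʳ k))
    ... | no _ = trans (+-identityʳ _) (trans (sum-cong-≗ {k} (λ i → trans (cong ⟦_⟧ (==-sym (c x y) i)) (sym (*-identityʳ _)))) (sum-δ {k} (λ _ → 1) (c x y)))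

  module _ (n : ℕ) where

    mono-cycle? : Dec (Σ (Fin k) (MonoCycle c n))
    mono-cycle? with Finₚ.any? (λ col → vec-any? n (λ v →
        Finₚ.all? (λ i → Finₚ.all? (λ j → (lookup v i Fin.≟ lookup v j) →-dec (i Fin.≟ j)))
        ×-dec Finₚ.all? (λ i → Finₚ.all? (λ j →
          ((suc (Fin.toℕ i) ≟ Fin.toℕ j) ⊎-dec ((suc (Fin.toℕ i) ≟ n) ×-dec (Fin.toℕ j ≟ 0))) →-dec (c (lookup v i) (lookup v j) Fin.≟ col)))))
    ... | yes (col , v , inj , adj) = yes (col , lookup v , (λ {i} {j} → inj i j) , adj)
    ... | no none = no λ { (col , f , inj , adj) → none (col , tabulate f ,
            (λ i j eq → inj (trans (sym (lookup∘tabulate f i)) (trans eq (lookup∘tabulate f j)))) ,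
            (λ i j a → trans (cong₂ c (lookup∘tabulate f i) (lookup∘tabulate f j)) (adj i j a))) }

  closed-walk-cycle : ∀ i n → Closing.ClosedWalk (graph i) (graph-sym i) (graph-irr i) n → MonoCycle c n i
  closed-walk-cycle i n (x , L , ch , u , refl) = (λ a → w (Fin.toℕ a)) , inj , adj
    where
    -- The list repeats `x` at its end, so position `n` is the start again and the closing edge is a
    -- step like the others.
    w : ℕ → V
    w = at x (x ∷ (L ++ x ∷ []))
    w-prefix : ∀ (a : Fin (suc (length L))) → w (Fin.toℕ a) ≡ at x (x ∷ L) (Fin.toℕ a)
    w-prefix a = at-++ x (x ∷ L) (x ∷ []) (Fin.toℕ a) (Finₚ.toℕ<n a)
    inj : ∀ {a b} → w (Fin.toℕ a) ≡ w (Fin.toℕ b) → a ≡ b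
    inj {a} {b} eq = Finₚ.toℕ-injective (at-injective x (x ∷ L) u _ _ (Finₚ.toℕ<n a) (Finₚ.toℕ<n b)
      (trans (sym (w-prefix a)) (trans eq (w-prefix b))))
    next : ∀ (a : Fin (suc (length L))) → c (w (Fin.toℕ a)) (w (suc (Fin.toℕ a))) ≡ i
    next a = graph-colour i _ _ (chain-at ch x (Fin.toℕ a)
      (subst (Fin.toℕ a <_) (sym (trans (length-++ L) (+-comm (length L) 1))) (Finₚ.toℕ<n a)))
    adj : ∀ a b → CycleAdj (suc (length L)) a b → c (w (Fin.toℕ a)) (w (Fin.toℕ b)) ≡ i
    adj a b (inj₁ eq) = trans (cong (λ m → c (w (Fin.toℕ a)) (w m)) (sym eq)) (next a)
    adj a b (inj₂ (eq , eq₀)) = trans (cong (c (w (Fin.toℕ a))) (trans (cong w eq₀) (sym (trans (cong w eq) (at-end x (x ∷ L) x))))) (next a)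

-- Choice of the parameters

arrows : ∀ K u g s b h θ₁ θ₂ q₁ q₂ ℓ W T σ → let N = 8 * (u * K) + 6 * u + s in
  3 ≤ K → s ≤ u → 1 ≤ u → N + 5 * (suc K * (g * N)) < 8 * (u * (K * s)) →
  2 ≤ g → g ≤ 2 * u → 4 * (2 * u) ≡ suc b * g → 1 ≤ θ₁ → 1 ≤ θ₂ → N ≤ q₁ * θ₁ → N ≤ q₂ * θ₂ →
  ℓ ≡ 2 * q₁ + 2 * (q₁ * q₁) → W ≡ suc (suc b) * ℓ + 3 → W ≤ T → W ≤ 2 * h → q₂ ^ T * (2 * suc T) < σ → 2 * h + σ ≤ 4 * (2 * u) →
  2 * ((suc (suc b) * ℓ + T * q₂) + (suc (suc b) * (2 * θ₁) + T * θ₂)) ≤ g →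
  Arrows (suc K) (2 * h) N
arrows K u g s b h θ₁ θ₂ q₁ q₂ ℓ W T σ 3≤K s≤u 1≤u gap 2≤g g≤t n≡ 1≤θ₁ 1≤θ₂ N≤₁ N≤₂ ℓ≡ W≡ W≤T W≤n big long small c c-sym
  with Colouring.mono-cycle? c c-sym (2 * h)
... | yes cycle = cycle
... | no none = ⊥-elim (counting u g s refl s≤u 1≤u 3≤K gap
        (λ i → proj₁ (st i)) (λ i → proj₁ (proj₂ (st i))) (λ i → proj₁ (proj₂ (proj₂ (proj₂ (st i)))))
        (λ i → proj₂ (proj₂ (proj₂ (proj₂ (proj₂ (st i))))))
        (λ i j i≢j x y e e′ → i≢j (trans (sym (graph-colour i x y (proj₁ (proj₂ (proj₂ (st i))) x y e))) (graph-colour j x y (proj₁ (proj₂ (proj₂ (st j))) x y e′))))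
        (λ i → total (graph i)) (λ i → proj₁ (proj₂ (proj₂ (proj₂ (proj₂ (st i)))))) graph-total)
  where
  open Colouring c c-sym
  st = λ i → Structure.structure (graph i) (graph-sym i) (graph-irr i) (2 * u) g b h θ₁ θ₂ q₁ q₂ ℓ W T σ
    2≤g g≤t n≡ 1≤θ₁ 1≤θ₂ N≤₁ N≤₂ ℓ≡ W≡ W≤T W≤n big long small (λ cw → none (i , closed-walk-cycle i (2 * h) cw))

scaled-arrows : ∀ K z c b G n q ℓ T r σ θ h → 3 ≤ K → 1 ≤ z → c ≡ 6 * (suc K * suc K) → suc b ≡ 8 * (z * c) →
  G ≡ 4 * suc (suc b) + 3 → n ≡ 8 * (z * K) + 6 * z + 1 → q ≡ n * (c * G) → ℓ ≡ 2 * q + 2 * (q * q) →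
  T ≡ suc (suc b) * ℓ + 3 → r ≡ q * T → r ^ T * (2 * suc T) < σ → 1 ≤ θ → 2 * (suc (suc b) * ℓ + T * r) ≤ T * θ →
  let s = c * (G * (T * θ)) in T ≤ 2 * h → 2 * h + σ ≤ 8 * (z * s) →
  Arrows (suc K) (2 * h) (8 * (z * s * K) + 6 * (z * s) + s)
scaled-arrows K z c b G n q ℓ T r σ θ h 3≤K 1≤z c≡ b≡ G≡ n≡ q≡ ℓ≡ T≡ r≡ big 1≤θ roomy T≤ long =
  arrows K u g s b h θ₁ θ q r ℓ T T σ 3≤K s≤u 1≤u gap 2≤g g≤2u 8u≡ 1≤θ₁ 1≤θ (≤-reflexive N≡₁) (≤-reflexive N≡₂)
    ℓ≡ T≡ ≤-refl T≤ big (≤-trans long (≤-reflexive (ring₀ u))) small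
  where
  θ₁ = T * θ
  g = G * θ₁
  s = c * g
  u = z * s
  N = 8 * (u * K) + 6 * u + s
  ring₀ : ∀ u → 8 * u ≡ 4 * (2 * u)
  ring₀ = solve-∀
  3≤T : 3 ≤ T
  3≤T = subst (3 ≤_) (sym T≡) (m≤n+m 3 _)
  3≤G : 3 ≤ G
  3≤G = subst (3 ≤_) (sym G≡) (m≤n+m 3 (4 * suc (suc b)))
  1≤θ₁ : 1 ≤ θ₁
  1≤θ₁ = *-mono-≤ (≤-trans (s≤s z≤n) 3≤T) 1≤θ
  1≤c : 1 ≤ c
  1≤c = subst (1 ≤_) (sym c≡) (s≤s z≤n)
  2≤g : 2 ≤ g
  2≤g = *-mono-≤ (≤-trans (s≤s (s≤s z≤n)) 3≤G) 1≤θ₁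
  1≤s : 1 ≤ s
  1≤s = *-mono-≤ 1≤c (≤-trans (s≤s z≤n) 2≤g)
  s≤u : s ≤ u
  s≤u = ≤-trans (≤-reflexive (sym (*-identityˡ s))) (*-monoˡ-≤ s 1≤z)
  1≤u : 1 ≤ u
  1≤u = ≤-trans 1≤s s≤u
  g≤s : g ≤ s
  g≤s = ≤-trans (≤-reflexive (sym (*-identityˡ g))) (*-monoˡ-≤ g 1≤c)
  g≤2u : g ≤ 2 * u
  g≤2u = ≤-trans g≤s (≤-trans s≤u (m≤m+n u _))
  8u≡ : 4 * (2 * u) ≡ suc b * g
  8u≡ = trans (ring z c g) (cong (_* g) (sym b≡))
    where
    ring : ∀ z c g → 4 * (2 * (z * (c * g))) ≡ 8 * (z * c) * g
    ring = solve-∀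
  N≡₁ : N ≡ q * θ₁
  N≡₁ = trans (ring z K c G θ₁) (trans (cong (λ m → m * (c * G) * θ₁) (sym n≡)) (cong (_* θ₁) (sym q≡)))
    where
    ring : ∀ z K c G t → 8 * (z * (c * (G * t)) * K) + 6 * (z * (c * (G * t))) + c * (G * t) ≡ (8 * (z * K) + 6 * z + 1) * (c * G) * t
    ring = solve-∀
  N≡₂ : N ≡ r * θ
  N≡₂ = trans N≡₁ (trans (sym (*-assoc q T θ)) (cong (_* θ) (sym r≡)))
  small : 2 * ((suc (suc b) * ℓ + T * r) + (suc (suc b) * (2 * θ₁) + T * θ)) ≤ g
  small = subst (λ m → 2 * ((suc (suc b) * ℓ + T * r) + (suc (suc b) * (2 * θ₁) + T * θ)) ≤ m * θ₁) (sym G≡)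
    (lin _ _ 0 roomy (ring (suc (suc b)) (suc (suc b) * ℓ + T * r) θ₁))
    where
    ring : ∀ J x t → (4 * J + 3) * t + 2 * x ≡ 2 * (x + (J * (2 * t) + t)) + t + 0
    ring = solve-∀
  -- With k = K + 1 the error is at most 6kg · 8uk = 8us, which is the origin of c = 6k².
  gap : N + 5 * (suc K * (g * N)) < 8 * (u * (K * s))
  gap = ≤-<-trans bound strict
    where
    N≤ : N ≤ 8 * (u * suc K)
    N≤ = lin _ _ _ s≤u (ring u K s)
      where
      ring : ∀ u K s → 8 * (u * suc K) + s ≡ 8 * (u * K) + 6 * u + s + u + u
      ring = solve-∀
    1≤Kg : 1 ≤ suc K * g
    1≤Kg = *-mono-≤ {1} {suc K} (s≤s z≤n) (≤-trans (s≤s z≤n) 2≤g)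
    bound : N + 5 * (suc K * (g * N)) ≤ 8 * (u * s)
    bound = begin
      N + 5 * (suc K * (g * N))                ≡⟨ ring₁ N K g ⟩
      (1 + 5 * (suc K * g)) * N                ≤⟨ *-mono-≤ (+-monoˡ-≤ (5 * (suc K * g)) 1≤Kg) N≤ ⟩
      (suc K * g + 5 * (suc K * g)) * (8 * (u * suc K)) ≡⟨ ring₂ K g u ⟩
      8 * (u * (6 * (suc K * suc K) * g))      ≡⟨ cong (λ m → 8 * (u * (m * g))) (sym c≡) ⟩
      8 * (u * s)                              ∎
      where
      open ≤-Reasoning
      ring₁ : ∀ N K g → N + 5 * (suc K * (g * N)) ≡ (1 + 5 * (suc K * g)) * N
      ring₁ = solve-∀
      ring₂ : ∀ K g u → (suc K * g + 5 * (suc K * g)) * (8 * (u * suc K)) ≡ 8 * (u * (6 * (suc K * suc K) * g))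
      ring₂ = solve-∀
    strict : 8 * (u * s) < 8 * (u * (K * s))
    strict = *-monoʳ-< 8 (<-≤-trans u< (*-monoʳ-≤ u (*-monoˡ-≤ s (≤-trans (s≤s (s≤s z≤n)) 3≤K))))
      where
      u< : u * s < u * (2 * s)
      u< = *-monoʳ-< u {{>-nonZero 1≤u}} (m<m+n s (≤-trans 1≤s (≤-reflexive (sym (+-identityʳ s)))))

-- As n ≥ (8z - 1)s, the vertices in `s` and the gap between n and 8zs raise the density above K +
-- 3/4 by at most a multiple of 1/z; `y` is chosen to keep this below 1/(4M).
ratio : ∀ K M y s n → y ≡ (2 + K) * M → (8 * y + 7) * s ≤ n →
  let z = suc y in 4 * M * (8 * (z * s * K) + 6 * (z * s) + s) ≤ (4 * K + 3) * M * n + n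
ratio K M y s n refl le = ≤-trans (lin _ _ _ z≤n (ring K M s))
  (≤-trans (*-monoʳ-≤ ((4 * K + 3) * M + 1) le) (≤-reflexive (ring′ ((4 * K + 3) * M) n)))
  where
  ring′ : ∀ a n → (a + 1) * n ≡ a * n + n
  ring′ = solve-∀
  ring : ∀ K M s → ((4 * K + 3) * M + 1) * ((8 * ((2 + K) * M) + 7) * s) + 0
    ≡ 4 * M * (8 * (suc ((2 + K) * M) * s * K) + 6 * (suc ((2 + K) * M) * s) + s) + 0 + (4 * (K * M) + 9 * M + 7) * s
  ring = solve-∀

-- `θ` is to be the integer quotient of 2h by `D`, so that (8y + 7)s = θD. The remainder, which is
-- below `D`, and `σ` both fit into the one further `s` in 8u = (8y + 8)s.
module Threshold (K m y c b G n q ℓ T r σ Λ D : ℕ) (3≤K : 3 ≤ K) (y≡ : y ≡ (2 + K) * suc m) (c≡ : c ≡ 6 * (suc K * suc K))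
  (b≡ : suc b ≡ 8 * (suc y * c)) (G≡ : G ≡ 4 * suc (suc b) + 3) (n≡ : n ≡ 8 * (suc y * K) + 6 * suc y + 1) (q≡ : q ≡ n * (c * G))
  (ℓ≡ : ℓ ≡ 2 * q + 2 * (q * q)) (T≡ : T ≡ suc (suc b) * ℓ + 3) (r≡ : r ≡ q * T) (σ> : r ^ T * (2 * suc T) < σ)
  (Λ≡ : Λ ≡ c * (G * T)) (D≡ : D ≡ (8 * y + 7) * Λ) where

  threshold : ℕ
  threshold = D * (D + σ + 2 * (suc (suc b) * ℓ + T * r) + 1) + T

  1≤T : 1 ≤ T
  1≤T = subst (1 ≤_) (sym T≡) (≤-trans (s≤s z≤n) (m≤n+m 3 _))

  1≤Λ : 1 ≤ Λ
  1≤Λ = subst (1 ≤_) (sym Λ≡) (*-mono-≤ (subst (1 ≤_) (sym c≡) (s≤s z≤n))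
    (*-mono-≤ (subst (1 ≤_) (sym G≡) (≤-trans (s≤s z≤n) (m≤n+m 3 (4 * suc (suc b))))) 1≤T))

  1≤D : 1 ≤ D
  1≤D = subst (1 ≤_) (sym D≡) (*-mono-≤ (≤-trans (s≤s z≤n) (m≤n+m 7 (8 * y))) 1≤Λ)

  module _ (h θ : ℕ) (large : threshold ≤ 2 * h) (θD≤ : θ * D ≤ 2 * h) (<θD : 2 * h < D + θ * D) where

    private
      s = c * (G * (T * θ))
      N = 8 * (suc y * s * K) + 6 * (suc y * s) + s

    θ-large : D + σ + 2 * (suc (suc b) * ℓ + T * r) + 1 ≤ θ
    θ-large = s≤s⁻¹ (*-cancelˡ-< D _ _ (≤-<-trans (m+n≤o⇒m≤o _ large) (<-≤-trans <θD (≤-reflexive (trans (cong (D +_) (*-comm θ D)) (sym (*-suc D θ)))))))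

    s≡ : s ≡ Λ * θ
    s≡ = trans (ring c G T θ) (cong (_* θ) (sym Λ≡))
      where
      ring : ∀ c G T θ → c * (G * (T * θ)) ≡ c * (G * T) * θ
      ring = solve-∀

    es≡ : (8 * y + 7) * s ≡ θ * D
    es≡ = trans (cong ((8 * y + 7) *_) s≡) (trans (ring (8 * y + 7) Λ θ) (cong (θ *_) (sym D≡)))
      where
      ring : ∀ e Λ θ → e * (Λ * θ) ≡ θ * (e * Λ)
      ring = solve-∀

    θ≤ : ∀ x → 1 ≤ x → θ ≤ x * θ
    θ≤ x 1≤x = ≤-trans (≤-reflexive (sym (*-identityˡ θ))) (*-monoˡ-≤ θ 1≤x)

    long : 2 * h + σ ≤ 8 * (suc y * s)
    long = begin
      2 * h + σ                          ≤⟨ +-monoˡ-≤ σ (<⇒≤ <θD) ⟩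
      D + θ * D + σ                      ≡⟨ ring₁ D (θ * D) σ ⟩
      D + σ + θ * D                      ≤⟨ +-mono-≤ (≤-trans (≤-trans (m≤m+n (D + σ) _) (m≤m+n _ 1)) (≤-trans θ-large (≤-trans (θ≤ Λ 1≤Λ) (≤-reflexive (sym s≡))))) (≤-reflexive (sym es≡)) ⟩
      s + (8 * y + 7) * s                ≡⟨ ring₂ y s ⟩
      8 * (suc y * s)                    ∎
      where
      open ≤-Reasoning
      ring₁ : ∀ a b c → a + b + c ≡ a + c + b
      ring₁ = solve-∀
      ring₂ : ∀ y s → s + (8 * y + 7) * s ≡ 8 * (suc y * s)
      ring₂ = solve-∀

    bound : Σ ℕ λ R → RamseyLe (suc K) (2 * h) R × (4 * suc m * R ≤ (4 * suc K ∸ 1) * suc m * (2 * h) + 2 * h)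
    bound = N , (N , ≤-refl , arr) , density
      where
      arr : Arrows (suc K) (2 * h) N
      arr = scaled-arrows K (suc y) c b G n q ℓ T r σ θ h 3≤K (s≤s z≤n) c≡ b≡ G≡ n≡ q≡ ℓ≡ T≡ r≡ σ>
        (≤-trans (m≤n+m 1 _) θ-large)
        (≤-trans (≤-trans (m≤n+m _ (D + σ)) (m≤m+n _ 1)) (≤-trans θ-large (θ≤ T 1≤T)))
        (m+n≤o⇒n≤o _ large) long
      density : 4 * suc m * N ≤ (4 * suc K ∸ 1) * suc m * (2 * h) + 2 * h
      density = subst (λ a → 4 * suc m * N ≤ a * suc m * (2 * h) + 2 * h) (sym (cong (_∸ 1) (ring K)))
        (ratio K (suc m) y s (2 * h) y≡ (≤-trans (≤-reflexive es≡) θD≤))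
        where
        ring : ∀ K → 4 * suc K ≡ suc (4 * K + 3)
        ring = solve-∀

-- Naming a number through this lemma keeps it from being unfolded.
named : (x : ℕ) → ∃ λ y → y ≡ x
named x = x , refl

-- The term o(n) in its epsilon form: for every `m` the excess over (k - 1/4)n is at most n/(4(m +
-- 1)) from some point on, with denominators cleared.
theorem2 : (k : ℕ) → 4 ≤ k → (m : ℕ) →
    Σ ℕ λ N₀ → (h : ℕ) → 2 ≤ h → N₀ ≤ 2 * h →
    Σ ℕ λ R → RamseyLe k (2 * h) R ×
    (4 * suc m * R ≤ (4 * k ∸ 1) * suc m * (2 * h) + 2 * h)
theorem2 (suc K) (s≤s 3≤K) m with named ((2 + K) * suc m) | named (6 * (suc K * suc K))
... | y , y≡ | c , c≡ with m≤n⇒∃[o]m+o≡n {1} {8 * (suc y * c)} (*-mono-≤ {1} {8} (s≤s z≤n) (*-mono-≤ {1} {suc y} (s≤s z≤n) (subst (1 ≤_) (sym c≡) (s≤s z≤n))))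
... | b , b≡ with named (4 * suc (suc b) + 3) | named (8 * (suc y * K) + 6 * suc y + 1)
... | G , G≡ | n , n≡ with named (n * (c * G))
... | q , q≡ with named (2 * q + 2 * (q * q))
... | ℓ , ℓ≡ with named (suc (suc b) * ℓ + 3)
... | T , T≡ with named (q * T) | named (c * (G * T))
... | r , r≡ | Λ , Λ≡ with named (suc (r ^ T * (2 * suc T))) | named ((8 * y + 7) * Λ)
... | σ , σ≡ | D , D≡ = P.threshold , λ h _ large →
      P.bound h (2 * h / D) large (m/n*n≤m (2 * h) D)
        (≤-<-trans (≤-reflexive (m≡m%n+[m/n]*n (2 * h) D)) (+-monoˡ-< (2 * h / D * D) (m%n<n (2 * h) D)))
  where
  module P = Threshold K m y c b G n q ℓ T r σ Λ D 3≤K y≡ c≡ b≡ G≡ n≡ q≡ ℓ≡ T≡ r≡ (≤-reflexive (sym σ≡)) Λ≡ D≡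
  instance
    D≢0 : NonZero D
    D≢0 = >-nonZero P.1≤D
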